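{- Let $q\ge1$ and let $w$ be a probability function on $SL_q$ (satisfying Constant Exchangeability). Then $w$ satisfies SPx if and only if there exist $\lambda\ge0$ and probability functions $w_1,w_2$ on $SL_q$, each satisfying ULi with SPx, such that $w=(1+\lambda)w_1-\lambda w_2$.
   Context: $L_q$ is the first-order language with unary predicates $P_1,\dots,P_q$, constants $a_1,a_2,\dots$; $SL_q$ its sentences. Atoms: $\alpha_1,\dots,\alpha_{2^q}$, the formulas $\bigwedge_{i=1}^q\pm P_i(x)$; $\gamma_q(\alpha)$ = number of negated predicates in $\alpha$. State descriptions: $\bigwedge_{i=1}^m\alpha_{h_i}(a_i)$. A probability function on $SL_q$ is $w:SL_q\to[0,1]$ with $w(\top)=1$, $w(\phi\vee\theta)=w(\phi)+w(\theta)$ if $\phi\models\neg\theta$, and $w(\exists x\phi(x))=\lim_n w(\bigvee_{i\le n}\phi(a_i))$. All probability functions are assumed to satisfy Ex (invariance under permutations of constants). Px: invariance under permutations of predicate symbols. P-spectrum of $\Theta=\bigwedge_k\alpha_{h_k}(a_k)$: for each $i\in\{0,\dots,q\}$, $M_i$ is the multiset of sizes of the classes of "$a_k\sim a_l\iff h_k=h_l$" on constants whose atom has exactly $i$ negations; the P-spectrum is $\langle M_0,\dots,M_q\rangle$. SPx: $w(\Theta)=w(\Phi)$ for state descriptions with the same constants and the same P-spectrum. ULi with SPx: there is a family of probability functions $w^{\mathcal L}$, one for each finite unary language $\mathcal L$, each satisfying Ex, Px and SPx, with $w^{L_q}=w$ and $w^{\mathcal L'}\restriction S\mathcal L=w^{\mathcal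 L}$ whenever $\mathcal L\subseteq\mathcal L'$. -}

module Defs where

open import Algebra.Bundles using (CommutativeMonoid)
import Algebra.Properties.CommutativeSemigroup as CommutativeSemigroupProperties
open import Data.Bool.Base using (Bool; true; false; T; if_then_else_)
import Data.Bool.Properties as Bool
open import Data.Fin.Base using (Fin; zero; suc; toℕ)
open import Data.Fin.Permutation using (Permutation′; _⟨$⟩ʳ_)
open import Data.Fin.Properties using (toℕ-injective)
open import Data.List.Base using (List; length; map; filter; deduplicate; allFin)
open import Data.List.Relation.Binary.Permutation.Propositional using (_↭_)
open import Data.Nat.Base as ℕ using (ℕ; zero; suc; _⊔_)
import Data.Nat.Properties as ℕ
open import Data.Product.Base using (Σ; ∃; _×_; _,_; proj₁; proj₂)
open import Data.Rational.Base as ℚ using (ℚ; 0ℚ; 1ℚ; ½; ∣_∣)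
import Data.Rational.Properties as ℚ
open import Data.Sum.Base using (_⊎_)
open import Data.Unit.Base using (⊤)
open import Data.Vec.Base using (Vec; lookup; count)
import Data.Vec.Properties as Vec
open import Function.Base using (id; _∘_)
open import Function.Bundles using (_↔_; Inverse)
open import Function.Definitions using (Injective)
open import Relation.Binary.PropositionalEquality using (_≡_; refl; sym; trans; cong; cong₂; subst₂; module ≡-Reasoning)
open import Relation.Nullary.Decidable.Core using (Dec; T?; decidable-stable)
open import Relation.Nullary.Negation.Core using (¬_)

-- Real numbers: Cauchy sequences of rationals, with _≈_ as equality.

IsCauchy : (ℕ → ℚ) → Set
IsCauchy x = ∀ ε → 0ℚ ℚ.< ε → ∃ λ N → ∀ m n → N ℕ.≤ m → N ℕ.≤ n → ∣ x m ℚ.- x n ∣ ℚ.≤ ε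

record ℝ : Set where
  constructor mkℝ
  field
    seq    : ℕ → ℚ
    cauchy : IsCauchy seq

open ℝ public

open CommutativeSemigroupProperties (CommutativeMonoid.commutativeSemigroup ℚ.+-0-commutativeMonoid) using (interchange)

abstract
  half-pos : ∀ ε → 0ℚ ℚ.< ε → 0ℚ ℚ.< ε ℚ.* ½
  half-pos ε 0<ε = ℚ.positive⁻¹ (ε ℚ.* ½) {{ℚ.pos*pos⇒pos ε {{ℚ.positive 0<ε}} ½}}

  halves : ∀ ε → ε ℚ.* ½ ℚ.+ ε ℚ.* ½ ≡ ε
  halves ε = trans (sym (ℚ.*-distribˡ-+ ε ½ ½)) (ℚ.*-identityʳ ε)

  +-cauchy : ∀ x y → IsCauchy x → IsCauchy y → IsCauchy (λ n → x n ℚ.+ y n)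
  +-cauchy x y cx cy ε 0<ε with cx (ε ℚ.* ½) (half-pos ε 0<ε) | cy (ε ℚ.* ½) (half-pos ε 0<ε)
  ... | M , hx | N , hy = M ⊔ N , λ m n p q →
    let open ℚ.≤-Reasoning in begin
    ∣ (x m ℚ.+ y m) ℚ.- (x n ℚ.+ y n) ∣
      ≡⟨ cong ∣_∣ (rearrange (x m) (y m) (x n) (y n)) ⟩
    ∣ (x m ℚ.- x n) ℚ.+ (y m ℚ.- y n) ∣
      ≤⟨ ℚ.∣p+q∣≤∣p∣+∣q∣ (x m ℚ.- x n) (y m ℚ.- y n) ⟩
    ∣ x m ℚ.- x n ∣ ℚ.+ ∣ y m ℚ.- y n ∣
      ≤⟨ ℚ.+-mono-≤ (hx m n (ℕ.m⊔n≤o⇒m≤o M N p) (ℕ.m⊔n≤o⇒m≤o M N q))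
                    (hy m n (ℕ.m⊔n≤o⇒n≤o M N p) (ℕ.m⊔n≤o⇒n≤o M N q)) ⟩
    ε ℚ.* ½ ℚ.+ ε ℚ.* ½
      ≡⟨ halves ε ⟩
    ε ∎
    where
    rearrange : ∀ a b c d → (a ℚ.+ b) ℚ.- (c ℚ.+ d) ≡ (a ℚ.- c) ℚ.+ (b ℚ.- d)
    rearrange a b c d = trans (cong ((a ℚ.+ b) ℚ.+_) (ℚ.neg-distrib-+ c d)) (interchange a b (ℚ.- c) (ℚ.- d))

  neg-cauchy : ∀ x → IsCauchy x → IsCauchy (λ n → ℚ.- x n)
  neg-cauchy x cx ε 0<ε with cx ε 0<ε
  ... | N , h = N , λ m n p q →
    let open ℚ.≤-Reasoning in begin
    ∣ ℚ.- x m ℚ.- ℚ.- x n ∣ ≡⟨ cong ∣_∣ (sym (ℚ.neg-distrib-+ (x m) (ℚ.- x n))) ⟩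
    ∣ ℚ.- (x m ℚ.- x n) ∣   ≡⟨ ℚ.∣-p∣≡∣p∣ (x m ℚ.- x n) ⟩
    ∣ x m ℚ.- x n ∣         ≤⟨ h m n p q ⟩
    ε ∎

  eventually-bounded : ∀ x → IsCauchy x →
    ∃ λ B → 0ℚ ℚ.< B × ∃ λ N → ∀ n → N ℕ.≤ n → ∣ x n ∣ ℚ.≤ B
  eventually-bounded x cx with cx 1ℚ (ℚ.positive⁻¹ 1ℚ)
  ... | N , h = 1ℚ ℚ.+ ∣ x N ∣
              , ℚ.+-mono-<-≤ (ℚ.positive⁻¹ 1ℚ) (ℚ.0≤∣p∣ (x N))
              , N , λ n p →
    let open ℚ.≤-Reasoning in begin
    ∣ x n ∣                     ≡⟨ cong ∣_∣ (split (x n) (x N)) ⟩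
    ∣ (x n ℚ.- x N) ℚ.+ x N ∣   ≤⟨ ℚ.∣p+q∣≤∣p∣+∣q∣ (x n ℚ.- x N) (x N) ⟩
    ∣ x n ℚ.- x N ∣ ℚ.+ ∣ x N ∣ ≤⟨ ℚ.+-monoˡ-≤ ∣ x N ∣ (h n N p ℕ.≤-refl) ⟩
    1ℚ ℚ.+ ∣ x N ∣ ∎
    where
    split : ∀ a b → a ≡ (a ℚ.- b) ℚ.+ b
    split a b = sym (trans (ℚ.+-assoc a (ℚ.- b) b)
                    (trans (cong (a ℚ.+_) (ℚ.+-inverseˡ b)) (ℚ.+-identityʳ a)))

  *-mono-abs : ∀ p q {r s} → ∣ p ∣ ℚ.≤ r → ∣ q ∣ ℚ.≤ s → ∣ p ℚ.* q ∣ ℚ.≤ r ℚ.* s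
  *-mono-abs p q {r} {s} p≤r q≤s =
    let open ℚ.≤-Reasoning in begin
    ∣ p ℚ.* q ∣     ≡⟨ ℚ.∣p*q∣≡∣p∣*∣q∣ p q ⟩
    ∣ p ∣ ℚ.* ∣ q ∣ ≤⟨ ℚ.*-monoʳ-≤-nonNeg ∣ q ∣ {{ℚ.nonNegative (ℚ.0≤∣p∣ q)}} p≤r ⟩
    r ℚ.* ∣ q ∣     ≤⟨ ℚ.*-monoˡ-≤-nonNeg r {{ℚ.nonNegative (ℚ.≤-trans (ℚ.0≤∣p∣ p) p≤r)}} q≤s ⟩
    r ℚ.* s ∎

  scale : ∀ ε B → 0ℚ ℚ.< ε → 0ℚ ℚ.< B → ∃ λ δ → 0ℚ ℚ.< δ × B ℚ.* δ ≡ ε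
  scale ε B 0<ε 0<B = 1/B ℚ.* ε
    , ℚ.positive⁻¹ (1/B ℚ.* ε) {{ℚ.pos*pos⇒pos 1/B {{ℚ.1/pos⇒pos B}} ε {{ℚ.positive 0<ε}}}}
    , trans (sym (ℚ.*-assoc B 1/B ε)) (trans (cong (ℚ._* ε) (ℚ.*-inverseʳ B)) (ℚ.*-identityˡ ε))
    where
    instance
      B-pos : ℚ.Positive B
      B-pos = ℚ.positive 0<B
      B-nonZero : ℚ.NonZero B
      B-nonZero = ℚ.pos⇒nonZero B
    1/B : ℚ
    1/B = ℚ.1/ B

  *-estimate : ∀ a b c d {A B δ} → ∣ a ∣ ℚ.≤ A → ∣ d ∣ ℚ.≤ B → ∣ a ℚ.- c ∣ ℚ.≤ δ → ∣ b ℚ.- d ∣ ℚ.≤ δ →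
    ∣ a ℚ.* b ℚ.- c ℚ.* d ∣ ℚ.≤ (A ℚ.+ B) ℚ.* δ
  *-estimate a b c d {A} {B} {δ} a≤A d≤B ac bd =
    let open ℚ.≤-Reasoning in begin
    ∣ a ℚ.* b ℚ.- c ℚ.* d ∣
      ≡⟨ cong ∣_∣ rearrange ⟩
    ∣ a ℚ.* (b ℚ.- d) ℚ.+ d ℚ.* (a ℚ.- c) ∣
      ≤⟨ ℚ.∣p+q∣≤∣p∣+∣q∣ (a ℚ.* (b ℚ.- d)) (d ℚ.* (a ℚ.- c)) ⟩
    ∣ a ℚ.* (b ℚ.- d) ∣ ℚ.+ ∣ d ℚ.* (a ℚ.- c) ∣
      ≤⟨ ℚ.+-mono-≤ (*-mono-abs a (b ℚ.- d) a≤A bd) (*-mono-abs d (a ℚ.- c) d≤B ac) ⟩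
    A ℚ.* δ ℚ.+ B ℚ.* δ
      ≡⟨ sym (ℚ.*-distribʳ-+ δ A B) ⟩
    (A ℚ.+ B) ℚ.* δ ∎
    where
    rearrange : a ℚ.* b ℚ.- c ℚ.* d ≡ a ℚ.* (b ℚ.- d) ℚ.+ d ℚ.* (a ℚ.- c)
    rearrange = sym (begin
      a ℚ.* (b ℚ.- d) ℚ.+ d ℚ.* (a ℚ.- c)
        ≡⟨ cong₂ ℚ._+_ (expand a b d) (trans (expand d a c) (ℚ.+-comm (d ℚ.* a) (ℚ.- (d ℚ.* c)))) ⟩
      (a ℚ.* b ℚ.- a ℚ.* d) ℚ.+ (ℚ.- (d ℚ.* c) ℚ.+ d ℚ.* a)
        ≡⟨ interchange (a ℚ.* b) (ℚ.- (a ℚ.* d)) (ℚ.- (d ℚ.* c)) (d ℚ.* a) ⟩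
      (a ℚ.* b ℚ.- d ℚ.* c) ℚ.+ (ℚ.- (a ℚ.* d) ℚ.+ d ℚ.* a)
        ≡⟨ cong₂ (λ u v → (a ℚ.* b ℚ.- u) ℚ.+ (ℚ.- (a ℚ.* d) ℚ.+ v)) (ℚ.*-comm d c) (ℚ.*-comm d a) ⟩
      (a ℚ.* b ℚ.- c ℚ.* d) ℚ.+ (ℚ.- (a ℚ.* d) ℚ.+ a ℚ.* d)
        ≡⟨ cong ((a ℚ.* b ℚ.- c ℚ.* d) ℚ.+_) (ℚ.+-inverseˡ (a ℚ.* d)) ⟩
      (a ℚ.* b ℚ.- c ℚ.* d) ℚ.+ 0ℚ
        ≡⟨ ℚ.+-identityʳ (a ℚ.* b ℚ.- c ℚ.* d) ⟩
      a ℚ.* b ℚ.- c ℚ.* d ∎)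
      where
      open ≡-Reasoning
      expand : ∀ x y z → x ℚ.* (y ℚ.- z) ≡ x ℚ.* y ℚ.- x ℚ.* z
      expand x y z = trans (ℚ.*-distribˡ-+ x y (ℚ.- z)) (cong (x ℚ.* y ℚ.+_) (sym (ℚ.neg-distribʳ-* x z)))

  *-cauchy : ∀ x y → IsCauchy x → IsCauchy y → IsCauchy (λ n → x n ℚ.* y n)
  *-cauchy x y cx cy ε 0<ε =
    let A , 0<A , K , bx = eventually-bounded x cx
        B , 0<B , L , by = eventually-bounded y cy
        δ , 0<δ , eq     = scale ε (A ℚ.+ B) 0<ε (ℚ.+-mono-< 0<A 0<B)
        M , hx           = cx δ 0<δ
        N , hy           = cy δ 0<δ
    in (K ⊔ L) ⊔ (M ⊔ N) , λ m n p q →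
    let p₁ = ℕ.m⊔n≤o⇒m≤o (K ⊔ L) (M ⊔ N) p
        p₂ = ℕ.m⊔n≤o⇒n≤o (K ⊔ L) (M ⊔ N) p
        q₁ = ℕ.m⊔n≤o⇒m≤o (K ⊔ L) (M ⊔ N) q
        q₂ = ℕ.m⊔n≤o⇒n≤o (K ⊔ L) (M ⊔ N) q
    in ℚ.≤-trans
         (*-estimate (x m) (y m) (x n) (y n)
           (bx m (ℕ.m⊔n≤o⇒m≤o K L p₁)) (by n (ℕ.m⊔n≤o⇒n≤o K L q₁))
           (hx m n (ℕ.m⊔n≤o⇒m≤o M N p₂) (ℕ.m⊔n≤o⇒m≤o M N q₂))
           (hy m n (ℕ.m⊔n≤o⇒n≤o M N p₂) (ℕ.m⊔n≤o⇒n≤o M N q₂)))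
         (ℚ.≤-reflexive eq)

infix  4 _≈_ _≤_
infixl 6 _+_ _-_
infixl 7 _*_
infix  8 -_

fromℚ : ℚ → ℝ
fromℚ p .seq _ = p
fromℚ p .cauchy ε 0<ε = 0 , λ _ _ _ _ → subst₂ ℚ._≤_ (sym (cong ∣_∣ (ℚ.+-inverseʳ p))) refl (ℚ.<⇒≤ 0<ε)

0ℝ 1ℝ : ℝ
0ℝ = fromℚ 0ℚ
1ℝ = fromℚ 1ℚ

-_ : ℝ → ℝ
- x = mkℝ (λ n → ℚ.- seq x n) (neg-cauchy (seq x) (cauchy x))

_+_ _-_ _*_ : ℝ → ℝ → ℝ
x + y = mkℝ (λ n → seq x n ℚ.+ seq y n) (+-cauchy (seq x) (seq y) (cauchy x) (cauchy y))
x - y = x + (- y)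
x * y = mkℝ (λ n → seq x n ℚ.* seq y n) (*-cauchy (seq x) (seq y) (cauchy x) (cauchy y))

_≈_ _≤_ : ℝ → ℝ → Set
x ≈ y = ∀ ε → 0ℚ ℚ.< ε → ∃ λ N → ∀ n → N ℕ.≤ n → ∣ seq x n ℚ.- seq y n ∣ ℚ.≤ ε
x ≤ y = ∀ ε → 0ℚ ℚ.< ε → ∃ λ N → ∀ n → N ℕ.≤ n → seq x n ℚ.≤ seq y n ℚ.+ ε

-- ∣ s n - l ∣ ≤ ε is written out as two inequalities.
Limit : (ℕ → ℝ) → ℝ → Set
Limit s l = ∀ ε → 0ℚ ℚ.< ε → ∃ λ N → ∀ n → N ℕ.≤ n →
  s n ≤ l + fromℚ ε × l ≤ s n + fromℚ ε

-- Syntax.  Formula q n is the type of formulas of the language with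
-- predicates indexed by Fin q and (de Bruijn) free variables in Fin n;
-- const k stands for the constant a_{k+1}.  There is no equality symbol.

private
  variable
    q r m n : ℕ

data Term (n : ℕ) : Set where
  var   : Fin n → Term n
  const : ℕ → Term n

infix  9 ∼_
infixr 7 _∧_
infixr 6 _∨_
infixr 5 _⇒_

data Formula (q : ℕ) (n : ℕ) : Set where
  ⊤ᶠ          : Formula q n
  P           : Fin q → Term n → Formula q n
  ∼_          : Formula q n → Formula q n
  _∧_ _∨_ _⇒_ : Formula q n → Formula q n → Formula q n
  ∀ᶠ ∃ᶠ       : Formula q (suc n) → Formula q n

Sentence : ℕ → Set
Sentence q = Formula q 0

weaken : Term n → Term (suc n)
weaken (var i)   = var (suc i)
weaken (const k) = const k

lift : (Fin m → Term n) → Fin (suc m) → Term (suc n)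
lift σ zero    = var zero
lift σ (suc i) = weaken (σ i)

substTerm : (Fin m → Term n) → Term m → Term n
substTerm σ (var i)   = σ i
substTerm σ (const k) = const k

subst : (Fin m → Term n) → Formula q m → Formula q n
subst σ ⊤ᶠ      = ⊤ᶠ
subst σ (P i t) = P i (substTerm σ t)
subst σ (∼ φ)   = ∼ subst σ φ
subst σ (φ ∧ ψ) = subst σ φ ∧ subst σ ψ
subst σ (φ ∨ ψ) = subst σ φ ∨ subst σ ψ
subst σ (φ ⇒ ψ) = subst σ φ ⇒ subst σ ψ
subst σ (∀ᶠ φ)  = ∀ᶠ (subst (lift σ) φ)
subst σ (∃ᶠ φ)  = ∃ᶠ (subst (lift σ) φ)

_⟨_⟩ : Formula q 1 → ℕ → Sentence q
φ ⟨ k ⟩ = subst (λ _ → const k) φ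

renameTerm : (ℕ → ℕ) → Term n → Term n
renameTerm g (var i)   = var i
renameTerm g (const k) = const (g k)

rename : (Fin q → Fin r) → (ℕ → ℕ) → Formula q n → Formula r n
rename f g ⊤ᶠ      = ⊤ᶠ
rename f g (P i t) = P (f i) (renameTerm g t)
rename f g (∼ φ)   = ∼ rename f g φ
rename f g (φ ∧ ψ) = rename f g φ ∧ rename f g ψ
rename f g (φ ∨ ψ) = rename f g φ ∨ rename f g ψ
rename f g (φ ⇒ ψ) = rename f g φ ⇒ rename f g ψ
rename f g (∀ᶠ φ)  = ∀ᶠ (rename f g φ)
rename f g (∃ᶠ φ)  = ∃ᶠ (rename f g φ)

⋀ : (Fin m → Formula q n) → Formula q n
⋀ {zero}  φ = ⊤ᶠ
⋀ {suc m} φ = φ zero ∧ ⋀ (φ ∘ suc)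

⋁ : (Fin m → Formula q n) → Formula q n
⋁ {zero}  φ = ∼ ⊤ᶠ
⋁ {suc m} φ = φ zero ∨ ⋁ (φ ∘ suc)

-- Semantics.  Tarski's clauses, with the disjunction and the existential
-- quantifier of the metalanguage read classically, i.e. as ¬ ¬ (_ ⊎ _) and
-- ¬ ¬ ∃.  Together with the two-valuedness of predicates this makes
-- satisfaction ¬¬-stable (Sat-stable), so that _⊨_ is entailment of classical
-- first-order logic without assuming excluded middle.

record Structure (q : ℕ) : Set₁ where
  field
    Universe : Set
    constant : ℕ → Universe
    holds    : Fin q → Universe → Bool

module _ (M : Structure q) where
  open Structure M

  value : (Fin n → Universe) → Term n → Universe
  value ρ (var i)   = ρ i
  value ρ (const k) = constant k

  extend : (Fin n → Universe) → Universe → Fin (suc n) → Universe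
  extend ρ u zero    = u
  extend ρ u (suc i) = ρ i

  Sat : (Fin n → Universe) → Formula q n → Set
  Sat ρ ⊤ᶠ      = ⊤
  Sat ρ (P i t) = T (holds i (value ρ t))
  Sat ρ (∼ φ)   = ¬ Sat ρ φ
  Sat ρ (φ ∧ ψ) = Sat ρ φ × Sat ρ ψ
  Sat ρ (φ ∨ ψ) = ¬ ¬ (Sat ρ φ ⊎ Sat ρ ψ)
  Sat ρ (φ ⇒ ψ) = Sat ρ φ → Sat ρ ψ
  Sat ρ (∀ᶠ φ)  = ∀ u → Sat (extend ρ u) φ
  Sat ρ (∃ᶠ φ)  = ¬ ¬ (∃ λ u → Sat (extend ρ u) φ)

  True : Sentence q → Set
  True = Sat λ ()

  Sat-stable : (ρ : Fin n → Universe) (φ : Formula q n) → ¬ ¬ Sat ρ φ → Sat ρ φ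
  Sat-stable ρ ⊤ᶠ      _   = _
  Sat-stable ρ (P i t) ¬¬s = decidable-stable (T? _) ¬¬s
  Sat-stable ρ (∼ φ)   ¬¬s = λ s → ¬¬s λ f → f s
  Sat-stable ρ (φ ∧ ψ) ¬¬s = Sat-stable ρ φ (λ k → ¬¬s λ s → k (proj₁ s))
                           , Sat-stable ρ ψ (λ k → ¬¬s λ s → k (proj₂ s))
  Sat-stable ρ (φ ∨ ψ) ¬¬s = λ k → ¬¬s λ s → s k
  Sat-stable ρ (φ ⇒ ψ) ¬¬s = λ t → Sat-stable ρ ψ (λ k → ¬¬s λ s → k (s t))
  Sat-stable ρ (∀ᶠ φ)  ¬¬s = λ u → Sat-stable (extend ρ u) φ (λ k → ¬¬s λ s → k (s u))
  Sat-stable ρ (∃ᶠ φ)  ¬¬s = λ k → ¬¬s λ s → s k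

infix 3 ⊨_ _⊨_

⊨_ : Sentence q → Set₁
⊨ φ = ∀ M → True M φ

_⊨_ : Sentence q → Sentence q → Set₁
φ ⊨ ψ = ∀ M → True M φ → True M ψ

record ProbabilityFunction (q : ℕ) : Set₁ where
  field
    prob        : Sentence q → ℝ
    nonNegative : ∀ φ → 0ℝ ≤ prob φ
    atMostOne   : ∀ φ → prob φ ≤ 1ℝ
    -- w(⊤) = 1, where ⊤ stands for an arbitrary tautology.  Demanding it only
    -- for the symbol ⊤ᶠ would not make prob respect logical equivalence.
    tautology   : ∀ φ → ⊨ φ → prob φ ≈ 1ℝ
    additive    : ∀ φ θ → φ ⊨ ∼ θ → prob (φ ∨ θ) ≈ prob φ + prob θ
    existential : ∀ (φ : Formula q 1) →
                  Limit (λ k → prob (⋁ λ (i : Fin k) → φ ⟨ toℕ i ⟩)) (prob (∃ᶠ φ))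

open ProbabilityFunction public using (prob)

Ex : ProbabilityFunction q → Set
Ex w = ∀ (π : ℕ ↔ ℕ) φ → prob w (rename id (Inverse.to π) φ) ≈ prob w φ

Px : ProbabilityFunction q → Set
Px {q} w = ∀ (π : Permutation′ q) φ → prob w (rename (π ⟨$⟩ʳ_) id φ) ≈ prob w φ

-- The i-th entry is the sign of the i-th predicate; false means negated.
Atom : ℕ → Set
Atom q = Vec Bool q

_≟ᴬ_ : (α β : Atom q) → Dec (α ≡ β)
_≟ᴬ_ = Vec.≡-dec Bool._≟_

γ : Atom q → ℕ
γ = count (Bool._≟ false)

atom : Atom q → Term n → Formula q n
atom α t = ⋀ λ i → if lookup α i then P i t else ∼ P i t

stateDescription : (Fin m → Atom q) → Sentence q
stateDescription h = ⋀ λ k → atom (h k) (const (toℕ k))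

-- sizes h i is the multiset M_i of the P-spectrum, as a list to be compared up to _↭_;
-- each class of k ~ l ⇔ h k ≡ h l contributes one representative.
sizes : (Fin m → Atom q) → Fin (suc q) → List ℕ
sizes {m} h i = map (λ k → length (filter (λ l → h k ≟ᴬ h l) members)) representatives
  where
  members representatives : List (Fin m)
  members         = filter (λ k → γ (h k) ℕ.≟ toℕ i) (allFin m)
  representatives = deduplicate (λ k l → h k ≟ᴬ h l) members

SamePSpectrum : (h h′ : Fin m → Atom q) → Set
SamePSpectrum h h′ = ∀ i → sizes h i ↭ sizes h′ i

SPx : ProbabilityFunction q → Set
SPx {q} w = ∀ {m} (h h′ : Fin m → Atom q) → SamePSpectrum h h′ →
  prob w (stateDescription h) ≈ prob w (stateDescription h′)

-- A finite set of predicate symbols drawn from P₁, P₂, … (indexed by ℕ),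
-- listed without repetition.  Formulas refer to a symbol by its position.
record Language : Set where
  field
    size      : ℕ
    symbol    : Fin size → ℕ
    injective : Injective _≡_ _≡_ symbol

open Language public using (size; symbol)

L : ℕ → Language
L q = record { size = q ; symbol = toℕ ; injective = toℕ-injective }

-- The position in 𝓛′ of each symbol of 𝓛.
_⊆_ : Language → Language → Set
𝓛 ⊆ 𝓛′ = Σ (Fin (size 𝓛) → Fin (size 𝓛′)) λ f → ∀ i → symbol 𝓛′ (f i) ≡ symbol 𝓛 i

record ULiWithSPx (w : ProbabilityFunction q) : Set₁ where
  field
    family   : (𝓛 : Language) → ProbabilityFunction (size 𝓛)
    exch     : ∀ 𝓛 → Ex (family 𝓛)
    px       : ∀ 𝓛 → Px (family 𝓛)
    spx      : ∀ 𝓛 → SPx (family 𝓛)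
    member   : ∀ φ → prob (family (L q)) φ ≈ prob w φ
    restrict : ∀ {𝓛 𝓛′} (ι : 𝓛 ⊆ 𝓛′) φ →
               prob (family 𝓛′) (rename (proj₁ ι) id φ) ≈ prob (family 𝓛) φ

{-# OPTIONS --safe #-}
module Submission where

-- A map κ from the atoms of L_q to those of L_r induces an interpretation of
-- L_r in L_q, hence a push-forward κ_* w of w. Give every atom α of L_q a
-- colour ρ α and every colour an independent random atom of L_r whose
-- predicates hold independently with a probability t depending on the colour:
-- averaging κ_* w over these colourings κ yields, for all r at once, a family
-- witnessing ULi with SPx. It remains to write w as a linear combination of
-- such averages at r = q. As t^(q-k) (1-t)^k, k = 0, …, q, are linearly
-- independent, combinations of the t's fix the number of negations of the atom
-- assigned to each colour; by inclusion–exclusion over coincidences, where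
-- merging two colours is again a colouring, one arrives at the sum of g_* w over
-- the permutations g of the atoms preserving γ. By SPx, g_* w and w agree on
-- state descriptions, hence on all sentences. Collecting positive and negative
-- coefficients gives w₁ and w₂.

open import Defs
open import Data.Bool.Base using (Bool; true; false; T; if_then_else_)
open import Data.Empty using (⊥-elim)
open import Data.Fin.Base using (Fin; zero; suc; toℕ; fromℕ; fromℕ<; punchOut; inject≤)
import Data.Fin.Properties as Fin
open import Data.List.Base as List using (List; []; _∷_; _++_; length; filter; concatMap; deduplicate; allFin; replicate)
import Data.List.Properties as List
open import Data.List.Membership.Propositional using (_∈_; find; lose)
open import Data.List.Membership.Propositional.Properties using (∈-map⁺; ∈-map⁻; ∈-++⁺ˡ; ∈-++⁺ʳ; ∈-filter⁺; ∈-filter⁻; ∈-concatMap⁺; ∈-concatMap⁻; ∈-allFin; ∈-∃++)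
open import Data.List.Membership.Propositional.Properties.WithK using (unique∧set⇒bag)
open import Data.List.Relation.Binary.BagAndSetEquality using (∼bag⇒↭)
open import Data.List.Relation.Binary.Permutation.Propositional as ↭ using (_↭_; ↭-sym; ↭-trans; ↭-reflexive)
import Data.List.Relation.Binary.Permutation.Propositional.Properties as ↭
open import Data.List.Relation.Unary.All as All using (All; []; _∷_)
import Data.List.Relation.Unary.All.Properties as All
open import Data.List.Relation.Unary.AllPairs using (AllPairs; []; _∷_)
import Data.List.Relation.Unary.AllPairs.Properties as AllPairs
import Data.List.Relation.Binary.Permutation.Setoid.Properties as ↭Setoid
open import Data.List.Relation.Unary.Any as Any using (Any; here; there)
import Data.List.Relation.Unary.Any.Properties as Any
open import Data.List.Relation.Unary.Unique.Propositional using (Unique)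
import Data.List.Relation.Unary.Unique.Propositional.Properties as Unique
open import Data.Nat.Base as ℕ using (ℕ; zero; suc; _⊔_) renaming (_≤_ to _≤ⁿ_)
import Data.Nat.Properties as ℕ
open import Data.Product.Base using (Σ; ∃; _×_; _,_; proj₁; proj₂)
import Data.Product.Properties as Product
open import Data.Rational.Base as ℚ using (ℚ; 0ℚ; 1ℚ; ½; ∣_∣)
import Data.Rational.Properties as ℚ
open import Data.Rational.Solver using (module +-*-Solver)
open import Data.Sum.Base as Sum using (_⊎_; inj₁; inj₂)
open import Data.Vec.Base as Vec using (Vec; []; _∷_; lookup; tabulate; insertAt; toList; fromList)
import Data.Vec.Properties as Vec
import Data.Vec.Relation.Unary.All as VecAll
open import Function.Base using (id; _∘_; case_of_)
open import Function.Bundles using (_⇔_; mk⇔; _↔_; mk↔ₛ′; Inverse; Injection)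
open import Function.Definitions using (Injective)
open import Relation.Binary.Bundles using (Setoid)
open import Relation.Binary.PropositionalEquality as ≡ using (_≡_; _≢_; refl; sym; trans; cong; cong₂; module ≡-Reasoning)
import Relation.Binary.Reasoning.Setoid as SetoidReasoning
open import Relation.Nullary.Decidable.Core using (Dec; yes; no; does; ¬?)
open import Relation.Nullary.Negation.Core using (¬_; contradiction)
open import Relation.Nullary.Decidable using (toWitness; decidable-stable)
import Data.List.Membership.DecPropositional as DecMembership
open import Function.Properties.Inverse using (↔⇒↣)

open +-*-Solver using (solve; _:+_; _:*_; _:-_; :-_; _:=_; con)

-- The obstacle is that neither injectivity of a colouring nor a prescribed number of negations
-- survives a change of language: distinct atoms may agree on fewer predicates, and small languages
-- have too few atoms. Independent atoms with independent predicates do survive: forgetting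
-- predicates turns the law with parameter `t` for many predicates into the law with the same `t`
-- for fewer. Such a law gives equal weight to atoms with equally many negations, so the average is
-- invariant under all permutations of the atoms preserving `γ`; state descriptions with equal
-- P-spectra differ by such a permutation and one of the constants, whence SPx. Px is the
-- restriction property for a bijection. The identity with the sum over permutations is wanted at
-- the single language `L_q`, and its coefficients may have either sign: this is where the negative
-- part of the decomposition comes from. All coefficients are rational, so their signs are decidable
-- and the terms can be sorted constructively.

private
  variable
    k m n q r r′ : ℕ
    A B K : Set
    x y z x′ y′ : ℝ
    a b c : ℚ

-- Real numbers

p≤q+ε⇒p-q≤ε : ∀ p q ε → p ℚ.≤ q ℚ.+ ε → p ℚ.- q ℚ.≤ ε
p≤q+ε⇒p-q≤ε p q ε p≤q+ε = ℚ.≤-trans (ℚ.+-monoˡ-≤ (ℚ.- q) p≤q+ε)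
  (ℚ.≤-reflexive (solve 2 (λ q ε → (q :+ ε) :- q := ε) refl q ε))

p-q≤ε⇒p≤q+ε : ∀ p q ε → p ℚ.- q ℚ.≤ ε → p ℚ.≤ q ℚ.+ ε
p-q≤ε⇒p≤q+ε p q ε p-q≤ε = ℚ.≤-trans (ℚ.≤-reflexive (solve 2 (λ p q → p := q :+ (p :- q)) refl p q))
  (ℚ.+-monoʳ-≤ q p-q≤ε)

neg-minus : ∀ p q → ℚ.- (p ℚ.- q) ≡ q ℚ.- p
neg-minus = solve 2 (λ p q → :- (p :- q) := q :- p) refl

p≤∣p∣ : ∀ p → p ℚ.≤ ∣ p ∣
p≤∣p∣ p with ℚ.≤-total 0ℚ p
... | inj₁ 0≤p = ℚ.≤-reflexive (sym (ℚ.0≤p⇒∣p∣≡p 0≤p))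
... | inj₂ p≤0 = ℚ.≤-trans p≤0 (ℚ.0≤∣p∣ p)

∣p∣≤-intro : ∀ p {ε} → p ℚ.≤ ε → ℚ.- p ℚ.≤ ε → ∣ p ∣ ℚ.≤ ε
∣p∣≤-intro p p≤ε -p≤ε with ℚ.∣p∣≡p∨∣p∣≡-p p
... | inj₁ eq = ℚ.≤-trans (ℚ.≤-reflexive eq) p≤ε
... | inj₂ eq = ℚ.≤-trans (ℚ.≤-reflexive eq) -p≤ε

infix 4 _≃_ _≼_
infixr 8 _·_

-- _≈_ and _≤_ unfold to Π-types, from which the two sides cannot be inferred;
-- the wrappers are rigid.
record _≃_ (x y : ℝ) : Set where
  constructor ⌊_⌋
  field ⌈_⌉ : x ≈ y
open _≃_

record _≼_ (x y : ℝ) : Set where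
  constructor ⌊_⌋
  field ⌈_⌉ : x ≤ y
open _≼_ renaming (⌈_⌉ to ⌈_⌉≤)

_·_ : ℚ → ℝ → ℝ
c · x = fromℚ c * x


≼-reflexive : x ≃ y → x ≼ y
≼-reflexive {x} {y} ⌊ x≈y ⌋ .⌈_⌉≤ ε 0<ε with x≈y ε 0<ε
... | N , h = N , λ n N≤n → p-q≤ε⇒p≤q+ε (seq x n) (seq y n) ε (ℚ.≤-trans (p≤∣p∣ _) (h n N≤n))

≼-antisym : x ≼ y → y ≼ x → x ≃ y
≼-antisym {x} {y} ⌊ x≤y ⌋ ⌊ y≤x ⌋ .⌈_⌉ ε 0<ε with x≤y ε 0<ε | y≤x ε 0<ε
... | M , f | N , g = M ⊔ N , λ n p → ∣p∣≤-intro (seq x n ℚ.- seq y n)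
  (p≤q+ε⇒p-q≤ε (seq x n) (seq y n) ε (f n (ℕ.m⊔n≤o⇒m≤o M N p)))
  (ℚ.≤-trans (ℚ.≤-reflexive (neg-minus (seq x n) (seq y n)))
    (p≤q+ε⇒p-q≤ε (seq y n) (seq x n) ε (g n (ℕ.m⊔n≤o⇒n≤o M N p))))

≃-sym : x ≃ y → y ≃ x
≃-sym {x} {y} ⌊ x≈y ⌋ .⌈_⌉ ε 0<ε with x≈y ε 0<ε
... | N , h = N , λ n N≤n → ℚ.≤-trans (ℚ.≤-reflexive
  (trans (cong ∣_∣ (sym (neg-minus (seq x n) (seq y n)))) (ℚ.∣-p∣≡∣p∣ _))) (h n N≤n)

pointwise-≼ : (∀ n → seq x n ℚ.≤ seq y n) → x ≼ y
pointwise-≼ {y = y} h .⌈_⌉≤ ε 0<ε = 0 , λ n _ → ℚ.≤-trans (h n)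
  (ℚ.≤-trans (ℚ.≤-reflexive (sym (ℚ.+-identityʳ (seq y n)))) (ℚ.+-monoʳ-≤ (seq y n) (ℚ.<⇒≤ 0<ε)))

pointwise : (∀ n → seq x n ≡ seq y n) → x ≃ y
pointwise eq = ≼-antisym (pointwise-≼ λ n → ℚ.≤-reflexive (eq n)) (pointwise-≼ λ n → ℚ.≤-reflexive (sym (eq n)))

≼-trans : x ≼ y → y ≼ z → x ≼ z
≼-trans {x} {y} {z} ⌊ x≤y ⌋ ⌊ y≤z ⌋ .⌈_⌉≤ ε 0<ε with x≤y (ε ℚ.* ½) (half-pos ε 0<ε) | y≤z (ε ℚ.* ½) (half-pos ε 0<ε)
... | M , f | N , g = M ⊔ N , λ n p → let open ℚ.≤-Reasoning in begin
  seq x n                              ≤⟨ f n (ℕ.m⊔n≤o⇒m≤o M N p) ⟩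
  seq y n ℚ.+ ε ℚ.* ½                  ≤⟨ ℚ.+-monoˡ-≤ (ε ℚ.* ½) (g n (ℕ.m⊔n≤o⇒n≤o M N p)) ⟩
  (seq z n ℚ.+ ε ℚ.* ½) ℚ.+ ε ℚ.* ½    ≡⟨ ℚ.+-assoc (seq z n) _ _ ⟩
  seq z n ℚ.+ (ε ℚ.* ½ ℚ.+ ε ℚ.* ½)    ≡⟨ cong (seq z n ℚ.+_) (halves ε) ⟩
  seq z n ℚ.+ ε ∎

≃-refl : x ≃ x
≃-refl = pointwise λ _ → refl

≼-refl : x ≼ x
≼-refl = ≼-reflexive ≃-refl

≃-reflexive : x ≡ y → x ≃ y
≃-reflexive refl = ≃-refl

≃-trans : x ≃ y → y ≃ z → x ≃ z
≃-trans x≃y y≃z = ≼-antisym (≼-trans (≼-reflexive x≃y) (≼-reflexive y≃z))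
                            (≼-trans (≼-reflexive (≃-sym y≃z)) (≼-reflexive (≃-sym x≃y)))

≃-setoid : Setoid _ _
≃-setoid = record { Carrier = ℝ ; _≈_ = _≃_ ; isEquivalence = record { refl = ≃-refl ; sym = ≃-sym ; trans = ≃-trans } }

module ≃-Reasoning = SetoidReasoning ≃-setoid

≼-resp : x ≃ x′ → y ≃ y′ → x ≼ y → x′ ≼ y′
≼-resp x≃x′ y≃y′ x≼y = ≼-trans (≼-reflexive (≃-sym x≃x′)) (≼-trans x≼y (≼-reflexive y≃y′))

+-mono-≼ : x ≼ y → x′ ≼ y′ → x + x′ ≼ y + y′
+-mono-≼ {x} {y} {x′} {y′} ⌊ p ⌋ ⌊ p′ ⌋ .⌈_⌉≤ ε 0<ε with p (ε ℚ.* ½) (half-pos ε 0<ε) | p′ (ε ℚ.* ½) (half-pos ε 0<ε)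
... | M , f | N , g = M ⊔ N , λ n p → let open ℚ.≤-Reasoning; h = ε ℚ.* ½ in begin
  seq x n ℚ.+ seq x′ n                     ≤⟨ ℚ.+-mono-≤ (f n (ℕ.m⊔n≤o⇒m≤o M N p)) (g n (ℕ.m⊔n≤o⇒n≤o M N p)) ⟩
  (seq y n ℚ.+ h) ℚ.+ (seq y′ n ℚ.+ h)     ≡⟨ solve 3 (λ a b h → (a :+ h) :+ (b :+ h) := (a :+ b) :+ (h :+ h)) refl (seq y n) (seq y′ n) h ⟩
  (seq y n ℚ.+ seq y′ n) ℚ.+ (h ℚ.+ h)     ≡⟨ cong (seq y n ℚ.+ seq y′ n ℚ.+_) (halves ε) ⟩
  (seq y n ℚ.+ seq y′ n) ℚ.+ ε ∎

neg-mono-≼ : x ≼ y → - y ≼ - x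
neg-mono-≼ {x} {y} ⌊ p ⌋ .⌈_⌉≤ ε 0<ε with p ε 0<ε
... | N , f = N , λ n N≤n → let open ℚ.≤-Reasoning in begin
  ℚ.- seq y n                              ≡⟨ solve 2 (λ b e → :- b := (:- (b :+ e)) :+ e) refl (seq y n) ε ⟩
  ℚ.- (seq y n ℚ.+ ε) ℚ.+ ε                ≤⟨ ℚ.+-monoˡ-≤ ε (ℚ.neg-antimono-≤ (f n N≤n)) ⟩
  ℚ.- seq x n ℚ.+ ε ∎

+-cong : x ≃ y → x′ ≃ y′ → x + x′ ≃ y + y′
+-cong p p′ = ≼-antisym (+-mono-≼ (≼-reflexive p) (≼-reflexive p′)) (+-mono-≼ (≼-reflexive (≃-sym p)) (≼-reflexive (≃-sym p′)))

neg-cong : x ≃ y → - x ≃ - y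
neg-cong p = ≼-antisym (neg-mono-≼ (≼-reflexive (≃-sym p))) (neg-mono-≼ (≼-reflexive p))

*-congˡ : ∀ z → x ≃ y → z * x ≃ z * y
*-congˡ {x} {y} z ⌊ x≈y ⌋ .⌈_⌉ ε 0<ε =
  let B , 0<B , M , bounded = eventually-bounded (seq z) (cauchy z)
      δ , 0<δ , Bδ≡ε = scale ε B 0<ε 0<B
      N , close = x≈y δ 0<δ
  in M ⊔ N , λ n p → let open ℚ.≤-Reasoning in begin
    ∣ seq z n ℚ.* seq x n ℚ.- seq z n ℚ.* seq y n ∣
      ≡⟨ cong ∣_∣ (solve 3 (λ c a b → c :* a :- c :* b := c :* (a :- b)) refl (seq z n) (seq x n) (seq y n)) ⟩
    ∣ seq z n ℚ.* (seq x n ℚ.- seq y n) ∣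
      ≤⟨ *-mono-abs (seq z n) _ (bounded n (ℕ.m⊔n≤o⇒m≤o M N p)) (close n (ℕ.m⊔n≤o⇒n≤o M N p)) ⟩
    B ℚ.* δ
      ≡⟨ Bδ≡ε ⟩
    ε ∎

·-cong : ∀ c → x ≃ y → c · x ≃ c · y
·-cong c = *-congˡ (fromℚ c)

fromℚ-mono : a ℚ.≤ b → fromℚ a ≼ fromℚ b
fromℚ-mono a≤b = pointwise-≼ λ _ → a≤b

-- A margin of δ = ε / (c + 1) is enough to have c δ ≤ ε, also for c = 0.
margin : 0ℚ ℚ.≤ c → ∀ ε → 0ℚ ℚ.< ε → ∃ λ δ → 0ℚ ℚ.< δ × c ℚ.* δ ℚ.≤ ε
margin {c} 0≤c ε 0<ε =
  let δ , 0<δ , eq = scale ε (c ℚ.+ 1ℚ) 0<ε (ℚ.+-mono-≤-< 0≤c (ℚ.positive⁻¹ 1ℚ))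
  in δ , 0<δ , ℚ.≤-trans
       (ℚ.*-monoʳ-≤-nonNeg δ {{ℚ.nonNegative (ℚ.<⇒≤ 0<δ)}} (ℚ.≤-trans (ℚ.≤-reflexive (sym (ℚ.+-identityʳ c))) (ℚ.+-monoʳ-≤ c (ℚ.<⇒≤ (ℚ.positive⁻¹ 1ℚ)))))
       (ℚ.≤-reflexive eq)

·-mono-≼ : 0ℚ ℚ.≤ c → x ≼ y → c · x ≼ c · y
·-mono-≼ {c} {x} {y} 0≤c ⌊ x≤y ⌋ .⌈_⌉≤ ε 0<ε =
  let δ , 0<δ , cδ≤ε = margin 0≤c ε 0<ε
      N , h = x≤y δ 0<δ
  in N , λ n N≤n → let open ℚ.≤-Reasoning in begin
    c ℚ.* seq x n             ≤⟨ ℚ.*-monoˡ-≤-nonNeg c {{ℚ.nonNegative 0≤c}} (h n N≤n) ⟩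
    c ℚ.* (seq y n ℚ.+ δ)     ≡⟨ ℚ.*-distribˡ-+ c (seq y n) δ ⟩
    c ℚ.* seq y n ℚ.+ c ℚ.* δ ≤⟨ ℚ.+-monoʳ-≤ (c ℚ.* seq y n) cδ≤ε ⟩
    c ℚ.* seq y n ℚ.+ ε ∎

≼-approx : (∀ ε → 0ℚ ℚ.< ε → x ≼ y + fromℚ ε) → x ≼ y
≼-approx {x} {y} h .⌈_⌉≤ ε 0<ε with ⌈ h (ε ℚ.* ½) (half-pos ε 0<ε) ⌉≤ (ε ℚ.* ½) (half-pos ε 0<ε)
... | N , f = N , λ n N≤n → ℚ.≤-trans (f n N≤n)
  (ℚ.≤-reflexive (trans (ℚ.+-assoc (seq y n) _ _) (cong (seq y n ℚ.+_) (halves ε))))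

fromℚ-cancel-≼ : fromℚ a ≼ fromℚ b → a ℚ.≤ b
fromℚ-cancel-≼ {a} {b} ⌊ h ⌋ with a ℚ.≤? b
... | yes a≤b = a≤b
... | no  a≰b with h ((a ℚ.- b) ℚ.* ½) (half-pos _ 0<a-b)
  where
  0<a-b : 0ℚ ℚ.< a ℚ.- b
  0<a-b = ℚ.≤-<-trans (ℚ.≤-reflexive (sym (ℚ.+-inverseʳ b))) (ℚ.+-monoˡ-< (ℚ.- b) (ℚ.≰⇒> a≰b))
... | N , f = contradiction (ℚ.≤-<-trans
    (ℚ.≤-trans (ℚ.≤-reflexive (halves (a ℚ.- b))) (p≤q+ε⇒p-q≤ε a b δ (f N ℕ.≤-refl)))
    (ℚ.≤-<-trans (ℚ.≤-reflexive (sym (ℚ.+-identityʳ δ))) (ℚ.+-monoʳ-< δ 0<δ)))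
  (ℚ.<-irrefl refl)
  where
  δ : ℚ
  δ = (a ℚ.- b) ℚ.* ½
  0<δ : 0ℚ ℚ.< δ
  0<δ = half-pos _ (ℚ.≤-<-trans (ℚ.≤-reflexive (sym (ℚ.+-inverseʳ b))) (ℚ.+-monoˡ-< (ℚ.- b) (ℚ.≰⇒> a≰b)))

fromℚ-injective : fromℚ a ≃ fromℚ b → a ≡ b
fromℚ-injective eq = ℚ.≤-antisym (fromℚ-cancel-≼ (≼-reflexive eq)) (fromℚ-cancel-≼ (≼-reflexive (≃-sym eq)))

infix 4 _⟶_
record _⟶_ (s : ℕ → ℝ) (l : ℝ) : Set where
  constructor ⌊_⌋
  field ⌈_⌉ : ∀ ε → 0ℚ ℚ.< ε → ∃ λ N → ∀ n → N ℕ.≤ n → s n ≼ l + fromℚ ε × l ≼ s n + fromℚ ε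
open _⟶_ renaming (⌈_⌉ to ⌈_⌉⟶)

⟶⇒Limit : ∀ {s l} → s ⟶ l → Limit s l
⟶⇒Limit h ε 0<ε with ⌈ h ⌉⟶ ε 0<ε
... | N , f = N , λ n N≤n → ⌈ proj₁ (f n N≤n) ⌉≤ , ⌈ proj₂ (f n N≤n) ⌉≤

Limit⇒⟶ : ∀ {s l} → Limit s l → s ⟶ l
Limit⇒⟶ h .⌈_⌉⟶ ε 0<ε with h ε 0<ε
... | N , f = N , λ n N≤n → ⌊ proj₁ (f n N≤n) ⌋ , ⌊ proj₂ (f n N≤n) ⌋

⟶-resp : ∀ {s s′ l l′} → (∀ n → s n ≃ s′ n) → l ≃ l′ → s ⟶ l → s′ ⟶ l′
⟶-resp s≃s′ l≃l′ h .⌈_⌉⟶ ε 0<ε with ⌈ h ⌉⟶ ε 0<ε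
... | N , f = N , λ n N≤n → ≼-resp (s≃s′ n) (+-cong l≃l′ ≃-refl) (proj₁ (f n N≤n))
                          , ≼-resp l≃l′ (+-cong (s≃s′ n) ≃-refl) (proj₂ (f n N≤n))

⟶-+ : ∀ {s s′ l l′} → s ⟶ l → s′ ⟶ l′ → (λ n → s n + s′ n) ⟶ l + l′
⟶-+ {s} {s′} {l} {l′} h h′ .⌈_⌉⟶ ε 0<ε with ⌈ h ⌉⟶ (ε ℚ.* ½) (half-pos ε 0<ε) | ⌈ h′ ⌉⟶ (ε ℚ.* ½) (half-pos ε 0<ε)
... | M , f | N , g = M ⊔ N , λ n p →
  let f₁ , f₂ = f n (ℕ.m⊔n≤o⇒m≤o M N p)
      g₁ , g₂ = g n (ℕ.m⊔n≤o⇒n≤o M N p)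
  in ≼-trans (+-mono-≼ f₁ g₁) (≼-reflexive (regroup l l′)) , ≼-trans (+-mono-≼ f₂ g₂) (≼-reflexive (regroup (s n) (s′ n)))
  where
  regroup : ∀ x y → (x + fromℚ (ε ℚ.* ½)) + (y + fromℚ (ε ℚ.* ½)) ≃ (x + y) + fromℚ ε
  regroup x y = pointwise λ n → trans
    (solve 3 (λ a b h → (a :+ h) :+ (b :+ h) := (a :+ b) :+ (h :+ h)) refl (seq x n) (seq y n) (ε ℚ.* ½))
    (cong (seq x n ℚ.+ seq y n ℚ.+_) (halves ε))

⟶-· : ∀ {s l} → 0ℚ ℚ.≤ c → s ⟶ l → (λ n → c · s n) ⟶ c · l
⟶-· {c} {s} {l} 0≤c h .⌈_⌉⟶ ε 0<ε =
  let δ , 0<δ , cδ≤ε = margin 0≤c ε 0<ε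
      N , f = ⌈ h ⌉⟶ δ 0<δ
      enlarge : ∀ x → c · (x + fromℚ δ) ≼ c · x + fromℚ ε
      enlarge x = pointwise-≼ λ n → ℚ.≤-trans (ℚ.≤-reflexive (ℚ.*-distribˡ-+ c (seq x n) δ)) (ℚ.+-monoʳ-≤ (c ℚ.* seq x n) cδ≤ε)
  in N , λ n N≤n → ≼-trans (·-mono-≼ 0≤c (proj₁ (f n N≤n))) (enlarge l)
                 , ≼-trans (·-mono-≼ 0≤c (proj₂ (f n N≤n))) (enlarge (s n))

+-interchange : ∀ x y x′ y′ → (x + y) + (x′ + y′) ≃ (x + x′) + (y + y′)
+-interchange x y x′ y′ = pointwise λ n →
  solve 4 (λ a b c d → (a :+ b) :+ (c :+ d) := (a :+ c) :+ (b :+ d)) refl (seq x n) (seq y n) (seq x′ n) (seq y′ n)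

+-identityˡ : ∀ x → 0ℝ + x ≃ x
+-identityˡ x = pointwise λ n → ℚ.+-identityˡ (seq x n)

+-identityʳ : ∀ x → x + 0ℝ ≃ x
+-identityʳ x = pointwise λ n → ℚ.+-identityʳ (seq x n)

+-comm : ∀ x y → x + y ≃ y + x
+-comm x y = pointwise λ n → ℚ.+-comm (seq x n) (seq y n)

+-assoc : ∀ x y z → (x + y) + z ≃ x + (y + z)
+-assoc x y z = pointwise λ n → ℚ.+-assoc (seq x n) (seq y n) (seq z n)

·-distribˡ : ∀ c x y → c · (x + y) ≃ c · x + c · y
·-distribˡ c x y = pointwise λ n → ℚ.*-distribˡ-+ c (seq x n) (seq y n)

·-distribʳ : ∀ a b x → (a ℚ.+ b) · x ≃ a · x + b · x
·-distribʳ a b x = pointwise λ n → ℚ.*-distribʳ-+ (seq x n) a b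

·-assoc : ∀ a b x → a · b · x ≃ (a ℚ.* b) · x
·-assoc a b x = pointwise λ n → sym (ℚ.*-assoc a b (seq x n))

·-comm : ∀ a b x → a · b · x ≃ b · a · x
·-comm a b x = pointwise λ n → solve 3 (λ a b x → a :* (b :* x) := b :* (a :* x)) refl a b (seq x n)

·-zeroˡ : ∀ x → 0ℚ · x ≃ 0ℝ
·-zeroˡ x = pointwise λ n → ℚ.*-zeroˡ (seq x n)

·-zeroʳ : ∀ c → c · 0ℝ ≃ 0ℝ
·-zeroʳ c = pointwise λ n → ℚ.*-zeroʳ c

·-identity : ∀ x → 1ℚ · x ≃ x
·-identity x = pointwise λ n → ℚ.*-identityˡ (seq x n)

·-coeff : ∀ x → a ≡ b → a · x ≃ b · x
·-coeff x refl = ≃-refl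

-- Measures on sentences


-- Finite measures of arbitrary mass are closed under sums and nonnegative rational multiples, as
-- probability functions are not. The mass is kept rational, so that masses can be compared and
-- inverted exactly.
record IsMeasure (s : ℚ) (μ : Sentence q → ℝ) : Set₁ where
  field
    nonNegative  : ∀ φ → 0ℝ ≼ μ φ
    tautology    : ∀ φ → ⊨ φ → μ φ ≃ fromℚ s
    additive     : ∀ φ θ → φ ⊨ ∼ θ → μ (φ ∨ θ) ≃ μ φ + μ θ
    existential  : ∀ φ → (λ k → μ (⋁ λ (i : Fin k) → φ ⟨ toℕ i ⟩)) ⟶ μ (∃ᶠ φ)
    exchangeable : ∀ (π : ℕ ↔ ℕ) φ → μ (rename id (Inverse.to π) φ) ≃ μ φ

module Measure {s : ℚ} {μ : Sentence q → ℝ} (isMeasure : IsMeasure s μ) where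
  open IsMeasure isMeasure public

  complement : ∀ φ → μ φ + μ (∼ φ) ≃ fromℚ s
  complement φ = ≃-trans (≃-sym (additive φ (∼ φ) λ M t f → f t))
    (tautology (φ ∨ ∼ φ) λ M k → k (inj₂ λ t → k (inj₁ t)))

  -- Both `φ` and `ψ` are complementary to `∼ ψ`, so their measures agree once `μ (∼ ψ)` is
  -- cancelled. Here `tautology` is applied to a valid sentence other than `⊤ᶠ`.
  respects : ∀ φ ψ → φ ⊨ ψ → ψ ⊨ φ → μ φ ≃ μ ψ
  respects φ ψ φ⊨ψ ψ⊨φ = +-cancelʳ (≃-trans (≃-sym (additive φ (∼ ψ) λ M t f → f (φ⊨ψ M t)))
    (≃-trans (tautology (φ ∨ ∼ ψ) λ M k → k (inj₂ λ t → k (inj₁ (ψ⊨φ M t)))) (≃-sym (complement ψ))))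
    where
    +-cancelʳ : ∀ {x y z} → x + z ≃ y + z → x ≃ y
    +-cancelʳ {x} {y} {z} eq = ≃-trans (expand x) (≃-trans (+-cong eq ≃-refl) (≃-sym (expand y)))
      where
      expand : ∀ x → x ≃ (x + z) - z
      expand x = pointwise λ n → solve 2 (λ a c → a := (a :+ c) :- c) refl (seq x n) (seq z n)

  split : ∀ θ χ → μ θ ≃ μ (θ ∧ χ) + μ (θ ∧ ∼ χ)
  split θ χ = ≃-trans
    (respects θ ((θ ∧ χ) ∨ (θ ∧ ∼ χ)) (λ M t k → k (inj₂ (t , λ c → k (inj₁ (t , c)))))
      (λ M f → Sat-stable M _ θ λ k → f λ { (inj₁ (t , _)) → k t ; (inj₂ (t , _)) → k t }))
    (additive (θ ∧ χ) (θ ∧ ∼ χ) λ M (_ , c) (_ , ¬c) → ¬c c)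

  monotone : ∀ φ ψ → φ ⊨ ψ → μ φ ≼ μ ψ
  monotone φ ψ φ⊨ψ = ≼-resp (+-identityʳ (μ φ))
    (≃-trans (+-cong (respects φ (ψ ∧ φ) (λ M t → φ⊨ψ M t , t) λ M → proj₂) ≃-refl) (≃-sym (split ψ φ)))
    (+-mono-≼ ≼-refl (nonNegative (ψ ∧ ∼ φ)))

  subadditive : ∀ φ ψ → μ (φ ∨ ψ) ≼ μ φ + μ ψ
  subadditive φ ψ = ≼-trans (≼-reflexive (split (φ ∨ ψ) φ)) (+-mono-≼
    (monotone ((φ ∨ ψ) ∧ φ) φ λ M → proj₂)
    (monotone ((φ ∨ ψ) ∧ ∼ φ) ψ λ M (f , ¬t) → Sat-stable M _ ψ λ k → f λ { (inj₁ t) → ¬t t ; (inj₂ t) → k t }))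

  inconsistent : ∀ φ → ⊨ ∼ φ → μ φ ≃ 0ℝ
  inconsistent φ ⊨∼φ = ≃-trans (x≃x+y-y (μ φ) (μ (∼ φ)))
    (≃-trans (+-cong (complement φ) (neg-cong (tautology (∼ φ) ⊨∼φ))) (pointwise λ n → ℚ.+-inverseʳ s))
    where
    x≃x+y-y : ∀ x y → x ≃ (x + y) - y
    x≃x+y-y x y = pointwise λ n → solve 2 (λ a c → a := (a :+ c) :- c) refl (seq x n) (seq y n)

isMeasure⁺ : (w : ProbabilityFunction q) → Ex w → IsMeasure 1ℚ (prob w)
isMeasure⁺ w ex = record
  { nonNegative  = λ φ → ⌊ ProbabilityFunction.nonNegative w φ ⌋
  ; tautology    = λ φ ⊨φ → ⌊ ProbabilityFunction.tautology w φ ⊨φ ⌋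
  ; additive     = λ φ θ φ⊨∼θ → ⌊ ProbabilityFunction.additive w φ θ φ⊨∼θ ⌋
  ; existential  = λ φ → Limit⇒⟶ (ProbabilityFunction.existential w φ)
  ; exchangeable = λ π φ → ⌊ ex π φ ⌋
  }

isMeasure⁻ : ∀ {μ : Sentence q → ℝ} → IsMeasure 1ℚ μ → ProbabilityFunction q
isMeasure⁻ {μ = μ} isMeasure = record
  { prob        = μ
  ; nonNegative = λ φ → ⌈ nonNegative φ ⌉≤
  ; atMostOne   = λ φ → ⌈ ≼-resp (+-identityʳ (μ φ)) (complement φ) (+-mono-≼ ≼-refl (nonNegative (∼ φ))) ⌉≤
  ; tautology   = λ φ ⊨φ → ⌈ tautology φ ⊨φ ⌉
  ; additive    = λ φ θ φ⊨∼θ → ⌈ additive φ θ φ⊨∼θ ⌉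
  ; existential = λ φ → ⟶⇒Limit (existential φ)
  }
  where open Measure isMeasure

isMeasure-0 : IsMeasure 0ℚ (λ (_ : Sentence q) → 0ℝ)
isMeasure-0 = record
  { nonNegative  = λ φ → ≼-refl
  ; tautology    = λ φ ⊨φ → ≃-refl
  ; additive     = λ φ θ φ⊨∼θ → ≃-sym (+-identityˡ 0ℝ)
  ; existential  = λ φ → ⌊ (λ ε 0<ε → 0 , λ n _ → small ε 0<ε , small ε 0<ε) ⌋
  ; exchangeable = λ π φ → ≃-refl
  }
  where
  small : ∀ ε → 0ℚ ℚ.< ε → 0ℝ ≼ 0ℝ + fromℚ ε
  small ε 0<ε = ≼-trans (fromℚ-mono (ℚ.<⇒≤ 0<ε)) (≼-reflexive (≃-sym (+-identityˡ (fromℚ ε))))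

isMeasure-+ : ∀ {s t} {μ ν : Sentence q → ℝ} → IsMeasure s μ → IsMeasure t ν → IsMeasure (s ℚ.+ t) (λ φ → μ φ + ν φ)
isMeasure-+ {μ = μ} {ν} isμ isν = record
  { nonNegative  = λ φ → ≼-trans (≼-reflexive (≃-sym (+-identityˡ 0ℝ))) (+-mono-≼ (M.nonNegative φ) (N.nonNegative φ))
  ; tautology    = λ φ ⊨φ → ≃-trans (+-cong (M.tautology φ ⊨φ) (N.tautology φ ⊨φ)) (pointwise λ _ → refl)
  ; additive     = λ φ θ φ⊨∼θ → ≃-trans (+-cong (M.additive φ θ φ⊨∼θ) (N.additive φ θ φ⊨∼θ)) (+-interchange (μ φ) (μ θ) (ν φ) (ν θ))
  ; existential  = λ φ → ⟶-+ (M.existential φ) (N.existential φ)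
  ; exchangeable = λ π φ → +-cong (M.exchangeable π φ) (N.exchangeable π φ)
  }
  where
  module M = IsMeasure isμ
  module N = IsMeasure isν

isMeasure-· : ∀ {c s} {μ : Sentence q → ℝ} → 0ℚ ℚ.≤ c → IsMeasure s μ → IsMeasure (c ℚ.* s) (λ φ → c · μ φ)
isMeasure-· {c = c} {μ = μ} 0≤c isμ = record
  { nonNegative  = λ φ → ≼-trans (≼-reflexive (≃-sym (·-zeroʳ c))) (·-mono-≼ 0≤c (M.nonNegative φ))
  ; tautology    = λ φ ⊨φ → ≃-trans (·-cong c (M.tautology φ ⊨φ)) (pointwise λ _ → refl)
  ; additive     = λ φ θ φ⊨∼θ → ≃-trans (·-cong c (M.additive φ θ φ⊨∼θ)) (·-distribˡ c (μ φ) (μ θ))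
  ; existential  = λ φ → ⟶-· 0≤c (M.existential φ)
  ; exchangeable = λ π φ → ·-cong c (M.exchangeable π φ)
  }
  where module M = IsMeasure isμ

-- Semantics of state descriptions

module _ (M : Structure q) where
  open Structure M

  type : Universe → Atom q
  type u = tabulate λ i → holds i u

  Sat-⋀⁻ : ∀ {ρ : Fin n → Universe} (φ : Fin m → Formula q n) → Sat M ρ (⋀ φ) → ∀ i → Sat M ρ (φ i)
  Sat-⋀⁻ φ (s , _)  zero    = s
  Sat-⋀⁻ φ (_ , ss) (suc i) = Sat-⋀⁻ (φ ∘ suc) ss i

  Sat-⋀⁺ : ∀ {ρ : Fin n → Universe} (φ : Fin m → Formula q n) → (∀ i → Sat M ρ (φ i)) → Sat M ρ (⋀ φ)
  Sat-⋀⁺ {m = zero}  φ f = _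
  Sat-⋀⁺ {m = suc m} φ f = f zero , Sat-⋀⁺ (φ ∘ suc) (f ∘ suc)

  Sat-literal⁻ : ∀ {ρ : Fin n → Universe} b i (t : Term n) →
    Sat M ρ (if b then P i t else ∼ P i t) → holds i (value M ρ t) ≡ b
  Sat-literal⁻ {ρ = ρ} b i t s with holds i (value M ρ t) in eq
  Sat-literal⁻ true  i t s | true  = refl
  Sat-literal⁻ true  i t s | false = ⊥-elim (≡.subst T eq s)
  Sat-literal⁻ false i t s | true  = ⊥-elim (s (≡.subst T (sym eq) _))
  Sat-literal⁻ false i t s | false = refl

  Sat-literal⁺ : ∀ {ρ : Fin n → Universe} b i (t : Term n) →
    holds i (value M ρ t) ≡ b → Sat M ρ (if b then P i t else ∼ P i t)
  Sat-literal⁺ true  i t eq = ≡.subst T (sym eq) _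
  Sat-literal⁺ false i t eq = λ s → ≡.subst T eq s

  Sat-atom⁻ : ∀ {ρ : Fin n → Universe} α (t : Term n) → Sat M ρ (atom α t) → type (value M ρ t) ≡ α
  Sat-atom⁻ α t s = trans (Vec.tabulate-cong λ i → Sat-literal⁻ (lookup α i) i t (Sat-⋀⁻ _ s i)) (Vec.tabulate∘lookup α)

  Sat-atom⁺ : ∀ {ρ : Fin n → Universe} α (t : Term n) → type (value M ρ t) ≡ α → Sat M ρ (atom α t)
  Sat-atom⁺ α t refl = Sat-⋀⁺ _ λ i → Sat-literal⁺ _ i t (sym (Vec.lookup∘tabulate _ i))

  module _ (c : Fin m → ℕ) (h : Fin m → Atom q) where
    True-atoms⁻ : True M (⋀ λ k → atom (h k) (const (c k))) → ∀ k → type (constant (c k)) ≡ h k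
    True-atoms⁻ s k = Sat-atom⁻ (h k) (const (c k)) (Sat-⋀⁻ _ s k)

    True-atoms⁺ : (∀ k → type (constant (c k)) ≡ h k) → True M (⋀ λ k → atom (h k) (const (c k)))
    True-atoms⁺ f = Sat-⋀⁺ _ λ k → Sat-atom⁺ (h k) (const (c k)) (f k)

-- Interpretations

-- A decision tree on the predicates, with `b` evaluated at the leaves: it says that `b` holds of
-- the sign vector of `t`. Satisfaction is then computed by testing one predicate at a time.
byCases : (s : ℕ) → (Fin s → Fin q) → (Atom s → Bool) → Term n → Formula q n
byCases zero    p b t = if b [] then ⊤ᶠ else ∼ ⊤ᶠ
byCases (suc s) p b t = (P (p zero) t ⇒ byCases s (p ∘ suc) (b ∘ (true ∷_)) t)
                      ∧ (∼ P (p zero) t ⇒ byCases s (p ∘ suc) (b ∘ (false ∷_)) t)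

-- An individual of type α is regarded as having type κ α.
interpret : (Atom q → Atom r) → Formula r n → Formula q n
interpret κ ⊤ᶠ      = ⊤ᶠ
interpret κ (P i t) = byCases _ id (λ α → lookup (κ α) i) t
interpret κ (∼ φ)   = ∼ interpret κ φ
interpret κ (φ ∧ ψ) = interpret κ φ ∧ interpret κ ψ
interpret κ (φ ∨ ψ) = interpret κ φ ∨ interpret κ ψ
interpret κ (φ ⇒ ψ) = interpret κ φ ⇒ interpret κ ψ
interpret κ (∀ᶠ φ)  = ∀ᶠ (interpret κ φ)
interpret κ (∃ᶠ φ)  = ∃ᶠ (interpret κ φ)

reduct : (Atom q → Atom r) → Structure q → Structure r
reduct κ M = record { Universe = Universe ; constant = constant ; holds = λ i u → lookup (κ (type M u)) i }
  where open Structure M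

type-reduct : ∀ (κ : Atom q → Atom r) M u → type (reduct κ M) u ≡ κ (type M u)
type-reduct κ M u = Vec.tabulate∘lookup (κ (type M u))

module _ (M : Structure q) where
  open Structure M

  Sat-byCases⁻ : ∀ {ρ : Fin n → Universe} s (p : Fin s → Fin q) b t →
    Sat M ρ (byCases s p b t) → T (b (tabulate λ i → holds (p i) (value M ρ t)))
  Sat-byCases⁻ zero    p b t s with b []
  ... | true  = _
  ... | false = s _
  Sat-byCases⁻ {ρ = ρ} (suc s) p b t (f , g) with holds (p zero) (value M ρ t)
  ... | true  = Sat-byCases⁻ s (p ∘ suc) (b ∘ (true ∷_)) t (f _)
  ... | false = Sat-byCases⁻ s (p ∘ suc) (b ∘ (false ∷_)) t (g λ ())

  Sat-byCases⁺ : ∀ {ρ : Fin n → Universe} s (p : Fin s → Fin q) b t →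
    T (b (tabulate λ i → holds (p i) (value M ρ t))) → Sat M ρ (byCases s p b t)
  Sat-byCases⁺ zero    p b t s with b []
  ... | true  = _
  Sat-byCases⁺ {ρ = ρ} (suc s) p b t h with holds (p zero) (value M ρ t)
  ... | true  = (λ _ → Sat-byCases⁺ s (p ∘ suc) (b ∘ (true ∷_)) t h) , λ f → ⊥-elim (f _)
  ... | false = (λ ()) , λ _ → Sat-byCases⁺ s (p ∘ suc) (b ∘ (false ∷_)) t h

module _ (κ : Atom q → Atom r) (M : Structure q) where
  open Structure M

  private
    N : Structure r
    N = reduct κ M

  value-reduct : ∀ {ρ ρ′ : Fin n → Universe} → (∀ i → ρ i ≡ ρ′ i) → ∀ t → value M ρ t ≡ value N ρ′ t
  value-reduct eq (var i)   = eq i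
  value-reduct eq (const k) = refl

  extend-reduct : ∀ {ρ ρ′ : Fin n → Universe} → (∀ i → ρ i ≡ ρ′ i) → ∀ u i → extend M ρ u i ≡ extend N ρ′ u i
  extend-reduct eq u zero    = refl
  extend-reduct eq u (suc i) = eq i

  -- The two directions are mutually recursive because `∼` and `⇒` reverse them. Assignments are
  -- related pointwise, since `extend` yields different functions for the two structures.
  Sat-interpret⁻ : ∀ {ρ ρ′ : Fin n → Universe} → (∀ i → ρ i ≡ ρ′ i) → ∀ φ → Sat M ρ (interpret κ φ) → Sat N ρ′ φ
  Sat-interpret⁺ : ∀ {ρ ρ′ : Fin n → Universe} → (∀ i → ρ i ≡ ρ′ i) → ∀ φ → Sat N ρ′ φ → Sat M ρ (interpret κ φ)

  Sat-interpret⁻ eq ⊤ᶠ      s = _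
  Sat-interpret⁻ eq (P i t) s = ≡.subst (λ u → T (lookup (κ (type M u)) i)) (value-reduct eq t) (Sat-byCases⁻ M _ id _ t s)
  Sat-interpret⁻ eq (∼ φ)   s = λ t → s (Sat-interpret⁺ eq φ t)
  Sat-interpret⁻ eq (φ ∧ ψ) (s , t) = Sat-interpret⁻ eq φ s , Sat-interpret⁻ eq ψ t
  Sat-interpret⁻ eq (φ ∨ ψ) s = λ k → s (k ∘ Sum.map (Sat-interpret⁻ eq φ) (Sat-interpret⁻ eq ψ))
  Sat-interpret⁻ eq (φ ⇒ ψ) s = λ t → Sat-interpret⁻ eq ψ (s (Sat-interpret⁺ eq φ t))
  Sat-interpret⁻ eq (∀ᶠ φ)  s = λ u → Sat-interpret⁻ (extend-reduct eq u) φ (s u)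
  Sat-interpret⁻ eq (∃ᶠ φ)  s = λ k → s λ (u , t) → k (u , Sat-interpret⁻ (extend-reduct eq u) φ t)

  Sat-interpret⁺ eq ⊤ᶠ      s = _
  Sat-interpret⁺ eq (P i t) s = Sat-byCases⁺ M _ id _ t (≡.subst (λ u → T (lookup (κ (type M u)) i)) (sym (value-reduct eq t)) s)
  Sat-interpret⁺ eq (∼ φ)   s = λ t → s (Sat-interpret⁻ eq φ t)
  Sat-interpret⁺ eq (φ ∧ ψ) (s , t) = Sat-interpret⁺ eq φ s , Sat-interpret⁺ eq ψ t
  Sat-interpret⁺ eq (φ ∨ ψ) s = λ k → s (k ∘ Sum.map (Sat-interpret⁺ eq φ) (Sat-interpret⁺ eq ψ))
  Sat-interpret⁺ eq (φ ⇒ ψ) s = λ t → Sat-interpret⁺ eq ψ (s (Sat-interpret⁻ eq φ t))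
  Sat-interpret⁺ eq (∀ᶠ φ)  s = λ u → Sat-interpret⁺ (extend-reduct eq u) φ (s u)
  Sat-interpret⁺ eq (∃ᶠ φ)  s = λ k → s λ (u , t) → k (u , Sat-interpret⁺ (extend-reduct eq u) φ t)

  True-interpret⁻ : ∀ φ → True M (interpret κ φ) → True N φ
  True-interpret⁻ = Sat-interpret⁻ λ ()

  True-interpret⁺ : ∀ φ → True N φ → True M (interpret κ φ)
  True-interpret⁺ = Sat-interpret⁺ λ ()

  module _ (h : Fin m → Atom r) where
    True-interpret-stateDescription⁻ : True M (interpret κ (stateDescription h)) → ∀ k → κ (type M (constant (toℕ k))) ≡ h k
    True-interpret-stateDescription⁻ s k =
      trans (sym (type-reduct κ M _)) (True-atoms⁻ N toℕ h (True-interpret⁻ (stateDescription h) s) k)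

    True-interpret-stateDescription⁺ : (∀ k → κ (type M (constant (toℕ k))) ≡ h k) → True M (interpret κ (stateDescription h))
    True-interpret-stateDescription⁺ f =
      True-interpret⁺ (stateDescription h) (True-atoms⁺ N toℕ h λ k → trans (type-reduct κ M _) (f k))

byCases-cong : ∀ s (p : Fin s → Fin q) {b b′} → (∀ α → b α ≡ b′ α) → ∀ {t t′ : Term n} → t ≡ t′ → byCases s p b t ≡ byCases s p b′ t′
byCases-cong zero    p eq refl = cong (if_then ⊤ᶠ else ∼ ⊤ᶠ) (eq [])
byCases-cong (suc s) p eq {t} refl = cong₂ (λ φ ψ → (P (p zero) t ⇒ φ) ∧ (∼ P (p zero) t ⇒ ψ))
  (byCases-cong s (p ∘ suc) (eq ∘ (true ∷_)) refl) (byCases-cong s (p ∘ suc) (eq ∘ (false ∷_)) refl)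

interpret-cong : ∀ {κ κ′ : Atom q → Atom r} → (∀ α → κ α ≡ κ′ α) → ∀ (φ : Formula r n) → interpret κ φ ≡ interpret κ′ φ
interpret-cong eq ⊤ᶠ      = refl
interpret-cong eq (P i t) = byCases-cong _ id (λ α → cong (λ β → lookup β i) (eq α)) refl
interpret-cong eq (∼ φ)   = cong ∼_ (interpret-cong eq φ)
interpret-cong eq (φ ∧ ψ) = cong₂ _∧_ (interpret-cong eq φ) (interpret-cong eq ψ)
interpret-cong eq (φ ∨ ψ) = cong₂ _∨_ (interpret-cong eq φ) (interpret-cong eq ψ)
interpret-cong eq (φ ⇒ ψ) = cong₂ _⇒_ (interpret-cong eq φ) (interpret-cong eq ψ)
interpret-cong eq (∀ᶠ φ)  = cong ∀ᶠ (interpret-cong eq φ)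
interpret-cong eq (∃ᶠ φ)  = cong ∃ᶠ (interpret-cong eq φ)

restrictAtom : (Fin r → Fin r′) → Atom r′ → Atom r
restrictAtom f α = tabulate λ i → lookup α (f i)

renameTerm-id : (t : Term n) → renameTerm id t ≡ t
renameTerm-id (var i)   = refl
renameTerm-id (const k) = refl

-- Entry `f i` of `κ α` is entry `i` of the restricted atom. Restricting a push-forward to a
-- sublanguage is therefore a push-forward again, along the restricted map.
interpret-restrict : ∀ (κ : Atom q → Atom r′) (f : Fin r → Fin r′) (φ : Formula r n) →
  interpret κ (rename f id φ) ≡ interpret (restrictAtom f ∘ κ) φ
interpret-restrict κ f ⊤ᶠ      = refl
interpret-restrict κ f (P i t) = byCases-cong _ id (λ α → sym (Vec.lookup∘tabulate _ i)) (renameTerm-id t)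
interpret-restrict κ f (∼ φ)   = cong ∼_ (interpret-restrict κ f φ)
interpret-restrict κ f (φ ∧ ψ) = cong₂ _∧_ (interpret-restrict κ f φ) (interpret-restrict κ f ψ)
interpret-restrict κ f (φ ∨ ψ) = cong₂ _∨_ (interpret-restrict κ f φ) (interpret-restrict κ f ψ)
interpret-restrict κ f (φ ⇒ ψ) = cong₂ _⇒_ (interpret-restrict κ f φ) (interpret-restrict κ f ψ)
interpret-restrict κ f (∀ᶠ φ)  = cong ∀ᶠ (interpret-restrict κ f φ)
interpret-restrict κ f (∃ᶠ φ)  = cong ∃ᶠ (interpret-restrict κ f φ)

rename-byCases : ∀ s (p : Fin s → Fin q) b (g : ℕ → ℕ) (t : Term n) →
  byCases s p b (renameTerm g t) ≡ rename id g (byCases s p b t)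
rename-byCases zero    p b g t with b []
... | true  = refl
... | false = refl
rename-byCases (suc s) p b g t = cong₂ (λ φ ψ → (P (p zero) (renameTerm g t) ⇒ φ) ∧ (∼ P (p zero) (renameTerm g t) ⇒ ψ))
  (rename-byCases s (p ∘ suc) (b ∘ (true ∷_)) g t) (rename-byCases s (p ∘ suc) (b ∘ (false ∷_)) g t)

interpret-rename : ∀ (κ : Atom q → Atom r) (g : ℕ → ℕ) (φ : Formula r n) →
  interpret κ (rename id g φ) ≡ rename id g (interpret κ φ)
interpret-rename κ g ⊤ᶠ      = refl
interpret-rename κ g (P i t) = rename-byCases _ id _ g t
interpret-rename κ g (∼ φ)   = cong ∼_ (interpret-rename κ g φ)
interpret-rename κ g (φ ∧ ψ) = cong₂ _∧_ (interpret-rename κ g φ) (interpret-rename κ g ψ)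
interpret-rename κ g (φ ∨ ψ) = cong₂ _∨_ (interpret-rename κ g φ) (interpret-rename κ g ψ)
interpret-rename κ g (φ ⇒ ψ) = cong₂ _⇒_ (interpret-rename κ g φ) (interpret-rename κ g ψ)
interpret-rename κ g (∀ᶠ φ)  = cong ∀ᶠ (interpret-rename κ g φ)
interpret-rename κ g (∃ᶠ φ)  = cong ∃ᶠ (interpret-rename κ g φ)

subst-byCases : ∀ s (p : Fin s → Fin q) b (σ : Fin m → Term n) t →
  byCases s p b (substTerm σ t) ≡ subst σ (byCases s p b t)
subst-byCases zero    p b σ t with b []
... | true  = refl
... | false = refl
subst-byCases (suc s) p b σ t = cong₂ (λ φ ψ → (P (p zero) (substTerm σ t) ⇒ φ) ∧ (∼ P (p zero) (substTerm σ t) ⇒ ψ))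
  (subst-byCases s (p ∘ suc) (b ∘ (true ∷_)) σ t) (subst-byCases s (p ∘ suc) (b ∘ (false ∷_)) σ t)

interpret-subst : ∀ (κ : Atom q → Atom r) (σ : Fin m → Term n) φ → interpret κ (subst σ φ) ≡ subst σ (interpret κ φ)
interpret-subst κ σ ⊤ᶠ      = refl
interpret-subst κ σ (P i t) = subst-byCases _ id _ σ t
interpret-subst κ σ (∼ φ)   = cong ∼_ (interpret-subst κ σ φ)
interpret-subst κ σ (φ ∧ ψ) = cong₂ _∧_ (interpret-subst κ σ φ) (interpret-subst κ σ ψ)
interpret-subst κ σ (φ ∨ ψ) = cong₂ _∨_ (interpret-subst κ σ φ) (interpret-subst κ σ ψ)
interpret-subst κ σ (φ ⇒ ψ) = cong₂ _⇒_ (interpret-subst κ σ φ) (interpret-subst κ σ ψ)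
interpret-subst κ σ (∀ᶠ φ)  = cong ∀ᶠ (interpret-subst κ (lift σ) φ)
interpret-subst κ σ (∃ᶠ φ)  = cong ∃ᶠ (interpret-subst κ (lift σ) φ)

interpret-⋁ : ∀ (κ : Atom q → Atom r) (φ : Formula r 1) (c : Fin k → ℕ) →
  interpret κ (⋁ λ i → φ ⟨ c i ⟩) ≡ ⋁ λ i → interpret κ φ ⟨ c i ⟩
interpret-⋁ {k = zero}  κ φ c = refl
interpret-⋁ {k = suc k} κ φ c = cong₂ _∨_ (interpret-subst κ _ φ) (interpret-⋁ κ φ (c ∘ suc))

-- The reduct keeps the universe and the constants, so validity and entailment transfer, and the
-- instances of an interpreted formula are the interpreted instances.
isMeasure-interpret : ∀ {s} {μ : Sentence q → ℝ} (κ : Atom q → Atom r) → IsMeasure s μ → IsMeasure s (μ ∘ interpret κ)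
isMeasure-interpret {μ = μ} κ isμ = record
  { nonNegative  = λ φ → nonNegative (interpret κ φ)
  ; tautology    = λ φ ⊨φ → tautology (interpret κ φ) λ M → True-interpret⁺ κ M φ (⊨φ (reduct κ M))
  ; additive     = λ φ θ φ⊨∼θ → additive (interpret κ φ) (interpret κ θ) λ M t →
                     True-interpret⁺ κ M (∼ θ) (φ⊨∼θ (reduct κ M) (True-interpret⁻ κ M φ t))
  ; existential  = λ φ → ⟶-resp (λ k → ≃-reflexive (cong μ (sym (interpret-⋁ κ φ (toℕ {k}))))) ≃-refl (existential (interpret κ φ))
  ; exchangeable = λ π φ → ≃-trans (≃-reflexive (cong μ (interpret-rename κ _ φ))) (exchangeable π (interpret κ φ))
  }
  where open IsMeasure isμ

-- Measures are determined by their values on state descriptions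


module _ (M : Structure q) where
  open Structure M

  value-weaken : ∀ (ρ : Fin n → Universe) u t → value M (extend M ρ u) (weaken t) ≡ value M ρ t
  value-weaken ρ u (var i)   = refl
  value-weaken ρ u (const k) = refl

  value-lift : ∀ {ρ : Fin n → Universe} {ρ′ : Fin m → Universe} {σ} → (∀ i → value M ρ (σ i) ≡ ρ′ i) →
    ∀ u i → value M (extend M ρ u) (lift σ i) ≡ extend M ρ′ u i
  value-lift eq u zero    = refl
  value-lift {ρ = ρ} {σ = σ} eq u (suc i) = trans (value-weaken ρ u (σ i)) (eq i)

  value-subst : ∀ {ρ : Fin n → Universe} {ρ′ : Fin m → Universe} {σ} → (∀ i → value M ρ (σ i) ≡ ρ′ i) →
    ∀ t → value M ρ (substTerm σ t) ≡ value M ρ′ t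
  value-subst eq (var i)   = eq i
  value-subst eq (const k) = refl

  Sat-subst⁻ : ∀ {ρ : Fin n → Universe} {ρ′ : Fin m → Universe} {σ} → (∀ i → value M ρ (σ i) ≡ ρ′ i) →
    ∀ φ → Sat M ρ (subst σ φ) → Sat M ρ′ φ
  Sat-subst⁺ : ∀ {ρ : Fin n → Universe} {ρ′ : Fin m → Universe} {σ} → (∀ i → value M ρ (σ i) ≡ ρ′ i) →
    ∀ φ → Sat M ρ′ φ → Sat M ρ (subst σ φ)

  Sat-subst⁻ eq ⊤ᶠ      s = _
  Sat-subst⁻ eq (P i t) s = ≡.subst (T ∘ holds i) (value-subst eq t) s
  Sat-subst⁻ eq (∼ φ)   s = λ t → s (Sat-subst⁺ eq φ t)
  Sat-subst⁻ eq (φ ∧ ψ) (s , t) = Sat-subst⁻ eq φ s , Sat-subst⁻ eq ψ t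
  Sat-subst⁻ eq (φ ∨ ψ) s = λ k → s (k ∘ Sum.map (Sat-subst⁻ eq φ) (Sat-subst⁻ eq ψ))
  Sat-subst⁻ eq (φ ⇒ ψ) s = λ t → Sat-subst⁻ eq ψ (s (Sat-subst⁺ eq φ t))
  Sat-subst⁻ {σ = σ} eq (∀ᶠ φ) s = λ u → Sat-subst⁻ (value-lift {σ = σ} eq u) φ (s u)
  Sat-subst⁻ {σ = σ} eq (∃ᶠ φ) s = λ k → s λ (u , t) → k (u , Sat-subst⁻ (value-lift {σ = σ} eq u) φ t)

  Sat-subst⁺ eq ⊤ᶠ      s = _
  Sat-subst⁺ eq (P i t) s = ≡.subst (T ∘ holds i) (sym (value-subst eq t)) s
  Sat-subst⁺ eq (∼ φ)   s = λ t → s (Sat-subst⁻ eq φ t)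
  Sat-subst⁺ eq (φ ∧ ψ) (s , t) = Sat-subst⁺ eq φ s , Sat-subst⁺ eq ψ t
  Sat-subst⁺ eq (φ ∨ ψ) s = λ k → s (k ∘ Sum.map (Sat-subst⁺ eq φ) (Sat-subst⁺ eq ψ))
  Sat-subst⁺ eq (φ ⇒ ψ) s = λ t → Sat-subst⁺ eq ψ (s (Sat-subst⁻ eq φ t))
  Sat-subst⁺ {σ = σ} eq (∀ᶠ φ) s = λ u → Sat-subst⁺ (value-lift {σ = σ} eq u) φ (s u)
  Sat-subst⁺ {σ = σ} eq (∃ᶠ φ) s = λ k → s λ (u , t) → k (u , Sat-subst⁺ (value-lift {σ = σ} eq u) φ t)

  instance⁻ : ∀ (φ : Formula q 1) k → True M (φ ⟨ k ⟩) → Sat M (extend M (λ ()) (constant k)) φ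
  instance⁻ φ k = Sat-subst⁻ (λ { zero → refl }) φ

  instance⁺ : ∀ (φ : Formula q 1) k → Sat M (extend M (λ ()) (constant k)) φ → True M (φ ⟨ k ⟩)
  instance⁺ φ k = Sat-subst⁺ (λ { zero → refl }) φ

  True-⋁-instances : ∀ (φ : Formula q 1) (c : Fin k → ℕ) → True M (⋁ λ i → φ ⟨ c i ⟩) → True M (∃ᶠ φ)
  True-⋁-instances {k = zero}  φ c s = ⊥-elim (s _)
  True-⋁-instances {k = suc k} φ c s = λ f → s λ
    { (inj₁ t) → f (constant (c zero) , instance⁻ φ (c zero) t)
    ; (inj₂ t) → True-⋁-instances φ (c ∘ suc) t f }

-- Approximation by sentences about finitely many constants

infix 5 _⇿_ _△_

_⇿_ _△_ : Sentence q → Sentence q → Sentence q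
φ ⇿ ψ = (φ ⇒ ψ) ∧ (ψ ⇒ φ)
φ △ ψ = ∼ (φ ⇿ ψ)

-- The types of the first `m` constants settle `φ`, which is thus in effect a disjunction of state
-- descriptions. Which alternative holds is data, so proofs may split on it.
Decided : ℕ → Sentence q → Set₁
Decided {q} m φ = (h : Fin m → Atom q) → (stateDescription h ⊨ φ) ⊎ (stateDescription h ⊨ ∼ φ)

Decided-weaken : m ≤ⁿ n → (φ : Sentence q) → Decided m φ → Decided n φ
Decided-weaken m≤n φ d h = Sum.map (λ f M t → f M (shorten M t)) (λ f M t → f M (shorten M t)) (d (λ k → h (inject≤ k m≤n)))
  where
  shorten : stateDescription h ⊨ stateDescription (λ k → h (inject≤ k m≤n))
  shorten M t = True-atoms⁺ M toℕ _ λ k → trans (cong (type M ∘ Structure.constant M) (sym (Fin.toℕ-inject≤ k m≤n)))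
    (True-atoms⁻ M toℕ h t (inject≤ k m≤n))

Decided-∼ : (φ : Sentence q) → Decided m φ → Decided m (∼ φ)
Decided-∼ φ d h with d h
... | inj₁ f = inj₂ λ M t g → g (f M t)
... | inj₂ f = inj₁ f

Decided-∧ : (φ ψ : Sentence q) → Decided m φ → Decided m ψ → Decided m (φ ∧ ψ)
Decided-∧ φ ψ d e h with d h | e h
... | inj₁ f | inj₁ g = inj₁ λ M t → f M t , g M t
... | inj₂ f | _      = inj₂ λ M t (a , _) → f M t a
... | inj₁ _ | inj₂ g = inj₂ λ M t (_ , b) → g M t b

Decided-∨ : (φ ψ : Sentence q) → Decided m φ → Decided m ψ → Decided m (φ ∨ ψ)
Decided-∨ φ ψ d e h with d h | e h
... | inj₁ f | _      = inj₁ λ M t k → k (inj₁ (f M t))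
... | inj₂ _ | inj₁ g = inj₁ λ M t k → k (inj₂ (g M t))
... | inj₂ f | inj₂ g = inj₂ λ M t s → s λ { (inj₁ a) → f M t a ; (inj₂ b) → g M t b }

Decided-⇒ : (φ ψ : Sentence q) → Decided m φ → Decided m ψ → Decided m (φ ⇒ ψ)
Decided-⇒ φ ψ d e h with d h | e h
... | inj₂ f | _      = inj₁ λ M t a → ⊥-elim (f M t a)
... | inj₁ _ | inj₁ g = inj₁ λ M t _ → g M t
... | inj₁ f | inj₂ g = inj₂ λ M t s → g M t (s (f M t))

Decided-P : ∀ (i : Fin q) k → Decided (suc k) (P i (const k))
Decided-P i k h = sign (lookup (h j) i) refl
  where
  j : Fin (suc k)
  j = fromℕ k
  holds≡ : ∀ M → True M (stateDescription h) → Structure.holds M i (Structure.constant M k) ≡ lookup (h j) i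
  holds≡ M t = trans (sym (Vec.lookup∘tabulate _ i)) (cong (λ α → lookup α i)
    (trans (cong (type M ∘ Structure.constant M) (sym (Fin.toℕ-fromℕ k))) (True-atoms⁻ M toℕ h t j)))
  sign : ∀ b → lookup (h j) i ≡ b → (stateDescription h ⊨ P i (const k)) ⊎ (stateDescription h ⊨ ∼ P i (const k))
  sign true  eq = inj₁ λ M t → ≡.subst T (sym (trans (holds≡ M t) eq)) _
  sign false eq = inj₂ λ M t s → ≡.subst T (trans (holds≡ M t) eq) s

module Approximation {s : ℚ} {κ : Sentence q → ℝ} (isκ : IsMeasure s κ) where
  open Measure isκ

  Approximable : Sentence q → Set₁
  Approximable φ = ∀ ε → 0ℚ ℚ.< ε → ∃ λ m → Σ (Sentence q) λ φ̃ → Decided m φ̃ × (κ (φ △ φ̃) ≼ fromℚ ε)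

  decided⇒approximable : ∀ φ → Decided m φ → Approximable φ
  decided⇒approximable φ d ε 0<ε = _ , φ , d ,
    ≼-trans (≼-reflexive (inconsistent (φ △ φ) λ M f → f ((λ t → t) , λ t → t))) (fromℚ-mono (ℚ.<⇒≤ 0<ε))

  -- Where `χ` and `χ̃` differ, one of the two given pairs must differ, so the union bound applies.
  -- Asking only for an implication in every structure lets one lemma serve the connectives and the
  -- triangle inequality for `κ (φ △ ψ)`.
  △-cover : ∀ φ φ̃ ψ ψ̃ χ χ̃ → (∀ M → True M (φ ⇿ φ̃) → True M (ψ ⇿ ψ̃) → True M (χ ⇿ χ̃)) →
    ∀ ε → κ (φ △ φ̃) ≼ fromℚ (ε ℚ.* ½) → κ (ψ △ ψ̃) ≼ fromℚ (ε ℚ.* ½) → κ (χ △ χ̃) ≼ fromℚ ε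
  △-cover φ φ̃ ψ ψ̃ χ χ̃ f ε p p′ = ≼-trans
    (monotone (χ △ χ̃) ((φ △ φ̃) ∨ (ψ △ ψ̃)) λ M g k → k (inj₁ λ a → k (inj₂ λ b → g (f M a b))))
    (≼-trans (subadditive (φ △ φ̃) (ψ △ ψ̃)) (≼-trans (+-mono-≼ p p′) (≼-reflexive (pointwise λ _ → halves ε))))

  approximable-resp : ∀ φ ψ → φ ⊨ ψ → ψ ⊨ φ → Approximable φ → Approximable ψ
  approximable-resp φ ψ f g a ε 0<ε with a ε 0<ε
  ... | m , φ̃ , d , p = m , φ̃ , d , ≼-trans
    (monotone (ψ △ φ̃) (φ △ φ̃) λ M k (s , t) → k ((λ x → s (g M x)) , λ x → f M (t x))) p

  approximable-op : (_⊙_ : Sentence q → Sentence q → Sentence q) →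
    (∀ {m} φ ψ → Decided m φ → Decided m ψ → Decided m (φ ⊙ ψ)) →
    (∀ M φ φ̃ ψ ψ̃ → True M (φ ⇿ φ̃) → True M (ψ ⇿ ψ̃) → True M ((φ ⊙ ψ) ⇿ (φ̃ ⊙ ψ̃))) →
    ∀ φ ψ → Approximable φ → Approximable ψ → Approximable (φ ⊙ ψ)
  approximable-op _⊙_ dec cng φ ψ a b ε 0<ε with a (ε ℚ.* ½) (half-pos ε 0<ε) | b (ε ℚ.* ½) (half-pos ε 0<ε)
  ... | m , φ̃ , d , p | n , ψ̃ , e , p′ = m ⊔ n , φ̃ ⊙ ψ̃ ,
    dec φ̃ ψ̃ (Decided-weaken (ℕ.m≤m⊔n m n) φ̃ d) (Decided-weaken (ℕ.m≤n⊔m m n) ψ̃ e) ,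
    △-cover φ φ̃ ψ ψ̃ (φ ⊙ ψ) (φ̃ ⊙ ψ̃) (λ M → cng M φ φ̃ ψ ψ̃) ε p p′

  approximable-∼ : ∀ φ → Approximable φ → Approximable (∼ φ)
  approximable-∼ φ a = approximable-op (λ φ _ → ∼ φ) (λ φ _ d _ → Decided-∼ φ d)
    (λ M φ φ̃ ψ ψ̃ (f , g) _ → (λ s t → s (g t)) , (λ s t → s (f t))) φ φ a a

  approximable-∧ : ∀ φ ψ → Approximable φ → Approximable ψ → Approximable (φ ∧ ψ)
  approximable-∧ = approximable-op _∧_ Decided-∧
    (λ M φ φ̃ ψ ψ̃ (f , g) (f′ , g′) → (λ (s , t) → f s , f′ t) , (λ (s , t) → g s , g′ t))

  approximable-∨ : ∀ φ ψ → Approximable φ → Approximable ψ → Approximable (φ ∨ ψ)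
  approximable-∨ = approximable-op _∨_ Decided-∨
    (λ M φ φ̃ ψ ψ̃ (f , g) (f′ , g′) → (λ s k → s (k ∘ Sum.map f f′)) , (λ s k → s (k ∘ Sum.map g g′)))

  approximable-⇒ : ∀ φ ψ → Approximable φ → Approximable ψ → Approximable (φ ⇒ ψ)
  approximable-⇒ = approximable-op _⇒_ Decided-⇒
    (λ M φ φ̃ ψ ψ̃ (f , g) (f′ , g′) → (λ s t → f′ (s (g t))) , (λ s t → g′ (s (f t))))

  approximable-⊤ : Approximable ⊤ᶠ
  approximable-⊤ = decided⇒approximable {m = 0} ⊤ᶠ λ h → inj₁ _

  approximable-⋁ : (φ : Fin k → Sentence q) → (∀ i → Approximable (φ i)) → Approximable (⋁ φ)
  approximable-⋁ {k = zero}  φ a = approximable-∼ ⊤ᶠ approximable-⊤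
  approximable-⋁ {k = suc k} φ a = approximable-∨ (φ zero) (⋁ (φ ∘ suc)) (a zero) (approximable-⋁ (φ ∘ suc) (a ∘ suc))

  -- The finite disjunctions of instances converge to `∃ᶠ φ` in measure, and each entails it; hence
  -- one that is close in measure is equally close in symmetric difference. That disjunction is then
  -- approximated in turn.
  approximable-∃ : ∀ φ → (∀ k → Approximable (φ ⟨ k ⟩)) → Approximable (∃ᶠ φ)
  approximable-∃ φ a ε 0<ε =
    let N , close = ⌈ existential φ ⌉⟶ (ε ℚ.* ½) (half-pos ε 0<ε)
        D = ⋁ λ (i : Fin N) → φ ⟨ toℕ i ⟩
        m , D̃ , d , p = approximable-⋁ (λ (i : Fin N) → φ ⟨ toℕ i ⟩) (λ i → a (toℕ i)) (ε ℚ.* ½) (half-pos ε 0<ε)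
    in m , D̃ , d , △-cover (∃ᶠ φ) D D D̃ (∃ᶠ φ) D̃
         (λ M (f , g) (f′ , g′) → (λ t → f′ (f t)) , (λ t → g (g′ t))) ε
         (difference D (λ M → True-⋁-instances M φ (toℕ {N})) (proj₂ (close N ℕ.≤-refl))) p
    where
    difference : ∀ D → D ⊨ ∃ᶠ φ → ∀ {δ} → κ (∃ᶠ φ) ≼ κ D + fromℚ δ → κ (∃ᶠ φ △ D) ≼ fromℚ δ
    difference D D⊨∃φ {δ} p = ≼-trans
      (monotone (∃ᶠ φ △ D) (∃ᶠ φ ∧ ∼ D) λ M k →
        Sat-stable M _ (∃ᶠ φ) (λ l → k ((λ e → ⊥-elim (l e)) , D⊨∃φ M)) , λ t → k ((λ _ → t) , D⊨∃φ M))
      (≼-resp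
        (≃-trans (+-cong (split (∃ᶠ φ) D) (neg-cong (respects D (∃ᶠ φ ∧ D) (λ M t → D⊨∃φ M t , t) λ M → proj₂)))
          (pointwise λ n → solve 2 (λ a b → (a :+ b) :- a := b) refl (seq (κ (∃ᶠ φ ∧ D)) n) (seq (κ (∃ᶠ φ ∧ ∼ D)) n)))
        (pointwise λ n → solve 2 (λ a b → (a :+ b) :- a := b) refl (seq (κ D) n) δ)
        (+-mono-≼ p ≼-refl))

  -- The induction runs over formulas with free variables, all filled with constants: below a
  -- quantifier it is the instances at constants that the limit clause of a measure speaks of.
  approximable-instance : (φ : Formula q n) (c : Fin n → ℕ) → Approximable (subst (const ∘ c) φ)
  -- Instantiating the lifted substitution at `k` amounts to substituting `c` with `k` put in front.
  -- The two sentences are compared by their truth in all structures, which replaces a syntactic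
  -- composition law for substitutions.
  approximable-body : (φ : Formula q (suc n)) (c : Fin n → ℕ) → ∀ k → Approximable (subst (lift (const ∘ c)) φ ⟨ k ⟩)

  approximable-instance ⊤ᶠ            c = approximable-⊤
  approximable-instance (P i (var j))   c = decided⇒approximable _ (Decided-P i (c j))
  approximable-instance (P i (const k)) c = decided⇒approximable _ (Decided-P i k)
  approximable-instance (∼ φ)   c = approximable-∼ _ (approximable-instance φ c)
  approximable-instance (φ ∧ ψ) c = approximable-∧ _ _ (approximable-instance φ c) (approximable-instance ψ c)
  approximable-instance (φ ∨ ψ) c = approximable-∨ _ _ (approximable-instance φ c) (approximable-instance ψ c)
  approximable-instance (φ ⇒ ψ) c = approximable-⇒ _ _ (approximable-instance φ c) (approximable-instance ψ c)
  approximable-instance (∃ᶠ φ)  c = approximable-∃ _ (approximable-body φ c)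
  -- The limit clause concerns `∃ᶠ`, so `∀ᶠ` is read as `∼ ∃ᶠ ∼`; stability of satisfaction makes
  -- the two equivalent.
  approximable-instance (∀ᶠ φ)  c = approximable-resp (∼ ∃ᶠ (∼ χ)) (∀ᶠ χ)
    (λ M s u → Sat-stable M _ χ λ k → s λ l → l (u , k))
    (λ M s t → t λ (u , k) → k (s u))
    (approximable-∼ (∃ᶠ (∼ χ)) (approximable-∃ (∼ χ) λ k → approximable-∼ (χ ⟨ k ⟩) (approximable-body φ c k)))
    where
    χ : Formula q 1
    χ = subst (lift (const ∘ c)) φ

  approximable-body φ c k = approximable-resp (subst (const ∘ c′) φ) (subst (lift (const ∘ c)) φ ⟨ k ⟩)
    (λ M s → instance⁺ M χ k (Sat-subst⁺ M (lifted M) φ (Sat-subst⁻ M {σ = const ∘ c′} (λ i → refl) φ s)))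
    (λ M s → Sat-subst⁺ M {σ = const ∘ c′} (λ i → refl) φ (Sat-subst⁻ M (lifted M) φ (instance⁻ M χ k s)))
    (approximable-instance φ c′)
    where
    χ : Formula q 1
    χ = subst (lift (const ∘ c)) φ
    c′ : Fin (suc _) → ℕ
    c′ zero    = k
    c′ (suc i) = c i
    lifted : ∀ M i → value M (extend M (λ ()) (Structure.constant M k)) (lift (const ∘ c) i) ≡ Structure.constant M (c′ i)
    lifted M zero    = refl
    lifted M (suc i) = refl

  approximable : ∀ φ → Approximable φ
  approximable φ = approximable-resp (subst (const ∘ λ ()) φ) φ
    (λ M → Sat-subst⁻ M (λ ()) φ) (λ M → Sat-subst⁺ M (λ ()) φ) (approximable-instance φ λ ())

module _ {s t : ℚ} {μ ν : Sentence q → ℝ} (isμ : IsMeasure s μ) (isν : IsMeasure t ν) where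
  private
    module M = Measure isμ
    module N = Measure isν

  agree-resp : ∀ φ ψ → φ ⊨ ψ → ψ ⊨ φ → μ φ ≃ ν φ → μ ψ ≃ ν ψ
  agree-resp φ ψ f g eq = ≃-trans (M.respects ψ φ g f) (≃-trans eq (N.respects φ ψ f g))

  agree-split : ∀ θ χ → μ (θ ∧ χ) ≃ ν (θ ∧ χ) → μ (θ ∧ ∼ χ) ≃ ν (θ ∧ ∼ χ) → μ θ ≃ ν θ
  agree-split θ χ eq eq′ = ≃-trans (M.split θ χ) (≃-trans (+-cong eq eq′) (≃-sym (N.split θ χ)))

  reassociate : ∀ θ χ ψ → μ (θ ∧ (χ ∧ ψ)) ≃ ν (θ ∧ (χ ∧ ψ)) → μ ((θ ∧ χ) ∧ ψ) ≃ ν ((θ ∧ χ) ∧ ψ)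
  reassociate θ χ ψ = agree-resp (θ ∧ (χ ∧ ψ)) ((θ ∧ χ) ∧ ψ) (λ M (a , b , c) → (a , b) , c) (λ M ((a , b) , c) → a , b , c)

  -- A case distinction on one literal after another; iterated over the constants in
  -- `agree-by-atoms`, it splits `θ` along all state descriptions without forming their disjunction.
  agree-by-literals : ∀ {s} (p : Fin s → Fin q) u θ →
    (∀ (α : Atom s) → let χ = ⋀ λ i → if lookup α i then P (p i) u else ∼ P (p i) u in μ (θ ∧ χ) ≃ ν (θ ∧ χ)) → μ θ ≃ ν θ
  agree-by-literals {zero}  p u θ agree = agree-resp (θ ∧ ⊤ᶠ) θ (λ M → proj₁) (λ M t → t , _) (agree [])
  agree-by-literals {suc s} p u θ agree = agree-split θ (P (p zero) u)
    (agree-by-literals (p ∘ suc) u (θ ∧ P (p zero) u) λ α → reassociate θ (P (p zero) u) _ (agree (true ∷ α)))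
    (agree-by-literals (p ∘ suc) u (θ ∧ ∼ P (p zero) u) λ α → reassociate θ (∼ P (p zero) u) _ (agree (false ∷ α)))

  agree-by-atoms : ∀ (c : Fin m → ℕ) θ →
    (∀ (h : Fin m → Atom q) → let χ = ⋀ λ k → atom (h k) (const (c k)) in μ (θ ∧ χ) ≃ ν (θ ∧ χ)) → μ θ ≃ ν θ
  agree-by-atoms {zero}  c θ agree = agree-resp (θ ∧ ⊤ᶠ) θ (λ M → proj₁) (λ M t → t , _) (agree λ ())
  agree-by-atoms {suc m} c θ agree = agree-by-literals id (const (c zero)) θ λ α →
    agree-by-atoms (c ∘ suc) (θ ∧ atom α (const (c zero))) λ h →
      reassociate θ (atom α (const (c zero))) _ (agree λ { zero → α ; (suc k) → h k })

  module _ (agree : ∀ {m} (h : Fin m → Atom q) → μ (stateDescription h) ≃ ν (stateDescription h)) where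
    agree-decided : ∀ φ → Decided m φ → μ φ ≃ ν φ
    agree-decided φ d = agree-by-atoms toℕ φ λ h → case d h of λ
      { (inj₁ f) → agree-resp (stateDescription h) (φ ∧ stateDescription h) (λ M t → f M t , t) (λ M → proj₂) (agree h)
      ; (inj₂ f) → ≃-trans (M.inconsistent _ λ M (a , t) → f M t a) (≃-sym (N.inconsistent _ λ M (a , t) → f M t a)) }

  private
    -- The sum of the measures dominates both, so a single `φ̃` approximates `φ` for `μ` and `ν` at
    -- once.
    module A = Approximation (isMeasure-+ isμ isν)

  close-by : ∀ φ φ̃ ε → μ (φ △ φ̃) + ν (φ △ φ̃) ≼ fromℚ ε →
    (μ φ ≼ μ φ̃ + fromℚ ε × μ φ̃ ≼ μ φ + fromℚ ε) × (ν φ ≼ ν φ̃ + fromℚ ε × ν φ̃ ≼ ν φ + fromℚ ε)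
  close-by φ φ̃ ε p = close isμ (≼-trans (≼-resp (+-identityʳ _) ≃-refl (+-mono-≼ ≼-refl (N.nonNegative (φ △ φ̃)))) p)
                   , close isν (≼-trans (≼-resp (+-identityˡ _) ≃-refl (+-mono-≼ (M.nonNegative (φ △ φ̃)) ≼-refl)) p)
    where
    close : ∀ {s} {μ : Sentence q → ℝ} → IsMeasure s μ → μ (φ △ φ̃) ≼ fromℚ ε → μ φ ≼ μ φ̃ + fromℚ ε × μ φ̃ ≼ μ φ + fromℚ ε
    close isμ p = within φ φ̃ (λ M s k → k (inj₂ λ (f , _) → k (inj₁ (f s))))
                , within φ̃ φ (λ M s k → k (inj₂ λ (_ , f) → k (inj₁ (f s))))
      where
      open Measure isμ
      within : ∀ φ₁ φ₂ → φ₁ ⊨ φ₂ ∨ (φ △ φ̃) → _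
      within φ₁ φ₂ f = ≼-trans (monotone φ₁ (φ₂ ∨ (φ △ φ̃)) f) (≼-trans (subadditive φ₂ (φ △ φ̃)) (+-mono-≼ ≼-refl p))

  -- Up to half of `ε`, `μ φ` is `μ φ̃`; this equals `ν φ̃` because `φ̃` is decided by finitely many
  -- constants, and `ν φ̃` is `ν φ` up to the other half.
  determined-by-state-descriptions : (∀ {m} (h : Fin m → Atom q) → μ (stateDescription h) ≃ ν (stateDescription h)) → ∀ φ → μ φ ≃ ν φ
  determined-by-state-descriptions agree φ = ≼-antisym
    (≼-approx λ ε 0<ε → let _ , φ̃ , d , p = A.approximable φ (ε ℚ.* ½) (half-pos ε 0<ε)
                            (a , _) , (_ , b) = close-by φ φ̃ _ p
                        in chain ε a (agree-decided agree φ̃ d) b)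
    (≼-approx λ ε 0<ε → let _ , φ̃ , d , p = A.approximable φ (ε ℚ.* ½) (half-pos ε 0<ε)
                            (_ , b) , (a , _) = close-by φ φ̃ _ p
                        in chain ε a (≃-sym (agree-decided agree φ̃ d)) b)
    where
    chain : ∀ ε {x y x′ y′} → x ≼ x′ + fromℚ (ε ℚ.* ½) → x′ ≃ y′ → y′ ≼ y + fromℚ (ε ℚ.* ½) → x ≼ y + fromℚ ε
    chain ε {y = y} a eq b = ≼-trans a (≼-trans (+-mono-≼ (≼-trans (≼-reflexive eq) b) ≼-refl)
      (≼-reflexive (pointwise λ n → trans (ℚ.+-assoc (seq y n) _ _) (cong (seq y n ℚ.+_) (halves ε)))))

-- Finite sums


∑ : List A → (A → ℝ) → ℝ
∑ []       F = 0ℝ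
∑ (x ∷ xs) F = F x + ∑ xs F

∑-cong-∈ : (xs : List A) {F G : A → ℝ} → (∀ {x} → x ∈ xs → F x ≃ G x) → ∑ xs F ≃ ∑ xs G
∑-cong-∈ []       eq = ≃-refl
∑-cong-∈ (x ∷ xs) eq = +-cong (eq (here refl)) (∑-cong-∈ xs (eq ∘ there))

∑-cong : (xs : List A) {F G : A → ℝ} → (∀ x → F x ≃ G x) → ∑ xs F ≃ ∑ xs G
∑-cong xs eq = ∑-cong-∈ xs λ {x} _ → eq x

∑-0 : (xs : List A) → ∑ xs (λ _ → 0ℝ) ≃ 0ℝ
∑-0 []       = ≃-refl
∑-0 (x ∷ xs) = ≃-trans (+-identityˡ (∑ xs λ _ → 0ℝ)) (∑-0 xs)

∑-+ : (xs : List A) (F G : A → ℝ) → ∑ xs (λ x → F x + G x) ≃ ∑ xs F + ∑ xs G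
∑-+ []       F G = ≃-sym (+-identityˡ 0ℝ)
∑-+ (x ∷ xs) F G = ≃-trans (+-cong ≃-refl (∑-+ xs F G)) (+-interchange (F x) (G x) (∑ xs F) (∑ xs G))

∑-· : ∀ c (xs : List A) (F : A → ℝ) → ∑ xs (λ x → c · F x) ≃ c · ∑ xs F
∑-· c []       F = ≃-sym (·-zeroʳ c)
∑-· c (x ∷ xs) F = ≃-trans (+-cong ≃-refl (∑-· c xs F)) (≃-sym (·-distribˡ c (F x) (∑ xs F)))

∑-swap : (xs : List A) (ys : List B) (F : A → B → ℝ) → ∑ xs (λ x → ∑ ys (F x)) ≃ ∑ ys (λ y → ∑ xs (λ x → F x y))
∑-swap []       ys F = ≃-sym (∑-0 ys)
∑-swap (x ∷ xs) ys F = ≃-trans (+-cong ≃-refl (∑-swap xs ys F)) (≃-sym (∑-+ ys (F x) λ y → ∑ xs λ x → F x y))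

∑-++ : (xs ys : List A) (F : A → ℝ) → ∑ (xs ++ ys) F ≃ ∑ xs F + ∑ ys F
∑-++ []       ys F = ≃-sym (+-identityˡ (∑ ys F))
∑-++ (x ∷ xs) ys F = ≃-trans (+-cong ≃-refl (∑-++ xs ys F)) (≃-sym (+-assoc (F x) (∑ xs F) (∑ ys F)))

∑-map : (f : A → B) (xs : List A) (F : B → ℝ) → ∑ (List.map f xs) F ≃ ∑ xs (F ∘ f)
∑-map f []       F = ≃-refl
∑-map f (x ∷ xs) F = +-cong ≃-refl (∑-map f xs F)

∑-concatMap : (f : A → List B) (xs : List A) (F : B → ℝ) → ∑ (concatMap f xs) F ≃ ∑ xs (λ x → ∑ (f x) F)
∑-concatMap f []       F = ≃-refl
∑-concatMap f (x ∷ xs) F = ≃-trans (∑-++ (f x) (concatMap f xs) F) (+-cong ≃-refl (∑-concatMap f xs F))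

∑-↭ : {xs ys : List A} (F : A → ℝ) → xs ↭ ys → ∑ xs F ≃ ∑ ys F
∑-↭ F ↭.refl            = ≃-refl
∑-↭ F (↭.prep x p)      = +-cong ≃-refl (∑-↭ F p)
∑-↭ F (↭.swap {xs = xs} {ys} x y p) = ≃-trans (+-cong ≃-refl (+-cong ≃-refl (∑-↭ F p)))
  (pointwise λ n → solve 3 (λ a b c → a :+ (b :+ c) := b :+ (a :+ c)) refl (seq (F x) n) (seq (F y) n) (seq (∑ ys F) n))
∑-↭ F (↭.trans p p′)    = ≃-trans (∑-↭ F p) (∑-↭ F p′)

-- Atoms

atoms : ∀ r → List (Atom r)
atoms zero    = [] ∷ []
atoms (suc r) = List.map (true ∷_) (atoms r) ++ List.map (false ∷_) (atoms r)

∈-atoms : (α : Atom r) → α ∈ atoms r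
∈-atoms []          = here refl
∈-atoms (true ∷ α)  = ∈-++⁺ˡ (∈-map⁺ (true ∷_) (∈-atoms α))
∈-atoms (false ∷ α) = ∈-++⁺ʳ (List.map (true ∷_) (atoms _)) (∈-map⁺ (false ∷_) (∈-atoms α))

atoms-unique : ∀ r → Unique (atoms r)
atoms-unique zero    = [] ∷ []
atoms-unique (suc r) = Unique.++⁺ (Unique.map⁺ Vec.∷-injectiveʳ (atoms-unique r)) (Unique.map⁺ Vec.∷-injectiveʳ (atoms-unique r))
  λ (p , p′) → case (∈-map⁻ (true ∷_) p , ∈-map⁻ (false ∷_) p′) of λ { ((_ , _ , refl) , (_ , _ , ())) }

-- Besides the laws `bern t`, the weights may be `indicator i`, which makes this a plain sum over
-- the atoms with `i` negations.
𝔼₁ : (Atom r → ℚ) → (Atom r → ℝ) → ℝ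
𝔼₁ f F = ∑ (atoms _) λ α → f α · F α

-- The head is averaged innermost: a fresh factor inserted below an existing average `𝔼 fs` is then
-- definitionally `𝔼 (f ∷ fs)`.
𝔼 : Vec (Atom r → ℚ) n → (Vec (Atom r) n → ℝ) → ℝ
𝔼 []       F = F []
𝔼 (f ∷ fs) F = 𝔼 fs λ β → 𝔼₁ f λ α → F (α ∷ β)

𝔼₁-cong : ∀ (f : Atom r → ℚ) {F G} → (∀ α → F α ≃ G α) → 𝔼₁ f F ≃ 𝔼₁ f G
𝔼₁-cong f eq = ∑-cong (atoms _) λ α → ·-cong (f α) (eq α)

𝔼₁-+ : ∀ (f : Atom r → ℚ) F G → 𝔼₁ f (λ α → F α + G α) ≃ 𝔼₁ f F + 𝔼₁ f G
𝔼₁-+ f F G = ≃-trans (∑-cong (atoms _) λ α → ·-distribˡ (f α) (F α) (G α)) (∑-+ (atoms _) (λ α → f α · F α) (λ α → f α · G α))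

𝔼₁-· : ∀ (f : Atom r → ℚ) c F → 𝔼₁ f (λ α → c · F α) ≃ c · 𝔼₁ f F
𝔼₁-· f c F = ≃-trans (∑-cong (atoms _) λ α → ·-comm (f α) c (F α)) (∑-· c (atoms _) λ α → f α · F α)

𝔼-cong : ∀ (fs : Vec (Atom r → ℚ) n) {F G} → (∀ β → F β ≃ G β) → 𝔼 fs F ≃ 𝔼 fs G
𝔼-cong []       eq = eq []
𝔼-cong (f ∷ fs) eq = 𝔼-cong fs λ β → 𝔼₁-cong f λ α → eq (α ∷ β)

𝔼-+ : ∀ (fs : Vec (Atom r → ℚ) n) F G → 𝔼 fs (λ β → F β + G β) ≃ 𝔼 fs F + 𝔼 fs G
𝔼-+ []       F G = ≃-refl
𝔼-+ (f ∷ fs) F G = ≃-trans (𝔼-cong fs λ β → 𝔼₁-+ f (λ α → F (α ∷ β)) (λ α → G (α ∷ β))) (𝔼-+ fs (λ β → 𝔼₁ f λ α → F (α ∷ β)) (λ β → 𝔼₁ f λ α → G (α ∷ β)))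

𝔼-· : ∀ (fs : Vec (Atom r → ℚ) n) c F → 𝔼 fs (λ β → c · F β) ≃ c · 𝔼 fs F
𝔼-· []       c F = ≃-refl
𝔼-· (f ∷ fs) c F = ≃-trans (𝔼-cong fs λ β → 𝔼₁-· f c (λ α → F (α ∷ β))) (𝔼-· fs c λ β → 𝔼₁ f λ α → F (α ∷ β))

𝔼-0 : ∀ (fs : Vec (Atom r → ℚ) n) → 𝔼 fs (λ _ → 0ℝ) ≃ 0ℝ
𝔼-0 fs = ≃-trans (𝔼-cong fs λ _ → ≃-sym (·-zeroˡ 0ℝ)) (≃-trans (𝔼-· fs 0ℚ λ _ → 0ℝ) (·-zeroˡ (𝔼 fs λ _ → 0ℝ)))

𝔼-∑ : ∀ (fs : Vec (Atom r → ℚ) n) (xs : List A) (F : Vec (Atom r) n → A → ℝ) → 𝔼 fs (λ β → ∑ xs (F β)) ≃ ∑ xs (λ x → 𝔼 fs (λ β → F β x))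
𝔼-∑ fs []       F = 𝔼-0 fs
𝔼-∑ fs (x ∷ xs) F = ≃-trans (𝔼-+ fs (λ β → F β x) (λ β → ∑ xs (F β))) (+-cong ≃-refl (𝔼-∑ fs xs F))

-- bern t is the law of an atom whose predicates hold independently with probability t.
bern : ℚ → Atom r → ℚ
bern t []          = 1ℚ
bern t (true ∷ α)  = t ℚ.* bern t α
bern t (false ∷ α) = (1ℚ ℚ.- t) ℚ.* bern t α

𝔼₁-bern : ∀ t (F : Atom (suc r) → ℝ) →
  𝔼₁ (bern t) F ≃ t · 𝔼₁ (bern t) (F ∘ (true ∷_)) + (1ℚ ℚ.- t) · 𝔼₁ (bern t) (F ∘ (false ∷_))
𝔼₁-bern {r} t F = ≃-trans (∑-++ (List.map (true ∷_) (atoms r)) (List.map (false ∷_) (atoms r)) λ α → bern t α · F α) (+-cong (half true refl) (half false refl))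
  where
  half : ∀ b {c} → (∀ {α : Atom r} → bern t (b ∷ α) ≡ c ℚ.* bern t α) →
    ∑ (List.map (b ∷_) (atoms r)) (λ α → bern t α · F α) ≃ c · 𝔼₁ (bern t) (F ∘ (b ∷_))
  half b {c} eq = ≃-trans (∑-map (b ∷_) (atoms r) λ α → bern t α · F α)
    (≃-trans (∑-cong (atoms r) λ α → ≃-trans (·-coeff (F (b ∷ α)) eq) (≃-sym (·-assoc c (bern t α) (F (b ∷ α))))) (∑-· c (atoms r) λ α → bern t α · F (b ∷ α)))

convex-self : ∀ t x → t · x + (1ℚ ℚ.- t) · x ≃ x
convex-self t x = pointwise λ n → solve 2 (λ t x → t :* x :+ (con 1ℚ :- t) :* x := x) refl t (seq x n)

𝔼₁-bern-const : ∀ r t x → 𝔼₁ {r} (bern t) (λ _ → x) ≃ x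
𝔼₁-bern-const zero    t x = ≃-trans (+-identityʳ (1ℚ · x)) (·-identity x)
𝔼₁-bern-const (suc r) t x = ≃-trans (𝔼₁-bern {r} t λ _ → x)
  (≃-trans (+-cong (·-cong t (𝔼₁-bern-const r t x)) (·-cong (1ℚ ℚ.- t) (𝔼₁-bern-const r t x))) (convex-self t x))

-- The predicates are independent and identically distributed, so conditioning on predicate `j`
-- looks like conditioning on the first one; the induction only interchanges two such conditionings.
𝔼₁-bern-insertAt : ∀ t j (F : Atom (suc r) → ℝ) →
  𝔼₁ (bern t) F ≃ t · 𝔼₁ (bern t) (λ α → F (insertAt α j true)) + (1ℚ ℚ.- t) · 𝔼₁ (bern t) (λ α → F (insertAt α j false))
𝔼₁-bern-insertAt {r}     t zero    F = 𝔼₁-bern t F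
𝔼₁-bern-insertAt {suc r} t (suc j) F = ≃-trans (𝔼₁-bern t F) (≃-trans
  (+-cong (·-cong t (𝔼₁-bern-insertAt t j (F ∘ (true ∷_)))) (·-cong t′ (𝔼₁-bern-insertAt t j (F ∘ (false ∷_)))))
  (≃-trans (exchange (E true true) (E true false) (E false true) (E false false))
    (≃-sym (+-cong (·-cong t (𝔼₁-bern t λ α → F (insertAt α (suc j) true))) (·-cong t′ (𝔼₁-bern t λ α → F (insertAt α (suc j) false)))))))
  where
  t′ : ℚ
  t′ = 1ℚ ℚ.- t
  E : Bool → Bool → ℝ
  E b b′ = 𝔼₁ (bern t) λ α → F (b ∷ insertAt α j b′)
  exchange : ∀ a b c d → t · (t · a + t′ · b) + t′ · (t · c + t′ · d) ≃ t · (t · a + t′ · c) + t′ · (t · b + t′ · d)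
  exchange a b c d = pointwise λ n → solve 6 (λ t t′ a b c d →
    t :* (t :* a :+ t′ :* b) :+ t′ :* (t :* c :+ t′ :* d) := t :* (t :* a :+ t′ :* c) :+ t′ :* (t :* b :+ t′ :* d))
    refl t t′ (seq a n) (seq b n) (seq c n) (seq d n)

restrictAtom-insertAt : ∀ {f : Fin (suc r) → Fin (suc r′)} (inj : Injective _≡_ _≡_ f) α b →
  restrictAtom f (insertAt α (f zero) b) ≡ b ∷ restrictAtom (λ i → punchOut {i = f zero} {f (suc i)} (λ eq → Fin.0≢1+n (inj eq))) α
restrictAtom-insertAt {f = f} inj α b = cong₂ _∷_ (Vec.insertAt-lookup α (f zero) b) (Vec.tabulate-cong λ i →
  trans (cong (lookup (insertAt α (f zero) b)) (sym (Fin.punchIn-punchOut _))) (Vec.insertAt-punchIn α (f zero) b _))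

-- Marginals of a product law. Conditioning on predicate `f zero` of the larger language and on the
-- first one of the smaller leaves an injection of the remaining predicates, given by `punchOut`;
-- predicates outside the image average out at the end. That `t` does not change is what lets one
-- parameter serve all languages.
𝔼₁-bern-restrict : ∀ t {f : Fin r → Fin r′} → Injective _≡_ _≡_ f → ∀ F → 𝔼₁ (bern t) (F ∘ restrictAtom f) ≃ 𝔼₁ (bern t) F
𝔼₁-bern-restrict {zero}  {r′} t inj F = ≃-trans (𝔼₁-bern-const r′ t (F [])) (≃-sym (𝔼₁-bern-const zero t (F [])))
𝔼₁-bern-restrict {suc r} {zero} t {f} inj F = contradiction (f zero) λ ()
𝔼₁-bern-restrict {suc r} {suc r′} t {f} inj F = ≃-trans (𝔼₁-bern-insertAt t (f zero) (F ∘ restrictAtom f))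
  (≃-trans (+-cong (·-cong t (half true)) (·-cong (1ℚ ℚ.- t) (half false))) (≃-sym (𝔼₁-bern t F)))
  where
  half : ∀ b → 𝔼₁ (bern t) (λ α → F (restrictAtom f (insertAt α (f zero) b))) ≃ 𝔼₁ (bern t) (F ∘ (b ∷_))
  half b = ≃-trans (𝔼₁-cong (bern t) λ α → ≃-reflexive (cong F (restrictAtom-insertAt inj α b)))
    (𝔼₁-bern-restrict t (λ {i} {j} eq → Fin.suc-injective (inj (Fin.punchOut-injective {i = f zero} {f (suc i)} {f (suc j)} _ _ eq))) (F ∘ (b ∷_)))

𝔼-bern-const : ∀ r (ts : Vec ℚ n) x → 𝔼 {r} (Vec.map bern ts) (λ _ → x) ≃ x
𝔼-bern-const r []       x = ≃-refl
𝔼-bern-const r (t ∷ ts) x = ≃-trans (𝔼-cong (Vec.map bern ts) λ _ → 𝔼₁-bern-const r t x) (𝔼-bern-const r ts x)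

𝔼-bern-restrict : ∀ (ts : Vec ℚ n) {f : Fin r → Fin r′} → Injective _≡_ _≡_ f → ∀ F →
  𝔼 (Vec.map bern ts) (F ∘ Vec.map (restrictAtom f)) ≃ 𝔼 (Vec.map bern ts) F
𝔼-bern-restrict []       inj F = ≃-refl
𝔼-bern-restrict (t ∷ ts) inj F = ≃-trans
  (𝔼-cong (Vec.map bern ts) λ β → 𝔼₁-bern-restrict t inj λ α → F (α ∷ Vec.map (restrictAtom _) β)) (𝔼-bern-restrict ts inj λ β → 𝔼₁ (bern t) λ α → F (α ∷ β))

-- Polynomial interpolation

pow : ℚ → ℕ → ℚ
pow t zero    = 1ℚ
pow t (suc n) = t ℚ.* pow t n

positives : Atom r → ℕ
positives []          = 0
positives (true ∷ α)  = suc (positives α)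
positives (false ∷ α) = positives α

positives+γ : (α : Atom r) → positives α ℕ.+ γ α ≡ r
positives+γ []          = refl
positives+γ (true ∷ α)  = cong suc (positives+γ α)
positives+γ (false ∷ α) = trans (ℕ.+-suc (positives α) (γ α)) (cong suc (positives+γ α))

bern≡ : ∀ t (α : Atom r) → bern t α ≡ pow t (positives α) ℚ.* pow (1ℚ ℚ.- t) (γ α)
bern≡ t []          = refl
bern≡ t (true ∷ α)  = trans (cong (t ℚ.*_) (bern≡ t α)) (sym (ℚ.*-assoc t _ _))
bern≡ t (false ∷ α) = trans (cong ((1ℚ ℚ.- t) ℚ.*_) (bern≡ t α))
  (solve 3 (λ a b c → a :* (b :* c) := b :* (a :* c)) refl (1ℚ ℚ.- t) (pow t (positives α)) (pow (1ℚ ℚ.- t) (γ α)))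

bern-γ : ∀ t (α β : Atom r) → γ α ≡ γ β → bern t α ≡ bern t β
bern-γ t α β eq = trans (bern≡ t α) (trans (cong₂ (λ p k → pow t p ℚ.* pow (1ℚ ℚ.- t) k)
  (ℕ.+-cancelʳ-≡ (γ β) _ _ (trans (cong (positives α ℕ.+_) (sym eq)) (trans (positives+γ α) (sym (positives+γ β))))) eq) (sym (bern≡ t β)))

-- The list is a signed measure with weight `a` at the point `t`; this is its integral of
-- `t^p (1 - t)^k`.
combination : List (ℚ × ℚ) → ℕ → ℕ → ℚ
combination []            p k = 0ℚ
combination ((a , t) ∷ L) p k = a ℚ.* (pow t p ℚ.* pow (1ℚ ℚ.- t) k) ℚ.+ combination L p k

reciprocal : ∀ x → x ≢ 0ℚ → ∃ λ y → x ℚ.* y ≡ 1ℚ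
reciprocal x x≢0 = ℚ.1/_ x {{ℚ.≢-nonZero x≢0}} , ℚ.*-inverseʳ x {{ℚ.≢-nonZero x≢0}}

pow-pos : ∀ t n → 0ℚ ℚ.< t → 0ℚ ℚ.< pow t n
pow-pos t zero    0<t = ℚ.positive⁻¹ 1ℚ
pow-pos t (suc n) 0<t = ℚ.positive⁻¹ _ {{ℚ.pos*pos⇒pos t {{ℚ.positive 0<t}} (pow t n) {{ℚ.positive (pow-pos t n 0<t)}}}}

-- The lower bound keeps the nodes strictly above the next one to be added, so that their
-- differences from it are invertible; the upper bound is for their use as probabilities.
Nodes≥ : ℚ → List (ℚ × ℚ) → Set
Nodes≥ b = All λ (_ , t) → b ℚ.≤ t × t ℚ.≤ 1ℚ

module _ (y : ℚ) where
  -- Multiplying the weights by y - t corresponds to the operation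
  -- v ↦ y v(p, k + 1) - (1 - y) v(p + 1, k) on moments.
  divide : ∀ {b} → y ℚ.< b → ∀ L → Nodes≥ b L → ∃ λ L′ → Nodes≥ b L′ ×
    (∀ p k → y ℚ.* combination L′ p (suc k) ℚ.- (1ℚ ℚ.- y) ℚ.* combination L′ (suc p) k ≡ combination L p k)
  divide y<b [] [] = [] , [] , λ p k → solve 1 (λ y → y :* con 0ℚ :- (con 1ℚ :- y) :* con 0ℚ := con 0ℚ) refl y
  divide y<b ((a , t) ∷ L) ((b≤t , t≤1) ∷ bounds) =
    let L′ , bounds′ , eq = divide y<b L bounds
        z , inverse = reciprocal (y ℚ.- t) λ y-t≡0 → ℚ.<⇒≢ (ℚ.<-≤-trans y<b b≤t) (ℚ-minus-zero y-t≡0)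
    in (a ℚ.* z , t) ∷ L′ , (b≤t , t≤1) ∷ bounds′ , λ p k → let open ≡-Reasoning in begin
      y ℚ.* combination ((a ℚ.* z , t) ∷ L′) p (suc k) ℚ.- (1ℚ ℚ.- y) ℚ.* combination ((a ℚ.* z , t) ∷ L′) (suc p) k
        ≡⟨ solve 8 (λ y t a z u v c d →
             y :* (a :* z :* (u :* ((con 1ℚ :- t) :* v)) :+ c) :- (con 1ℚ :- y) :* (a :* z :* (t :* u :* v) :+ d)
             := a :* ((y :- t) :* z) :* (u :* v) :+ (y :* c :- (con 1ℚ :- y) :* d))
             refl y t a z (pow t p) (pow (1ℚ ℚ.- t) k) (combination L′ p (suc k)) (combination L′ (suc p) k) ⟩
      a ℚ.* ((y ℚ.- t) ℚ.* z) ℚ.* (pow t p ℚ.* pow (1ℚ ℚ.- t) k) ℚ.+ (y ℚ.* combination L′ p (suc k) ℚ.- (1ℚ ℚ.- y) ℚ.* combination L′ (suc p) k)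
        ≡⟨ cong₂ (λ u v → a ℚ.* u ℚ.* (pow t p ℚ.* pow (1ℚ ℚ.- t) k) ℚ.+ v) inverse (eq p k) ⟩
      a ℚ.* 1ℚ ℚ.* (pow t p ℚ.* pow (1ℚ ℚ.- t) k) ℚ.+ combination L p k
        ≡⟨ cong (λ u → u ℚ.* (pow t p ℚ.* pow (1ℚ ℚ.- t) k) ℚ.+ combination L p k) (ℚ.*-identityʳ a) ⟩
      combination ((a , t) ∷ L) p k ∎
    where
    ℚ-minus-zero : ∀ {p q} → p ℚ.- q ≡ 0ℚ → p ≡ q
    ℚ-minus-zero {p} {q} eq = trans (solve 2 (λ p q → p := (p :- q) :+ q) refl p q) (trans (cong (ℚ._+ q) eq) (ℚ.+-identityˡ q))

*-cancelˡ-pos : ∀ {p q r} → 0ℚ ℚ.< r → r ℚ.* p ≡ r ℚ.* q → p ≡ q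
*-cancelˡ-pos {r = r} 0<r eq = ℚ.≤-antisym (ℚ.*-cancelˡ-≤-pos r {{ℚ.positive 0<r}} (ℚ.≤-reflexive eq))
                                           (ℚ.*-cancelˡ-≤-pos r {{ℚ.positive 0<r}} (ℚ.≤-reflexive (sym eq)))

-- The nodes `1, 1/2, 1/4, …` are distinct, lie between 0 and 1, and are positive, as `interpolate`
-- has to divide by them and by their powers.
node : ℕ → ℚ
node = pow ½

0<node : ∀ n → 0ℚ ℚ.< node n
0<node n = pow-pos ½ n (ℚ.positive⁻¹ ½)

node-decreasing : ∀ n → node (suc n) ℚ.< node n
node-decreasing n = ℚ.<-≤-trans (ℚ.*-monoˡ-<-pos (node n) {{ℚ.positive (0<node n)}} {½} {1ℚ} (toWitness {a? = ½ ℚ.<? 1ℚ} _)) (ℚ.≤-reflexive (ℚ.*-identityˡ (node n)))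

node≤1 : ∀ n → node n ℚ.≤ 1ℚ
node≤1 zero    = ℚ.≤-refl
node≤1 (suc n) = ℚ.≤-trans (ℚ.<⇒≤ (node-decreasing n)) (node≤1 n)

-- Newton-style induction on the degree, adding one node `y₀`. The operation of `divide` annihilates
-- the contribution of `y₀`, so the induction hypothesis, applied to the image of `v` under that
-- operation and followed by division, weights the older nodes. The weight of `y₀` then sets the
-- value at `k = 0`, and the resulting recurrence in `k` gives the others.
interpolate : ∀ n (v : ℕ → ℚ) → ∃ λ ns → Nodes≥ (node n) ns × (∀ p k → p ℕ.+ k ≡ n → combination ns p k ≡ v k)
interpolate zero v = (v 0 , 1ℚ) ∷ [] , (ℚ.≤-refl , ℚ.≤-refl) ∷ [] ,
  λ { zero zero refl → solve 1 (λ v → v :* con 1ℚ :+ con 0ℚ := v) refl (v 0) }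
interpolate (suc n) v =
  let ns , bounds , moments = interpolate n λ k → y₀ ℚ.* v (suc k) ℚ.- (1ℚ ℚ.- y₀) ℚ.* v k
      ns′ , bounds′ , divided = divide y₀ (node-decreasing n) ns bounds
  in (weight ns′ , y₀) ∷ ns′
   , (ℚ.≤-refl , node≤1 (suc n)) ∷ All.map (λ (b≤t , t≤1) → ℚ.≤-trans (ℚ.<⇒≤ (node-decreasing n)) b≤t , t≤1) bounds′
   , λ p k → moments′ ns′ (λ p k eq → trans (divided p k) (moments p k eq)) k p
  where
  y₀ : ℚ
  y₀ = node (suc n)
  z₀ : ℚ
  z₀ = proj₁ (reciprocal (pow y₀ (suc n)) (ℚ.<⇒≢ (pow-pos y₀ (suc n) (0<node (suc n))) ∘ sym))
  -- Corrects the value at `k = 0`, to which `y₀` contributes its weight times `pow y₀ (suc n)`;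
  -- `z₀` is the inverse of that power.
  weight : List (ℚ × ℚ) → ℚ
  weight ns = (v 0 ℚ.- combination ns (suc n) 0) ℚ.* z₀
  module _ (ns : List (ℚ × ℚ))
    (shift : ∀ p k → p ℕ.+ k ≡ n → y₀ ℚ.* combination ns p (suc k) ℚ.- (1ℚ ℚ.- y₀) ℚ.* combination ns (suc p) k ≡ y₀ ℚ.* v (suc k) ℚ.- (1ℚ ℚ.- y₀) ℚ.* v k)
    where
    a₀ : ℚ
    a₀ = weight ns
    open ≡-Reasoning
    moments′ : ∀ k p → p ℕ.+ k ≡ suc n → combination ((a₀ , y₀) ∷ ns) p k ≡ v k
    moments′ zero p eq with refl ← trans (sym (ℕ.+-identityʳ p)) eq = begin
      a₀ ℚ.* (pow y₀ (suc n) ℚ.* 1ℚ) ℚ.+ combination ns (suc n) 0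
        ≡⟨ solve 4 (λ v c z₀ u → (v :- c) :* z₀ :* (u :* con 1ℚ) :+ c := (v :- c) :* (u :* z₀) :+ c) refl (v 0) (combination ns (suc n) 0) z₀ (pow y₀ (suc n)) ⟩
      (v 0 ℚ.- combination ns (suc n) 0) ℚ.* (pow y₀ (suc n) ℚ.* z₀) ℚ.+ combination ns (suc n) 0
        ≡⟨ cong (λ u → (v 0 ℚ.- combination ns (suc n) 0) ℚ.* u ℚ.+ combination ns (suc n) 0)
             (proj₂ (reciprocal (pow y₀ (suc n)) (ℚ.<⇒≢ (pow-pos y₀ (suc n) (0<node (suc n))) ∘ sym))) ⟩
      (v 0 ℚ.- combination ns (suc n) 0) ℚ.* 1ℚ ℚ.+ combination ns (suc n) 0
        ≡⟨ solve 2 (λ v c → (v :- c) :* con 1ℚ :+ c := v) refl (v 0) (combination ns (suc n) 0) ⟩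
      v 0 ∎
    -- The recurrence determines `y₀` times the value at `k + 1` from the value at `k`; the positive
    -- factor `y₀` is then cancelled.
    moments′ (suc k) p eq = *-cancelˡ-pos (0<node (suc n)) (begin
      y₀ ℚ.* combination ((a₀ , y₀) ∷ ns) p (suc k)
        ≡⟨ solve 6 (λ y₀ a₀ u w c d →
             y₀ :* (a₀ :* (u :* ((con 1ℚ :- y₀) :* w)) :+ c)
             := (y₀ :* c :- (con 1ℚ :- y₀) :* d) :+ (con 1ℚ :- y₀) :* (a₀ :* (y₀ :* u :* w) :+ d))
             refl y₀ a₀ (pow y₀ p) (pow (1ℚ ℚ.- y₀) k) (combination ns p (suc k)) (combination ns (suc p) k) ⟩
      (y₀ ℚ.* combination ns p (suc k) ℚ.- (1ℚ ℚ.- y₀) ℚ.* combination ns (suc p) k) ℚ.+ (1ℚ ℚ.- y₀) ℚ.* combination ((a₀ , y₀) ∷ ns) (suc p) k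
        ≡⟨ cong₂ (λ c d → c ℚ.+ (1ℚ ℚ.- y₀) ℚ.* d) (shift p k (ℕ.suc-injective (trans (sym (ℕ.+-suc p k)) eq)))
             (moments′ k (suc p) (trans (sym (ℕ.+-suc p k)) eq)) ⟩
      (y₀ ℚ.* v (suc k) ℚ.- (1ℚ ℚ.- y₀) ℚ.* v k) ℚ.+ (1ℚ ℚ.- y₀) ℚ.* v k
        ≡⟨ solve 3 (λ y₀ c d → (y₀ :* c :- (con 1ℚ :- y₀) :* d) :+ (con 1ℚ :- y₀) :* d := y₀ :* c) refl y₀ (v (suc k)) (v k) ⟩
      y₀ ℚ.* v (suc k) ∎)

indicator : ℕ → Atom r → ℚ
indicator i α = if does (γ α ℕ.≟ i) then 1ℚ else 0ℚ

abstract
  -- On atoms of `L_q` the positive and the negated predicates add up to `q` in number, and the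
  -- moments of degree `q` can be prescribed at will. A signed mixture of laws `bern t` can
  -- therefore single out one number of negations.
  indicator-combination : ∀ q i → ∃ λ ns → Nodes≥ 0ℚ ns ×
    (∀ (α : Atom q) → indicator i α ≡ combination ns (positives α) (γ α))
  indicator-combination q i =
    let ns , bounds , moments = interpolate q λ k → if does (k ℕ.≟ i) then 1ℚ else 0ℚ
    in ns , All.map (λ (b≤t , t≤1) → ℚ.≤-trans (ℚ.<⇒≤ (0<node q)) b≤t , t≤1) bounds
     , λ α → sym (moments (positives α) (γ α) (positives+γ α))

∑-combination : List (ℚ × ℚ) → (ℚ → ℝ) → ℝ
∑-combination ns F = ∑ ns λ (a , t) → a · F t

𝔼₁-combination : ∀ ns {f : Atom r → ℚ} → (∀ α → f α ≡ combination ns (positives α) (γ α)) → ∀ F →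
  𝔼₁ f F ≃ ∑-combination ns λ t → 𝔼₁ (bern t) F
𝔼₁-combination ns {f} eq F = ≃-trans (∑-cong (atoms _) λ α → ≃-trans (·-coeff (F α) (eq α)) (expand ns α))
  (≃-trans (∑-swap (atoms _) ns λ α (a , t) → a · bern t α · F α) (∑-cong ns λ (a , t) → ∑-· a (atoms _) λ α → bern t α · F α))
  where
  expand : ∀ ns α → combination ns (positives α) (γ α) · F α ≃ ∑ ns λ (a , t) → a · bern t α · F α
  expand []             α = ·-zeroˡ (F α)
  expand ((a , t) ∷ ns) α = ≃-trans (·-distribʳ (a ℚ.* (pow t (positives α) ℚ.* pow (1ℚ ℚ.- t) (γ α))) (combination ns (positives α) (γ α)) (F α)) (+-cong
    (≃-trans (·-coeff (F α) (cong (a ℚ.*_) (sym (bern≡ t α)))) (≃-sym (·-assoc a (bern t α) (F α)))) (expand ns α))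

-- Lists up to permutation


unique-↭ : {xs ys : List A} → Unique xs → Unique ys →
  (∀ {z} → z ∈ xs → z ∈ ys) → (∀ {z} → z ∈ ys → z ∈ xs) → xs ↭ ys
unique-↭ xs! ys! f g = ∼bag⇒↭ (unique∧set⇒bag xs! ys! (mk⇔ f g))

Unique-map-injective : ∀ {f : A → B} {xs x y} → Unique (List.map f xs) → x ∈ xs → y ∈ xs → f x ≡ f y → x ≡ y
Unique-map-injective (_ ∷ _)    (here refl) (here refl) eq = refl
Unique-map-injective {f = f} (x∉ ∷ _)   (here refl) (there q)   eq = contradiction eq (All.lookup x∉ (∈-map⁺ f q))
Unique-map-injective {f = f} (x∉ ∷ _)   (there p)   (here refl) eq = contradiction (sym eq) (All.lookup x∉ (∈-map⁺ f p))
Unique-map-injective (_ ∷ xs!)  (there p)   (there q)   eq = Unique-map-injective xs! p q eq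

filter-partition : ∀ {P : A → Set} (P? : ∀ x → Dec (P x)) xs → xs ↭ filter P? xs ++ filter (λ x → ¬? (P? x)) xs
filter-partition P? []       = ↭.refl
filter-partition P? (x ∷ xs) with does (P? x)
... | true  = ↭.prep x (filter-partition P? xs)
... | false = ↭-trans (↭.prep x (filter-partition P? xs)) (↭-sym (↭.shift x (filter P? xs) _))

filter-map : ∀ {P : B → Set} (P? : ∀ y → Dec (P y)) (f : A → B) xs → filter P? (List.map f xs) ≡ List.map f (filter (λ x → P? (f x)) xs)
filter-map P? f []       = refl
filter-map P? f (x ∷ xs) with does (P? (f x))
... | true  = cong (f x ∷_) (filter-map P? f xs)
... | false = filter-map P? f xs

filter-filter : ∀ {P Q : A → Set} (P? : ∀ x → Dec (P x)) (Q? : ∀ x → Dec (Q x)) → (∀ x → P x → Q x) →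
  ∀ xs → filter P? (filter Q? xs) ≡ filter P? xs
filter-filter P? Q? P⇒Q []       = refl
filter-filter P? Q? P⇒Q (x ∷ xs) with Q? x
... | no ¬q = trans (filter-filter P? Q? P⇒Q xs) (sym (List.filter-reject P? (¬q ∘ P⇒Q x)))
... | yes _ with does (P? x)
...   | true  = cong (x ∷_) (filter-filter P? Q? P⇒Q xs)
...   | false = filter-filter P? Q? P⇒Q xs

All-≡⇒replicate : ∀ {x : A} {xs} → All (_≡ x) xs → xs ≡ replicate (length xs) x
All-≡⇒replicate []           = refl
All-≡⇒replicate (refl ∷ eqs) = cong (_ ∷_) (All-≡⇒replicate eqs)

↭-by-key : (key : A → K) (_≟_ : (i j : K) → Dec (i ≡ j)) (xs ys : List A) →
  (∀ i → filter (λ x → key x ≟ i) xs ↭ filter (λ x → key x ≟ i) ys) → xs ↭ ys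
↭-by-key key _≟_ []       []       eq = ↭.refl
↭-by-key key _≟_ []       (y ∷ ys) eq = contradiction
  (↭-trans (↭-reflexive (sym (List.filter-accept (λ x → key x ≟ key y) refl))) (↭-sym (eq (key y)))) ↭.¬x∷xs↭[]
↭-by-key key _≟_ (x ∷ xs) ys eq with ∈-∃++ (proj₁ (∈-filter⁻ (λ z → key z ≟ key x) {xs = ys}
  (↭.∈-resp-↭ (eq (key x)) (∈-filter⁺ (λ z → key z ≟ key x) (here refl) refl))))
... | us , vs , refl = ↭-trans (↭.prep x (↭-by-key key _≟_ xs (us ++ vs) rest)) (↭-sym (↭.shift x us vs))
  where
  moved : ∀ i → filter (λ z → key z ≟ i) (x ∷ xs) ↭ filter (λ z → key z ≟ i) (x ∷ us ++ vs)
  moved i = ↭-trans (eq i) (↭.filter-↭ (λ z → key z ≟ i) (↭.shift x us vs))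
  rest : ∀ i → filter (λ z → key z ≟ i) xs ↭ filter (λ z → key z ≟ i) (us ++ vs)
  rest i with key x ≟ i | moved i
  ... | yes _ | p = ↭.drop-∷ p
  ... | no  _ | p = p

module _ (_≟_ : (x y : A) → Dec (x ≡ y)) where
  matching : (f f′ : A → B) (xs zs : List A) → Unique xs → List.map f′ xs ≡ List.map f zs →
    ∃ λ g → List.map g xs ≡ zs × (∀ {x} → x ∈ xs → f′ x ≡ f (g x))
  matching f f′ []       []       _          eq = id , refl , λ ()
  matching f f′ (x ∷ xs) (z ∷ zs) (x∉ ∷ xs!) eq with matching f f′ xs zs xs! (List.∷-injectiveʳ eq)
  ... | g , map≡ , g-eq = g′ , cong₂ _∷_ g′-here (trans (List.map-cong-local (All.map g′-there x∉)) map≡)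
      , λ { (here refl) → trans (List.∷-injectiveˡ eq) (cong f (sym g′-here))
          ; (there p) → trans (g-eq p) (cong f (sym (g′-there (All.lookup x∉ p)))) }
    where
    g′ : A → A
    g′ y with x ≟ y
    ... | yes _ = z
    ... | no  _ = g y
    g′-here : g′ x ≡ z
    g′-here with x ≟ x
    ... | yes _  = refl
    ... | no x≢x = contradiction refl x≢x
    g′-there : ∀ {y} → x ≢ y → g′ y ≡ g y
    g′-there {y} x≢y with x ≟ y
    ... | yes x≡y = contradiction x≡y x≢y
    ... | no _    = refl

  -- A permutation between the lists of values lifts to a rearrangement `zs` of `xs`; `g` sends each
  -- entry of `xs` to the entry of `zs` at the same place.
  reindex : ∀ {xs} → Unique xs → (∀ x → x ∈ xs) → (f f′ : A → B) → List.map f xs ↭ List.map f′ xs →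
    ∃ λ g → (∀ x → f′ x ≡ f (g x)) × List.map g xs ↭ xs
  reindex {xs = xs} xs! complete f f′ p with ↭.↭-map-inv f p
  ... | zs , eq , xs↭zs with matching f f′ xs zs xs! eq
  ...   | g , map≡ , g-eq = g , (λ x → g-eq (complete x)) , ↭-trans (↭-reflexive map≡) (↭-sym xs↭zs)

Unique-resp-↭ : {xs ys : List A} → xs ↭ ys → Unique xs → Unique ys
Unique-resp-↭ p = ↭Setoid.Unique-resp-↭ (≡.setoid _) (↭.↭⇒↭ₛ p)

record IsPermutation (xs : List A) (g : A → A) : Set where
  field
    injective : ∀ {x y} → g x ≡ g y → x ≡ y
    inverse   : A → A
    inverseʳ  : ∀ x → g (inverse x) ≡ x
    map-↭     : List.map g xs ↭ xs

isPermutation : ∀ {xs : List A} → Unique xs → (∀ x → x ∈ xs) → (g : A → A) → List.map g xs ↭ xs → IsPermutation xs g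
isPermutation {xs = xs} xs! complete g p = record
  { injective = λ eq → Unique-map-injective (Unique-resp-↭ (↭-sym p) xs!) (complete _) (complete _) eq
  ; inverse   = λ x → proj₁ (preimage x)
  ; inverseʳ  = λ x → sym (proj₂ (proj₂ (preimage x)))
  ; map-↭     = p
  }
  where
  preimage : ∀ x → ∃ λ y → y ∈ xs × x ≡ g y
  preimage x = ∈-map⁻ g (↭.∈-resp-↭ (↭-sym p) (complete x))

-- P-spectra

count : (Fin m → Atom q) → Atom q → ℕ
count h α = length (filter (λ l → α ≟ᴬ h l) (allFin _))

module _ (h : Fin m → Atom q) where
  count-positive : ∀ k → count h (h k) ≢ 0
  count-positive k eq = ℕ.<⇒≢ (List.filter-some (λ l → h k ≟ᴬ h l) (Any.map (cong h) (∈-allFin k))) (sym eq)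

  count-witness : ∀ α → count h α ≢ 0 → ∃ λ k → α ≡ h k
  count-witness α ≢0 with filter (λ l → α ≟ᴬ h l) (allFin m) in eq
  ... | []     = contradiction refl ≢0
  ... | k ∷ ks = k , proj₂ (∈-filter⁻ (λ l → α ≟ᴬ h l) {xs = allFin m} (≡.subst (k ∈_) (sym eq) (here refl)))

level : ∀ q → ℕ → List (Atom q)
level q i = filter (λ α → γ α ℕ.≟ i) (atoms q)

module _ (h : Fin m → Atom q) (i : ℕ) where
  members representatives : List (Fin m)
  members         = filter (λ k → γ (h k) ℕ.≟ i) (allFin m)
  representatives = deduplicate (λ k l → h k ≟ᴬ h l) members

  occurring : List (Atom q)
  occurring = List.map h representatives

  private
    R? : (k l : Fin m) → Dec (h k ≡ h l)
    R? k l = h k ≟ᴬ h l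

  occurring-unique : Unique occurring
  occurring-unique = AllPairs.map⁺ (distinct members)
    where
    distinct : ∀ ks → AllPairs (λ k l → h k ≢ h l) (deduplicate R? ks)
    distinct []       = []
    distinct (k ∷ ks) = All.all-filter (λ l → ¬? (R? k l)) (deduplicate R? ks) ∷ AllPairs.filter⁺ _ (distinct ks)

  representative-γ : ∀ {k} → k ∈ representatives → γ (h k) ≡ i
  representative-γ p = proj₂ (∈-filter⁻ (λ k → γ (h k) ℕ.≟ i) {xs = allFin m} (Any.deduplicate⁻ R? p))

  occurring⁺ : ∀ k → γ (h k) ≡ i → h k ∈ occurring
  occurring⁺ k eq = Any.map⁺ (Any.deduplicate⁺ R? (λ e e′ → trans e′ (sym e))
    (Any.map (cong h) (∈-filter⁺ (λ k → γ (h k) ℕ.≟ i) (∈-allFin k) eq)))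

  -- Constants with the same atom have equally many negations in it, so the class of a constant
  -- within its level is its class among all constants.
  sizes-count : List.map (λ k → length (filter (λ l → h k ≟ᴬ h l) members)) representatives ≡ List.map (count h) occurring
  sizes-count = trans
    (List.map-cong-local (All.tabulate λ {k} p → cong length
      (filter-filter (λ l → h k ≟ᴬ h l) (λ l → γ (h l) ℕ.≟ i) (λ l eq → trans (cong γ (sym eq)) (representative-γ p)) (allFin m))))
    (List.map-∘ representatives)

  -- The spectrum records only the atoms that occur. One zero for every absent atom completes it to
  -- the counts over the whole level.
  counts-↭ : ∃ λ z → List.map (count h) (level q i) ↭ List.map (count h) occurring ++ replicate z 0
  counts-↭ = length absent , ↭-trans (↭.map⁺ (count h) (filter-partition present? (level q i)))
    (↭-trans (↭-reflexive (List.map-++ (count h) (filter present? (level q i)) absent′))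
      (↭.++⁺ (↭.map⁺ (count h) present-↭) (↭-reflexive (All-≡⇒replicate (All.map⁺ (All.map decidable (All.all-filter _ (level q i))))))))
    where
    present? : ∀ α → Dec (count h α ≢ 0)
    present? α = ¬? (count h α ℕ.≟ 0)
    absent′ : List (Atom q)
    absent′ = filter (λ α → ¬? (present? α)) (level q i)
    absent : List ℕ
    absent = List.map (count h) absent′
    decidable : ∀ {n} → ¬ (n ≢ 0) → n ≡ 0
    decidable = decidable-stable (_ ℕ.≟ 0)
    present-↭ : filter present? (level q i) ↭ occurring
    present-↭ = unique-↭ (Unique.filter⁺ _ (Unique.filter⁺ _ (atoms-unique q))) occurring-unique to from
      where
      to : ∀ {α} → α ∈ filter present? (level q i) → α ∈ occurring
      to {α} p with ∈-filter⁻ present? {xs = (level q i)} p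
      ... | p′ , ≢0 with count-witness h α ≢0 | ∈-filter⁻ (λ α → γ α ℕ.≟ i) {xs = atoms q} p′
      ...   | k , refl | _ , γ≡ = occurring⁺ k γ≡
      from : ∀ {α} → α ∈ occurring → α ∈ filter present? (level q i)
      from p with ∈-map⁻ h p
      ... | k , k∈ , refl = ∈-filter⁺ present? (∈-filter⁺ (λ α → γ α ℕ.≟ i) (∈-atoms (h k)) (representative-γ k∈)) (count-positive h k)

γ≤ : (α : Atom q) → γ α ≤ⁿ q
γ≤ α = ≡.subst (γ α ≤ⁿ_) (positives+γ α) (ℕ.m≤n+m (γ α) (positives α))

module _ {h h′ : Fin m → Atom q} (same : SamePSpectrum h h′) where
  -- Both sides count over the same level, so equal spectra force equally many padding zeros. The
  -- levels beyond `q`, of which the spectra do not speak, are empty.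
  level-↭ : ∀ i → List.map (count h) (level q i) ↭ List.map (count h′) (level q i)
  level-↭ i with i ℕ.<? suc q
  ... | no i≰q = ↭-trans (↭-reflexive (cong (List.map (count h)) empty)) (↭-reflexive (cong (List.map (count h′)) (sym empty)))
    where
    empty : level q i ≡ []
    empty = List.filter-none (λ α → γ α ℕ.≟ i) {xs = atoms q} (All.universal (λ α eq → i≰q (ℕ.s≤s (≡.subst (_≤ⁿ q) eq (γ≤ α)))) (atoms q))
  ... | yes i≤q with counts-↭ h i | counts-↭ h′ i
  ...   | z , p | z′ , p′ = ↭-trans p (↭-trans (↭.++⁺ occ (↭-reflexive (cong (λ n → replicate n 0) z≡z′))) (↭-sym p′))
    where
    spectrum≡ : ∀ (h : Fin m → Atom q) → sizes h (fromℕ< i≤q) ≡ List.map (count h) (occurring h i)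
    spectrum≡ h = trans (sizes-count h (toℕ (fromℕ< i≤q))) (cong (List.map (count h) ∘ occurring h) (Fin.toℕ-fromℕ< i≤q))
    occ : List.map (count h) (occurring h i) ↭ List.map (count h′) (occurring h′ i)
    occ = ↭-trans (↭-reflexive (sym (spectrum≡ h))) (↭-trans (same (fromℕ< i≤q)) (↭-reflexive (spectrum≡ h′)))
    len : ∀ {xs : List ℕ} ys z → xs ↭ ys ++ replicate z 0 → length xs ≡ length ys ℕ.+ z
    len ys z p = trans (↭.↭-length p) (trans (List.length-++ ys) (cong (length ys ℕ.+_) (List.length-replicate z)))
    z≡z′ : z ≡ z′
    z≡z′ = ℕ.+-cancelˡ-≡ (length (List.map (count h) (occurring h i))) z z′
      (trans (sym (len (List.map (count h) (occurring h i)) z p)) (trans (trans (List.length-map (count h) (level q i)) (sym (List.length-map (count h′) (level q i))))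
        (trans (len (List.map (count h′) (occurring h′ i)) z′ p′) (cong (ℕ._+ z′) (sym (↭.↭-length occ))))))

  -- Pairing each count with `γ` ensures that the matching of atoms extracted from this permutation
  -- preserves the number of negations.
  profile-↭ : List.map (λ α → γ α , count h α) (atoms q) ↭ List.map (λ α → γ α , count h′ α) (atoms q)
  profile-↭ = ↭-by-key proj₁ ℕ._≟_ _ _ λ i → ↭-trans (↭-reflexive (layer h i))
    (↭-trans (↭.map⁺ (i ,_) (level-↭ i)) (↭-reflexive (sym (layer h′ i))))
    where
    layer : ∀ (h : Fin m → Atom q) i → filter (λ x → proj₁ x ℕ.≟ i) (List.map (λ α → γ α , count h α) (atoms q))
      ≡ List.map (i ,_) (List.map (count h) (level q i))
    layer h i = trans (filter-map (λ x → proj₁ x ℕ.≟ i) (λ α → γ α , count h α) (atoms q))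
      (trans (List.map-cong-local (All.map (λ {α} eq → cong (_, count h α) eq) (All.all-filter (λ α → γ α ℕ.≟ i) (atoms q))))
        (List.map-∘ (level q i)))

count-∘ : ∀ (h : Fin m → Atom q) {g : Atom q → Atom q} → (∀ {α β} → g α ≡ g β → α ≡ β) → ∀ α → count (g ∘ h) (g α) ≡ count h α
count-∘ h {g} inj α = cong length (List.filter-≐ (λ l → g α ≟ᴬ g (h l)) (λ l → α ≟ᴬ h l) (inj , cong g) (allFin _))

count≡⇒↭ : (h h′ : Fin m → Atom q) → (∀ α → count h α ≡ count h′ α) → List.map h (allFin m) ↭ List.map h′ (allFin m)
count≡⇒↭ {m} h h′ eq = ↭-by-key id _≟ᴬ_ _ _ λ α → ↭-reflexive (trans (constant h α)
  (trans (cong (λ n → replicate n α) (eq α)) (sym (constant h′ α))))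
  where
  constant : ∀ h α → filter (_≟ᴬ α) (List.map h (allFin m)) ≡ replicate (count h α) α
  constant h α = trans (All-≡⇒replicate (All.all-filter (_≟ᴬ α) (List.map h (allFin m)))) (cong (λ n → replicate n α)
    (trans (cong length (filter-map (_≟ᴬ α) h (allFin m))) (trans (List.length-map h (filter (λ k → h k ≟ᴬ α) (allFin m)))
      (cong length (List.filter-≐ (λ k → h k ≟ᴬ α) (λ k → α ≟ᴬ h k) (sym , sym) (allFin m))))))

abstract
  -- Equal profiles give a `g` such that `g α` occurs in `h` as often as `α` in `h′`. Then `h` and
  -- `g ∘ h′` take every value equally often and differ by a permutation of the constants.
  sameSpectrum⇒conjugate : {h h′ : Fin m → Atom q} → SamePSpectrum h h′ →
    ∃ λ g → ∃ λ π → IsPermutation (atoms q) g × (∀ α → γ (g α) ≡ γ α) × IsPermutation (allFin m) π × (∀ k → g (h′ k) ≡ h (π k))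
  sameSpectrum⇒conjugate {m} {q} {h} {h′} same with reindex _≟ᴬ_ (atoms-unique q) ∈-atoms _ _ (profile-↭ same)
  ... | g , g-eq , g-↭ with reindex Fin._≟_ (Unique.allFin⁺ m) ∈-allFin h (g ∘ h′)
      (count≡⇒↭ h (g ∘ h′) λ α → ≡.subst (λ α → count h α ≡ count (g ∘ h′) α) (inverseʳ α)
        (trans (sym (proj₂ (Product.,-injective (g-eq (inverse α))))) (sym (count-∘ h′ injective (inverse α)))))
    where open IsPermutation (isPermutation (atoms-unique q) ∈-atoms g g-↭)
  ... | π , π-eq , π-↭ = g , π , isPermutation (atoms-unique q) ∈-atoms g g-↭ , (λ α → sym (proj₁ (Product.,-injective (g-eq α))))
      , isPermutation (Unique.allFin⁺ m) ∈-allFin π π-↭ , π-eq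

sizes-cong : (h h′ : Fin m → Atom q) → (∀ k → γ (h k) ≡ γ (h′ k)) →
  (∀ k l → h k ≡ h l → h′ k ≡ h′ l) → (∀ k l → h′ k ≡ h′ l → h k ≡ h l) → SamePSpectrum h h′
sizes-cong {m} h h′ γ≡ to from i = ↭-reflexive (trans
  (cong₂ (λ ms rs → List.map (λ k → length (filter (λ l → h k ≟ᴬ h l) ms)) rs) members≡ representatives≡)
  (List.map-cong (λ k → cong length (List.filter-≐ (λ l → h k ≟ᴬ h l) (λ l → h′ k ≟ᴬ h′ l) (to k _ , from k _) (members h′ (toℕ i))))
    (representatives h′ (toℕ i))))
  where
  members≡ : members h (toℕ i) ≡ members h′ (toℕ i)
  members≡ = List.filter-≐ (λ k → γ (h k) ℕ.≟ toℕ i) (λ k → γ (h′ k) ℕ.≟ toℕ i)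
    ((λ {k} eq → trans (sym (γ≡ k)) eq) , (λ {k} eq → trans (γ≡ k) eq)) (allFin m)
  deduplicate≡ : ∀ ks → deduplicate (λ k l → h k ≟ᴬ h l) ks ≡ deduplicate (λ k l → h′ k ≟ᴬ h′ l) ks
  deduplicate≡ []       = refl
  deduplicate≡ (k ∷ ks) = cong (k ∷_) (trans
    (List.filter-≐ (λ l → ¬? (h k ≟ᴬ h l)) (λ l → ¬? (h′ k ≟ᴬ h′ l)) ((_∘ from k _) , (_∘ to k _)) (deduplicate (λ k l → h k ≟ᴬ h l) ks))
    (cong (filter (λ l → ¬? (h′ k ≟ᴬ h′ l))) (deduplicate≡ ks)))
  representatives≡ : representatives h (toℕ i) ≡ representatives h′ (toℕ i)
  representatives≡ = trans (cong (deduplicate (λ k l → h k ≟ᴬ h l)) members≡) (deduplicate≡ (members h′ (toℕ i)))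

-- Uniform families


onℕ : (Fin m → Fin m) → ℕ → ℕ
onℕ {m} f n with n ℕ.<? m
... | yes n<m = toℕ (f (fromℕ< n<m))
... | no  _   = n

onℕ-toℕ : ∀ (f : Fin m → Fin m) k → onℕ f (toℕ k) ≡ toℕ (f k)
onℕ-toℕ {m} f k with toℕ k ℕ.<? m
... | yes k<m = cong (toℕ ∘ f) (Fin.fromℕ<-toℕ k k<m)
... | no  k≮m = contradiction (Fin.toℕ<n k) k≮m

onℕ-inverse : ∀ (f g : Fin m → Fin m) → (∀ k → f (g k) ≡ k) → ∀ n → onℕ f (onℕ g n) ≡ n
onℕ-inverse {m} f g eq n with n ℕ.<? m
... | yes n<m = trans (onℕ-toℕ f _) (trans (cong toℕ (eq _)) (Fin.toℕ-fromℕ< n<m))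
... | no  n≮m with n ℕ.<? m
...   | yes n<m = contradiction n<m n≮m
...   | no  _   = refl

↔-onℕ : ∀ {π : Fin m → Fin m} → IsPermutation (allFin m) π → ℕ ↔ ℕ
↔-onℕ {π = π} perm = mk↔ₛ′ (onℕ π) (onℕ inverse) (onℕ-inverse π inverse inverseʳ)
  (onℕ-inverse inverse π λ k → injective (inverseʳ (π k)))
  where open IsPermutation perm

⋀-cong : {φ ψ : Fin m → Formula q n} → (∀ i → φ i ≡ ψ i) → ⋀ φ ≡ ⋀ ψ
⋀-cong {m = zero}  eq = refl
⋀-cong {m = suc m} eq = cong₂ _∧_ (eq zero) (⋀-cong (eq ∘ suc))

rename-⋀ : ∀ g (φ : Fin m → Formula q n) → rename id g (⋀ φ) ≡ ⋀ λ i → rename id g (φ i)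
rename-⋀ {m = zero}  g φ = refl
rename-⋀ {m = suc m} g φ = cong (rename id g (φ zero) ∧_) (rename-⋀ g (φ ∘ suc))

rename-atom : ∀ g (α : Atom q) (t : Term n) → rename id g (atom α t) ≡ atom α (renameTerm g t)
rename-atom {q} {n} g α t = trans (rename-⋀ g _) (⋀-cong λ i → literal (lookup α i) i)
  where
  literal : ∀ b i → rename {q} {q} {n} id g (if b then P i t else ∼ P i t) ≡ (if b then P i (renameTerm g t) else ∼ P i (renameTerm g t))
  literal true  i = refl
  literal false i = refl

-- Renaming constants along `π` turns conjunct `k` into the statement that constant `π k` has atom
-- `h (π k)`: the conjuncts of `stateDescription h`, in another order.
stateDescription-permute : ∀ {s} {μ : Sentence q → ℝ} → IsMeasure s μ → ∀ {π : Fin m → Fin m} → IsPermutation (allFin m) π →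
  ∀ h → μ (stateDescription (h ∘ π)) ≃ μ (stateDescription h)
stateDescription-permute {μ = μ} isμ {π} perm h = ≃-trans (≃-sym (exchangeable (↔-onℕ perm) (stateDescription (h ∘ π))))
  (≃-trans (≃-reflexive (cong μ (trans (rename-⋀ (onℕ π) _) (⋀-cong λ k → rename-atom (onℕ π) (h (π k)) _))))
    (respects _ (stateDescription h)
      (λ M t → True-atoms⁺ M toℕ h λ k → ≡.subst (λ k → type M (Structure.constant M (toℕ k)) ≡ h k) (inverseʳ k)
        (trans (cong (type M ∘ Structure.constant M) (sym (onℕ-toℕ π (inverse k)))) (True-atoms⁻ M (onℕ π ∘ toℕ) (h ∘ π) t (inverse k))))
      (λ M t → True-atoms⁺ M (onℕ π ∘ toℕ) (h ∘ π) λ k →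
        trans (cong (type M ∘ Structure.constant M) (onℕ-toℕ π k)) (True-atoms⁻ M toℕ h t (π k)))))
  where
  open Measure isμ
  open IsPermutation perm

𝔼₁-bern-permute : ∀ t {g : Atom r → Atom r} → IsPermutation (atoms r) g → (∀ α → γ (g α) ≡ γ α) →
  ∀ F → 𝔼₁ (bern t) (F ∘ g) ≃ 𝔼₁ (bern t) F
𝔼₁-bern-permute {r} t {g} perm γ≡ F = ≃-trans (∑-cong (atoms r) λ α → ·-coeff (F (g α)) (bern-γ t α (g α) (sym (γ≡ α))))
  (≃-trans (≃-sym (∑-map g (atoms r) λ α → bern t α · F α)) (∑-↭ (λ α → bern t α · F α) (IsPermutation.map-↭ perm)))

𝔼-bern-permute : ∀ (ts : Vec ℚ n) {g : Atom r → Atom r} → IsPermutation (atoms r) g → (∀ α → γ (g α) ≡ γ α) →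
  ∀ F → 𝔼 (Vec.map bern ts) (F ∘ Vec.map g) ≃ 𝔼 (Vec.map bern ts) F
𝔼-bern-permute []       perm γ≡ F = ≃-refl
𝔼-bern-permute (t ∷ ts) {g} perm γ≡ F = ≃-trans
  (𝔼-cong (Vec.map bern ts) λ β → 𝔼₁-bern-permute t perm γ≡ λ α → F (α ∷ Vec.map g β))
  (𝔼-bern-permute ts perm γ≡ λ β → 𝔼₁ (bern t) λ α → F (α ∷ β))

-- The mass is left existential rather than computed from the weights; `isMeasure-mass` recovers it
-- from the value at tautologies.
isMeasure-∑ : (xs : List A) {c : A → ℚ} → (∀ x → 0ℚ ℚ.≤ c x) → {μ : A → Sentence q → ℝ} → (∀ x → ∃ λ s → IsMeasure s (μ x)) →
  ∃ λ s → IsMeasure s (λ φ → ∑ xs λ x → c x · μ x φ)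
isMeasure-∑ []       0≤c isμ = 0ℚ , isMeasure-0
isMeasure-∑ (x ∷ xs) 0≤c isμ = _ , isMeasure-+ (isMeasure-· (0≤c x) (proj₂ (isμ x))) (proj₂ (isMeasure-∑ xs 0≤c isμ))

Probability : ℚ → Set
Probability t = 0ℚ ℚ.≤ t × t ℚ.≤ 1ℚ

bern-nonNegative : ∀ {t} → Probability t → ∀ (α : Atom r) → 0ℚ ℚ.≤ bern t α
bern-nonNegative         _           []          = ℚ.<⇒≤ (ℚ.positive⁻¹ 1ℚ)
bern-nonNegative {t = t} (0≤t , t≤1) (true ∷ α)  = ℚ.nonNegative⁻¹ _ {{ℚ.nonNeg*nonNeg⇒nonNeg t {{ℚ.nonNegative 0≤t}} (bern t α)
  {{ℚ.nonNegative (bern-nonNegative (0≤t , t≤1) α)}}}}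
bern-nonNegative {t = t} (0≤t , t≤1) (false ∷ α) = ℚ.nonNegative⁻¹ _ {{ℚ.nonNeg*nonNeg⇒nonNeg (1ℚ ℚ.- t) {{ℚ.nonNegative 0≤1-t}} (bern t α)
  {{ℚ.nonNegative (bern-nonNegative (0≤t , t≤1) α)}}}}
  where
  0≤1-t : 0ℚ ℚ.≤ 1ℚ ℚ.- t
  0≤1-t = ℚ.≤-trans (ℚ.≤-reflexive (sym (ℚ.+-inverseʳ t))) (ℚ.+-monoˡ-≤ (ℚ.- t) t≤1)

isMeasure-𝔼 : ∀ {ts : Vec ℚ n} → VecAll.All Probability ts → {μ : Vec (Atom r) n → Sentence q → ℝ} → (∀ β → ∃ λ s → IsMeasure s (μ β)) →
  ∃ λ s → IsMeasure s (λ φ → 𝔼 (Vec.map bern ts) λ β → μ β φ)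
isMeasure-𝔼 VecAll.[]          isμ = isμ []
isMeasure-𝔼 (pt VecAll.∷ pts) isμ = isMeasure-𝔼 pts λ β → isMeasure-∑ (atoms _) (bern-nonNegative pt) λ α → isμ (α ∷ β)

isMeasure-mass : ∀ {s s′} {μ : Sentence q → ℝ} → IsMeasure s μ → (∀ φ → ⊨ φ → μ φ ≃ fromℚ s′) → IsMeasure s′ μ
isMeasure-mass isμ mass = record { nonNegative = nonNegative ; tautology = mass ; additive = additive ; existential = existential ; exchangeable = exchangeable }
  where open IsMeasure isμ

-- Indexed by the number of predicates. Demanding `restricts` for all injections at once covers both
-- the compatibility with sublanguages and, for bijections, Px.
record Uniform (s : ℚ) (F : ∀ r → Sentence r → ℝ) : Set₁ where
  field
    isMeasure  : ∀ r → IsMeasure s (F r)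
    restricts  : ∀ {r r′} {f : Fin r → Fin r′} → Injective _≡_ _≡_ f → ∀ φ → F r′ (rename f id φ) ≃ F r φ
    spectral   : ∀ r {m} (h h′ : Fin m → Atom r) → SamePSpectrum h h′ → F r (stateDescription h) ≃ F r (stateDescription h′)

uniform-0 : Uniform 0ℚ (λ _ _ → 0ℝ)
uniform-0 = record { isMeasure = λ r → isMeasure-0 ; restricts = λ _ _ → ≃-refl ; spectral = λ _ _ _ _ → ≃-refl }

uniform-+ : ∀ {s t F G} → Uniform s F → Uniform t G → Uniform (s ℚ.+ t) (λ r φ → F r φ + G r φ)
uniform-+ u v = record
  { isMeasure = λ r → isMeasure-+ (U.isMeasure r) (V.isMeasure r)
  ; restricts = λ inj φ → +-cong (U.restricts inj φ) (V.restricts inj φ)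
  ; spectral  = λ r h h′ same → +-cong (U.spectral r h h′ same) (V.spectral r h h′ same)
  }
  where
  module U = Uniform u
  module V = Uniform v

uniform-· : ∀ {c s F} → 0ℚ ℚ.≤ c → Uniform s F → Uniform (c ℚ.* s) (λ r φ → c · F r φ)
uniform-· {c} 0≤c u = record
  { isMeasure = λ r → isMeasure-· 0≤c (isMeasure r)
  ; restricts = λ inj φ → ·-cong c (restricts inj φ)
  ; spectral  = λ r h h′ same → ·-cong c (spectral r h h′ same)
  }
  where open Uniform u

-- Averages over random colourings

module _ {μ : Sentence q → ℝ} (isμ : IsMeasure 1ℚ μ) (ρ : Atom q → Fin n) where
  private
    module M = Measure isμ

  colouring : Vec (Atom r) n → Atom q → Atom r
  colouring β α = lookup β (ρ α)

  -- Colour `c` receives an atom whose law is `bern` at entry `c` of `ts`, independently of the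
  -- other colours. The data `μ`, `ρ` and `ts` are the same for every `r`, which ties the languages
  -- together.
  random : Vec ℚ n → ∀ r → Sentence r → ℝ
  random ts r φ = 𝔼 (Vec.map bern ts) λ β → μ (interpret (colouring β) φ)

  colouring-map : ∀ (g : Atom r → Atom r′) β α → colouring (Vec.map g β) α ≡ g (colouring β α)
  colouring-map g β α = Vec.lookup-map (ρ α) g β

  random-isMeasure : ∀ {ts} → VecAll.All Probability ts → ∀ r → IsMeasure 1ℚ (random ts r)
  random-isMeasure {ts} pts r = isMeasure-mass
    (proj₂ (isMeasure-𝔼 pts {λ β φ → μ (interpret (colouring β) φ)} λ β → 1ℚ , isMeasure-interpret (colouring β) isμ))
    (λ φ ⊨φ → ≃-trans
      (𝔼-cong (Vec.map bern ts) {λ β → μ (interpret (colouring β) φ)} {λ _ → 1ℝ} λ β →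
        IsMeasure.tautology (isMeasure-interpret (colouring β) isμ) φ ⊨φ)
      (𝔼-bern-const r ts 1ℝ))

  random-restricts : ∀ ts {f : Fin r → Fin r′} → Injective _≡_ _≡_ f → ∀ φ → random ts r′ (rename f id φ) ≃ random ts r φ
  random-restricts ts {f} inj φ = ≃-trans
    (𝔼-cong (Vec.map bern ts) {λ β → μ (interpret (colouring β) (rename f id φ))}
      {λ β → μ (interpret (colouring (Vec.map (restrictAtom f) β)) φ)} λ β →
      ≃-reflexive (cong μ (trans (interpret-restrict (colouring β) f φ) (sym (interpret-cong (colouring-map (restrictAtom f) β) φ)))))
    (𝔼-bern-restrict ts inj λ β → μ (interpret (colouring β) φ))

  module _ {g : Atom r → Atom r} (perm : IsPermutation (atoms r) g) (h : Fin m → Atom r) where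
    open IsPermutation perm

    interpret-relabel : ∀ β → μ (interpret (colouring (Vec.map g β)) (stateDescription (g ∘ h))) ≃ μ (interpret (colouring β) (stateDescription h))
    interpret-relabel β = M.respects (interpret (colouring (Vec.map g β)) (stateDescription (g ∘ h))) (interpret (colouring β) (stateDescription h))
      (λ M t → True-interpret-stateDescription⁺ (colouring β) M h λ k →
        injective (trans (sym (colouring-map g β _)) (True-interpret-stateDescription⁻ (colouring (Vec.map g β)) M (g ∘ h) t k)))
      (λ M t → True-interpret-stateDescription⁺ (colouring (Vec.map g β)) M (g ∘ h) λ k →
        trans (colouring-map g β _) (cong g (True-interpret-stateDescription⁻ (colouring β) M h t k)))

    random-relabel : ∀ ts → (∀ α → γ (g α) ≡ γ α) → random ts r (stateDescription (g ∘ h)) ≃ random ts r (stateDescription h)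
    random-relabel ts γ≡ = ≃-trans (≃-sym (𝔼-bern-permute ts perm γ≡ λ β → μ (interpret (colouring β) (stateDescription (g ∘ h)))))
      (𝔼-cong (Vec.map bern ts) {λ β → μ (interpret (colouring (Vec.map g β)) (stateDescription (g ∘ h)))}
        {λ β → μ (interpret (colouring β) (stateDescription h))} interpret-relabel)

  random-spectral : ∀ {ts} → VecAll.All Probability ts → ∀ r {m} (h h′ : Fin m → Atom r) → SamePSpectrum h h′ →
    random ts r (stateDescription h) ≃ random ts r (stateDescription h′)
  random-spectral {ts} pts r h h′ same =
    let g , π , g-perm , γ≡ , π-perm , eq = sameSpectrum⇒conjugate same in
    ≃-trans (≃-sym (stateDescription-permute (random-isMeasure pts r) π-perm h))
      (≃-trans (≃-reflexive (cong (random ts r) (⋀-cong λ k → cong (λ α → atom α (const (toℕ k))) (sym (eq k)))))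
        (random-relabel g-perm h′ ts γ≡))

  random-uniform : ∀ {ts} → VecAll.All Probability ts → Uniform 1ℚ (random ts)
  random-uniform {ts} pts = record { isMeasure = random-isMeasure pts ; restricts = random-restricts ts ; spectral = random-spectral pts }

-- Signed combinations of uniform families

record Difference (G : Sentence q → ℝ) : Set₁ where
  constructor difference
  field
    {s₁ s₂} : ℚ
    {F₁ F₂} : ∀ r → Sentence r → ℝ
    uniform₁ : Uniform s₁ F₁
    uniform₂ : Uniform s₂ F₂
    equals   : ∀ φ → G φ ≃ F₁ q φ - F₂ q φ

difference-cong : ∀ {G H : Sentence q → ℝ} → (∀ φ → H φ ≃ G φ) → Difference G → Difference H
difference-cong eq (difference u v eq′) = difference u v λ φ → ≃-trans (eq φ) (eq′ φ)

difference-uniform : ∀ {s F} → Uniform s F → Difference (F q)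
difference-uniform {q} {F = F} u = difference u uniform-0 λ φ → pointwise λ n → solve 1 (λ a → a := a :- con 0ℚ) refl (seq (F q φ) n)

difference-+ : ∀ {G H : Sentence q → ℝ} → Difference G → Difference H → Difference (λ φ → G φ + H φ)
difference-+ {q} (difference {F₁ = F₁} {F₂} u v eq) (difference {F₁ = F₁′} {F₂′} u′ v′ eq′) =
  difference (uniform-+ u u′) (uniform-+ v v′) λ φ → ≃-trans (+-cong (eq φ) (eq′ φ))
    (pointwise λ n → solve 4 (λ a b c d → (a :- b) :+ (c :- d) := (a :+ c) :- (b :+ d)) refl
      (seq (F₁ q φ) n) (seq (F₂ q φ) n) (seq (F₁′ q φ) n) (seq (F₂′ q φ) n))

-- A negative factor exchanges the two families, so that both are still multiplied by a nonnegative
-- number.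
difference-· : ∀ c {G : Sentence q → ℝ} → Difference G → Difference (λ φ → c · G φ)
difference-· {q} c (difference {F₁ = F₁} {F₂} u v eq) with ℚ.≤-total 0ℚ c
... | inj₁ 0≤c = difference (uniform-· 0≤c u) (uniform-· 0≤c v) λ φ → ≃-trans (·-cong c (eq φ))
  (pointwise λ n → solve 3 (λ c a b → c :* (a :- b) := c :* a :- c :* b) refl c (seq (F₁ q φ) n) (seq (F₂ q φ) n))
... | inj₂ c≤0 = difference (uniform-· 0≤-c v) (uniform-· 0≤-c u) λ φ → ≃-trans (·-cong c (eq φ))
  (pointwise λ n → solve 3 (λ c a b → c :* (a :- b) := (:- c) :* b :- (:- c) :* a) refl c (seq (F₁ q φ) n) (seq (F₂ q φ) n))
  where
  0≤-c : 0ℚ ℚ.≤ ℚ.- c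
  0≤-c = ℚ.neg-antimono-≤ c≤0

difference-∑ : (xs : List A) {G : A → Sentence q → ℝ} → (∀ {x} → x ∈ xs → Difference (G x)) → Difference (λ φ → ∑ xs λ x → G x φ)
difference-∑ []       d = difference-uniform uniform-0
difference-∑ (x ∷ xs) d = difference-+ (d (here refl)) (difference-∑ xs (d ∘ there))

-- The average is multilinear in its weights, so the factors `indicator i` can be expanded into laws
-- `bern t` one at a time. During the induction the factor in question is absorbed into `F`.
difference-indicators : ∀ (is : Vec ℕ n) (F : Vec (Atom q) n → Sentence q → ℝ) →
  (∀ {ts} → VecAll.All Probability ts → Difference (λ φ → 𝔼 (Vec.map bern ts) λ β → F β φ)) →
  Difference (λ φ → 𝔼 (Vec.map indicator is) λ β → F β φ)
difference-indicators []       F d = d VecAll.[]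
difference-indicators {q = q} (i ∷ is) F d =
  let ns , bounds , eq = indicator-combination q i in
  difference-indicators is (λ β φ → 𝔼₁ (indicator i) λ α → F (α ∷ β) φ) λ {ts} pts → difference-cong
    (λ φ → ≃-trans (𝔼-cong (Vec.map bern ts) λ β → 𝔼₁-combination ns eq λ α → F (α ∷ β) φ)
      (≃-trans (𝔼-∑ (Vec.map bern ts) ns λ β (a , t) → a · 𝔼₁ (bern t) λ α → F (α ∷ β) φ)
        (∑-cong ns λ (a , t) → 𝔼-· (Vec.map bern ts) a λ β → 𝔼₁ (bern t) λ α → F (α ∷ β) φ)))
    (difference-∑ ns {λ (a , t) φ → a · 𝔼 (Vec.map bern (t ∷ ts)) λ β → F β φ}
      λ {(a , t)} p → difference-· a (d (All.lookup bounds p VecAll.∷ pts)))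

-- Sums over injective maps preserving γ


_∈?_ : (α : Atom q) (αs : List (Atom q)) → Dec (α ∈ αs)
_∈?_ = DecMembership._∈?_ _≟ᴬ_

∑-filter : ∀ {P : A → Set} (P? : ∀ x → Dec (P x)) xs (F : A → ℝ) →
  ∑ (filter P? xs) F ≃ ∑ xs λ x → (if does (P? x) then 1ℚ else 0ℚ) · F x
∑-filter P? []       F = ≃-refl
∑-filter P? (x ∷ xs) F with does (P? x)
... | true  = +-cong (≃-sym (·-identity (F x))) (∑-filter P? xs F)
... | false = ≃-trans (∑-filter P? xs F) (≃-trans (≃-sym (+-identityˡ (∑ xs G))) (+-cong (≃-sym (·-zeroˡ (F x))) ≃-refl))
  where
  G : _ → ℝ
  G x = (if does (P? x) then 1ℚ else 0ℚ) · F x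

∑-level : ∀ q i (F : Atom q → ℝ) → ∑ (level q i) F ≃ 𝔼₁ (indicator i) F
∑-level q i F = ∑-filter (λ α → γ α ℕ.≟ i) (atoms q) F

toList-lookup : (σ : Vec A n) → toList σ ≡ List.map (lookup σ) (allFin n)
toList-lookup σ = trans (go σ) (sym (List.map-tabulate id (lookup σ)))
  where
  go : (σ : Vec A n) → toList σ ≡ List.tabulate (lookup σ)
  go []      = refl
  go (x ∷ σ) = cong (x ∷_) (go σ)

unique⇒lookup-injective : {σ : Vec A n} → Unique (toList σ) → ∀ {i j} → lookup σ i ≡ lookup σ j → i ≡ j
unique⇒lookup-injective {σ = σ} σ! = Unique-map-injective (≡.subst Unique (toList-lookup σ) σ!) (∈-allFin _) (∈-allFin _)

covering : {xs ys : List A} → Unique xs → (∀ {x} → x ∈ xs → x ∈ ys) → length xs ≡ length ys → xs ↭ ys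
covering {ys = []}     []         xs⊆ys len = ↭.refl
covering {xs = x ∷ xs} (x∉ ∷ xs!) xs⊆ys len with ∈-∃++ (xs⊆ys (here refl))
... | us , vs , refl = ↭-trans (↭.prep x (covering xs! rest
    (ℕ.suc-injective (trans len (↭.↭-length (↭.shift x us vs)))))) (↭-sym (↭.shift x us vs))
  where
  rest : ∀ {y} → y ∈ xs → y ∈ us ++ vs
  rest y∈ with ↭.∈-resp-↭ (↭.shift x us vs) (xs⊆ys (there y∈))
  ... | here refl = contradiction refl (All.lookup x∉ y∈)
  ... | there p   = p

extensions : ℕ → Vec (Atom q) n → List (Atom q)
extensions {q} i σ = filter (λ α → ¬? (α ∈? toList σ)) (level q i)

-- When the prescribed numbers of negations are those of the list of all atoms, these vectors are
-- the permutations of the atoms that preserve `γ`.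
injections : Vec ℕ n → List (Vec (Atom q) n)
injections []       = [] ∷ []
injections (i ∷ is) = concatMap (λ σ → List.map (_∷ σ) (extensions i σ)) (injections is)

positions : Vec ℕ n → ℕ → List (Fin n)
positions is i = filter (λ j → lookup is j ℕ.≟ i) (allFin _)

injections⁻ : (is : Vec ℕ n) {σ : Vec (Atom q) n} → σ ∈ injections is → Unique (toList σ) × Vec.map γ σ ≡ is
injections⁻ []       (here refl) = [] , refl
injections⁻ {q = q} (i ∷ is) p with find (∈-concatMap⁻ (λ σ → List.map (_∷ σ) (extensions i σ)) {xs = injections is} p)
... | σ , σ∈ , p′ with ∈-map⁻ (_∷ σ) p′
...   | α , α∈ , refl with injections⁻ is σ∈ | ∈-filter⁻ (λ α → ¬? (α ∈? toList σ)) {xs = level q i} α∈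
...     | σ! , refl | α∈level , α∉ = All.¬Any⇒All¬ (toList σ) α∉ ∷ σ!
          , cong (_∷ _) (proj₂ (∈-filter⁻ (λ α → γ α ℕ.≟ i) {xs = atoms q} α∈level))

injections⁺ : (σ : Vec (Atom q) n) → Unique (toList σ) → σ ∈ injections (Vec.map γ σ)
injections⁺ []      _         = here refl
injections⁺ (α ∷ σ) (α∉ ∷ σ!) = ∈-concatMap⁺ (λ σ → List.map (_∷ σ) (extensions (γ α) σ)) (lose (injections⁺ σ σ!)
  (∈-map⁺ (_∷ σ) (∈-filter⁺ (λ α → ¬? (α ∈? toList σ)) (∈-filter⁺ (λ β → γ β ℕ.≟ γ α) (∈-atoms α) refl) (All.All¬⇒¬Any α∉))))

module _ {σ : Vec (Atom q) n} (σ! : Unique (toList σ)) (i : ℕ) where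
  excluded-↭ : filter (λ α → α ∈? toList σ) (level q i) ↭ List.map (lookup σ) (positions (Vec.map γ σ) i)
  excluded-↭ = ↭-trans (unique-↭ (Unique.filter⁺ _ (Unique.filter⁺ _ (atoms-unique q))) (Unique.filter⁺ (λ α → γ α ℕ.≟ i) σ!)
    (λ p → let p′ , ∈σ = ∈-filter⁻ (λ α → α ∈? toList σ) {xs = level q i} p
           in ∈-filter⁺ (λ α → γ α ℕ.≟ i) ∈σ (proj₂ (∈-filter⁻ (λ α → γ α ℕ.≟ i) {xs = atoms q} p′)))
    (λ p → let ∈σ , γ≡ = ∈-filter⁻ (λ α → γ α ℕ.≟ i) {xs = toList σ} p
           in ∈-filter⁺ (λ α → α ∈? toList σ) (∈-filter⁺ (λ α → γ α ℕ.≟ i) (∈-atoms _) γ≡) ∈σ))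
    (↭-reflexive (trans (cong (filter (λ α → γ α ℕ.≟ i)) (toList-lookup σ))
      (trans (filter-map (λ α → γ α ℕ.≟ i) (lookup σ) (allFin n)) (cong (List.map (lookup σ))
        (List.filter-≐ _ (λ j → lookup (Vec.map γ σ) j ℕ.≟ i)
          ((λ {j} → trans (Vec.lookup-map j γ σ)) , (λ {j} → trans (sym (Vec.lookup-map j γ σ)))) (allFin n))))))

  -- The whole level, less the atoms already used. By `excluded-↭` the latter are indexed by
  -- positions, which depend on the prescribed numbers only; the sums over `σ` and over positions
  -- can then be interchanged.
  ∑-extensions : ∀ F → ∑ (extensions i σ) F ≃ 𝔼₁ (indicator i) F + (ℚ.- 1ℚ) · ∑ (positions (Vec.map γ σ) i) (F ∘ lookup σ)
  ∑-extensions F = ≃-trans (isolate (∑ inside F) (∑ (extensions i σ) F)) (+-cong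
    (≃-trans (≃-sym (∑-++ inside (extensions i σ) F)) (≃-trans (≃-sym (∑-↭ F (filter-partition (λ α → α ∈? toList σ) (level q i)))) (∑-level q i F)))
    (·-cong (ℚ.- 1ℚ) (≃-trans (∑-↭ F excluded-↭) (∑-map (lookup σ) (positions (Vec.map γ σ) i) F))))
    where
    inside : List (Atom q)
    inside = filter (λ α → α ∈? toList σ) (level q i)
    isolate : ∀ x y → y ≃ (x + y) + (ℚ.- 1ℚ) · x
    isolate x y = pointwise λ n → solve 2 (λ a b → b := (a :+ b) :+ con (ℚ.- 1ℚ) :* a) refl (seq x n) (seq y n)

-- One step of inclusion-exclusion: the first entry is released from being distinct from the others,
-- and its coincidences with the entries of the same level are subtracted. Either term has one
-- constrained entry fewer.
∑-injections : ∀ i (is : Vec ℕ n) (F : Vec (Atom q) (suc n) → ℝ) → ∑ (injections (i ∷ is)) F ≃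
  𝔼₁ (indicator i) (λ α → ∑ (injections is) λ σ → F (α ∷ σ)) + (ℚ.- 1ℚ) · ∑ (positions is i) λ j → ∑ (injections is) λ σ → F (lookup σ j ∷ σ)
∑-injections {q = q} i is F = begin
  ∑ (injections (i ∷ is)) F
    ≈⟨ ∑-concatMap (λ σ → List.map (_∷ σ) (extensions i σ)) (injections is) F ⟩
  ∑ (injections is) (λ σ → ∑ (List.map (_∷ σ) (extensions i σ)) F)
    ≈⟨ ∑-cong-∈ (injections is) (λ {σ} σ∈ → ≃-trans (∑-map (_∷ σ) (extensions i σ) F) (expand σ σ∈)) ⟩
  ∑ (injections is) (λ σ → E σ + (ℚ.- 1ℚ) · C σ)
    ≈⟨ ∑-+ (injections is) E (λ σ → (ℚ.- 1ℚ) · C σ) ⟩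
  ∑ (injections is) E + ∑ (injections is) (λ σ → (ℚ.- 1ℚ) · C σ)
    ≈⟨ +-cong (≃-trans (∑-swap (injections is) (atoms q) λ σ α → indicator i α · F (α ∷ σ))
                (∑-cong (atoms q) λ α → ∑-· (indicator i α) (injections is) λ σ → F (α ∷ σ)))
              (≃-trans (∑-· (ℚ.- 1ℚ) (injections is) C)
                (·-cong (ℚ.- 1ℚ) (∑-swap (injections is) (positions is i) λ σ j → F (lookup σ j ∷ σ)))) ⟩
  𝔼₁ (indicator i) (λ α → ∑ (injections is) λ σ → F (α ∷ σ)) + (ℚ.- 1ℚ) · ∑ (positions is i) (λ j → ∑ (injections is) λ σ → F (lookup σ j ∷ σ)) ∎
  where
  open ≃-Reasoning
  E C : Vec (Atom q) _ → ℝ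
  E σ = 𝔼₁ (indicator i) λ α → F (α ∷ σ)
  C σ = ∑ (positions is i) λ j → F (lookup σ j ∷ σ)
  expand : ∀ σ → σ ∈ injections is → ∑ (extensions i σ) (λ α → F (α ∷ σ)) ≃ E σ + (ℚ.- 1ℚ) · C σ
  expand σ σ∈ = let σ! , γ≡ = injections⁻ is σ∈ in
    ≡.subst (λ is → ∑ (extensions i σ) (λ α → F (α ∷ σ)) ≃ E σ + (ℚ.- 1ℚ) · ∑ (positions is i) λ j → F (lookup σ j ∷ σ)) γ≡
      (∑-extensions σ! i λ α → F (α ∷ σ))

module _ {μ : Sentence q → ℝ} (isμ : IsMeasure 1ℚ μ) where
  -- Every atom takes its image from a fixed place among the free or the constrained entries.
  -- Merging places keeps this form, and once no constrained entry is left it is a colouring.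
  Selects : (Vec (Atom q) k → Vec (Atom q) n → Atom q → Atom q) → Set
  Selects G = ∀ α → (∃ λ c → ∀ β σ → G β σ α ≡ lookup β c) ⊎ (∃ λ d → ∀ β σ → G β σ α ≡ lookup σ d)

  -- The entries of σ, which are required to be distinct, are traded one by one for
  -- unconstrained ones, at the price of terms in which an entry is repeated.
  difference-injections : ∀ (is : Vec ℕ n) (js : Vec ℕ k) (G : Vec (Atom q) k → Vec (Atom q) n → Atom q → Atom q) → Selects G →
    Difference λ φ → 𝔼 (Vec.map indicator js) λ β → ∑ (injections is) λ σ → μ (interpret (G β σ) φ)
  difference-injections [] js G sel = difference-cong
    (λ φ → 𝔼-cong (Vec.map indicator js) λ β → ≃-trans (+-identityʳ (μ (interpret (G β []) φ)))
      (≃-reflexive (cong μ (interpret-cong (λ α → proj₂ (select α) β) φ))))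
    (difference-indicators js (λ β φ → μ (interpret (colouring isμ (proj₁ ∘ select) β) φ)) λ pts →
      difference-uniform (random-uniform isμ (proj₁ ∘ select) pts))
    where
    select : ∀ α → ∃ λ c → ∀ β → G β [] α ≡ lookup β c
    select α with sel α
    ... | inj₁ (c , eq) = c , λ β → eq β []
    ... | inj₂ (() , _)
  difference-injections (i ∷ is) js G sel = difference-cong
    (λ φ → ≃-trans (𝔼-cong fs λ β → ∑-injections i is λ σ → Φ β σ φ)
      (≃-trans (𝔼-+ fs (λ β → 𝔼₁ (indicator i) λ α → ∑ (injections is) λ σ → Φ β (α ∷ σ) φ)
                       (λ β → (ℚ.- 1ℚ) · ∑ (positions is i) λ j → ∑ (injections is) λ σ → Φ β (lookup σ j ∷ σ) φ))
        (+-cong ≃-refl (≃-trans (𝔼-· fs (ℚ.- 1ℚ) λ β → ∑ (positions is i) λ j → ∑ (injections is) λ σ → Φ β (lookup σ j ∷ σ) φ)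
          (·-cong (ℚ.- 1ℚ) (𝔼-∑ fs (positions is i) λ β j → ∑ (injections is) λ σ → Φ β (lookup σ j ∷ σ) φ))))))
    (difference-+
      (difference-injections is (i ∷ js) (λ β σ → G (Vec.tail β) (Vec.head β ∷ σ)) free)
      (difference-· (ℚ.- 1ℚ) (difference-∑ (positions is i) {λ j φ → 𝔼 fs λ β → ∑ (injections is) λ σ → Φ β (lookup σ j ∷ σ) φ} λ {j} _ →
        difference-injections is js (λ β σ → G β (lookup σ j ∷ σ)) (merged j))))
    where
    fs = Vec.map indicator js
    Φ : Vec (Atom q) _ → Vec (Atom q) _ → Sentence q → ℝ
    Φ β σ φ = μ (interpret (G β σ) φ)
    free : Selects λ β σ → G (Vec.tail β) (Vec.head β ∷ σ)
    free α with sel α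
    ... | inj₁ (c , eq)     = inj₁ (suc c , λ { (b ∷ β) σ → eq β (b ∷ σ) })
    ... | inj₂ (zero , eq)  = inj₁ (zero , λ { (b ∷ β) σ → eq β (b ∷ σ) })
    ... | inj₂ (suc d , eq) = inj₂ (d , λ { (b ∷ β) σ → eq β (b ∷ σ) })
    merged : ∀ j → Selects λ β σ → G β (lookup σ j ∷ σ)
    merged j α with sel α
    ... | inj₁ (c , eq)     = inj₁ (c , λ β σ → eq β (lookup σ j ∷ σ))
    ... | inj₂ (zero , eq)  = inj₂ (j , λ β σ → eq β (lookup σ j ∷ σ))
    ... | inj₂ (suc d , eq) = inj₂ (d , λ β σ → eq β (lookup σ j ∷ σ))

-- Invariance from SPx and the signed decomposition

module _ {μ : Sentence q → ℝ} (isμ : IsMeasure 1ℚ μ)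
         (spx : ∀ {m} (h h′ : Fin m → Atom q) → SamePSpectrum h h′ → μ (stateDescription h) ≃ μ (stateDescription h′)) where
  open Measure isμ

  -- Interpreting the state description of `h` through `g` yields that of `inverse ∘ h`. It has the
  -- same P-spectrum, since a bijection preserving `γ` changes neither the classes nor the levels of
  -- the constants.
  invariant : ∀ {g} → IsPermutation (atoms q) g → (∀ α → γ (g α) ≡ γ α) → ∀ φ → μ (interpret g φ) ≃ μ φ
  invariant {g} perm γ≡ = determined-by-state-descriptions (isMeasure-interpret g isμ) isμ λ h → ≃-trans
    (respects (interpret g (stateDescription h)) (stateDescription (inverse ∘ h))
      (λ M t → True-atoms⁺ M toℕ (inverse ∘ h) λ k →
        injective (trans (True-interpret-stateDescription⁻ g M h t k) (sym (inverseʳ (h k)))))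
      (λ M t → True-interpret-stateDescription⁺ g M h λ k →
        trans (cong g (True-atoms⁻ M toℕ (inverse ∘ h) t k)) (inverseʳ (h k))))
    (spx (inverse ∘ h) h (sizes-cong (inverse ∘ h) h
      (λ k → trans (sym (γ≡ (inverse (h k)))) (cong γ (inverseʳ (h k))))
      (λ k l eq → trans (sym (inverseʳ (h k))) (trans (cong g eq) (inverseʳ (h l))))
      (λ k l → cong inverse)))
    where open IsPermutation perm

  -- Every atom has a colour of its own, so that colourings realise arbitrary self-maps of the
  -- atoms.
  colour : Atom q → Fin (length (atoms q))
  colour α = Any.index (∈-atoms α)

  allAtoms : Vec (Atom q) (length (atoms q))
  allAtoms = fromList (atoms q)

  lookup-colour : ∀ α → lookup allAtoms (colour α) ≡ α
  lookup-colour α = go (∈-atoms α)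
    where
    go : ∀ {αs} (p : α ∈ αs) → lookup (fromList αs) (Any.index p) ≡ α
    go (here refl) = refl
    go (there p)   = go p

  -- Distinct entries make the self-map injective, hence, by `covering`, a permutation of the finite
  -- set of atoms; the prescribed numbers make it preserve `γ`.
  injection-invariant : ∀ {σ} → σ ∈ injections (Vec.map γ allAtoms) → ∀ φ → μ (interpret (lookup σ ∘ colour) φ) ≃ μ φ
  injection-invariant {σ} σ∈ = invariant
    (isPermutation (atoms-unique q) ∈-atoms g
      (covering (Unique.map⁺ g-injective (atoms-unique q)) (λ _ → ∈-atoms _) (List.length-map g (atoms q))))
    (λ α → trans (sym (Vec.lookup-map (colour α) γ σ)) (trans (cong (λ is → lookup is (colour α)) (proj₂ properties))
      (trans (Vec.lookup-map (colour α) γ allAtoms) (cong γ (lookup-colour α)))))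
    where
    g : Atom q → Atom q
    g = lookup σ ∘ colour
    properties : Unique (toList σ) × Vec.map γ σ ≡ Vec.map γ allAtoms
    properties = injections⁻ (Vec.map γ allAtoms) σ∈
    g-injective : ∀ {α β} → g α ≡ g β → α ≡ β
    g-injective {α} {β} eq = trans (sym (lookup-colour α))
      (trans (cong (lookup allAtoms) (unique⇒lookup-injective (proj₁ properties) eq)) (lookup-colour β))

  abstract
    -- In the sum over the `γ`-preserving permutations every summand equals `μ φ`, so `c` is their
    -- number. It is positive because the identity, given by `allAtoms`, is one of them.
    multiple-difference : ∃ λ c → 0ℚ ℚ.< c × Difference λ φ → c · μ φ
    multiple-difference = card gs , card-positive gs (injections⁺ allAtoms
        (≡.subst Unique (sym (Vec.toList∘fromList (atoms q))) (atoms-unique q)))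
      , difference-cong (λ φ → ≃-sym (≃-trans (∑-cong-∈ gs λ σ∈ → injection-invariant σ∈ φ) (∑-const gs (μ φ))))
          (difference-injections isμ (Vec.map γ allAtoms) [] (λ _ σ → lookup σ ∘ colour) λ α → inj₂ (colour α , λ _ _ → refl))
      where
      gs : List (Vec (Atom q) (length (atoms q)))
      gs = injections (Vec.map γ allAtoms)
      card : List A → ℚ
      card []       = 0ℚ
      card (x ∷ xs) = 1ℚ ℚ.+ card xs
      ∑-const : ∀ (xs : List A) x → ∑ xs (λ _ → x) ≃ card xs · x
      ∑-const []       x = ≃-sym (·-zeroˡ x)
      ∑-const (_ ∷ xs) x = ≃-trans (+-cong (≃-sym (·-identity x)) (∑-const xs x)) (≃-sym (·-distribʳ 1ℚ (card xs) x))
      card-nonNegative : (xs : List A) → 0ℚ ℚ.≤ card xs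
      card-nonNegative []       = ℚ.≤-refl
      card-nonNegative (_ ∷ xs) = ℚ.+-mono-≤ (ℚ.<⇒≤ (ℚ.positive⁻¹ 1ℚ)) (card-nonNegative xs)
      card-positive : ∀ {x : A} xs → x ∈ xs → 0ℚ ℚ.< card xs
      card-positive (_ ∷ xs) _ = ℚ.+-mono-<-≤ (ℚ.positive⁻¹ 1ℚ) (card-nonNegative xs)

  abstract
    measure-difference : Difference μ
    measure-difference =
      let c , 0<c , d = multiple-difference
          c⁻¹ , inverse = reciprocal c (ℚ.<⇒≢ 0<c ∘ sym)
      in difference-cong (λ φ → ≃-sym (≃-trans (·-assoc c⁻¹ c (μ φ))
           (≃-trans (·-coeff (μ φ) (trans (ℚ.*-comm c⁻¹ c) inverse)) (·-identity (μ φ))))) (difference-· c⁻¹ d)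

-- Normalisation and the two directions of the equivalence

reciprocal-nonNegative : ∀ {x} → 0ℚ ℚ.< x → ∃ λ y → 0ℚ ℚ.≤ y × x ℚ.* y ≡ 1ℚ
reciprocal-nonNegative {x} 0<x = let y , 0<y , eq = scale 1ℚ x (ℚ.positive⁻¹ 1ℚ) 0<x in y , ℚ.<⇒≤ 0<y , eq

abstract
  normalise : ∀ {s F} → Uniform s F → 0ℚ ℚ.< s → ∃ λ F′ → Uniform 1ℚ F′ × (∀ r φ → F r φ ≃ s · F′ r φ)
  normalise {s} {F} u 0<s =
    let y , 0≤y , eq = reciprocal-nonNegative 0<s in
    (λ r φ → y · F r φ)
    , ≡.subst (λ s → Uniform s λ r φ → y · F r φ) (trans (ℚ.*-comm y s) eq) (uniform-· 0≤y u)
    , λ r φ → ≃-sym (≃-trans (·-assoc s y (F r φ)) (≃-trans (·-coeff (F r φ) eq) (·-identity (F r φ))))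

uniform⇒ULi : ∀ {F : ∀ r → Sentence r → ℝ} (u : Uniform 1ℚ F) → ULiWithSPx (isMeasure⁻ (Uniform.isMeasure u q))
uniform⇒ULi {q} {F} u = record
  { family   = λ 𝓛 → isMeasure⁻ (isMeasure (size 𝓛))
  ; exch     = λ 𝓛 π φ → ⌈ IsMeasure.exchangeable (isMeasure (size 𝓛)) π φ ⌉
  ; px       = λ 𝓛 π φ → ⌈ restricts (Injection.injective (↔⇒↣ π)) φ ⌉
  ; spx      = λ 𝓛 h h′ same → ⌈ spectral (size 𝓛) h h′ same ⌉
  ; member   = λ φ → ⌈ ≃-refl {F q φ} ⌉
  ; restrict = λ {𝓛} {𝓛′} (f , eq) φ → ⌈ restricts (λ {i} {j} fi≡fj → Language.injective 𝓛
                 (trans (sym (eq i)) (trans (cong (symbol 𝓛′) fi≡fj) (eq j)))) φ ⌉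
  }
  where open Uniform u

theorem3 : (q : ℕ) → 1 ≤ⁿ q →
    (w : ProbabilityFunction q) → Ex w →
    SPx w ⇔
    (∃ λ (c : ℝ) → 0ℝ ≤ c ×
    ∃ λ (w₁ : ProbabilityFunction q) → ∃ λ (w₂ : ProbabilityFunction q) →
    Ex w₁ × ULiWithSPx w₁ × Ex w₂ × ULiWithSPx w₂ ×
    (∀ φ → prob w φ ≈ (1ℝ + c) * prob w₁ φ - c * prob w₂ φ))
theorem3 q _ w ex = mk⇔
  (λ spx → decompose (measure-difference (isMeasure⁺ w ex) λ h h′ same → ⌊ spx h h′ same ⌋)) recompose
  where
  recompose : _ → SPx w
  recompose (c , _ , w₁ , w₂ , _ , uli₁ , _ , uli₂ , eq) h h′ same = ⌈ agree ⌉
    where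
    spx : ∀ {w} → ULiWithSPx w → prob w (stateDescription h) ≃ prob w (stateDescription h′)
    spx {w} uli = ≃-trans (≃-sym (at h)) (≃-trans within (at h′))
      where
      at : ∀ h → prob (ULiWithSPx.family uli (L q)) (stateDescription h) ≃ prob w (stateDescription h)
      at h = ⌊ ULiWithSPx.member uli (stateDescription h) ⌋
      within : prob (ULiWithSPx.family uli (L q)) (stateDescription h) ≃ prob (ULiWithSPx.family uli (L q)) (stateDescription h′)
      within = ⌊ ULiWithSPx.spx uli (L q) h h′ same ⌋
    mixture : ∀ φ → prob w φ ≃ (1ℝ + c) * prob w₁ φ - c * prob w₂ φ
    mixture φ = ⌊ eq φ ⌋
    agree : prob w (stateDescription h) ≃ prob w (stateDescription h′)
    agree = ≃-trans (mixture (stateDescription h)) (≃-trans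
      (+-cong (*-congˡ (1ℝ + c) (spx uli₁)) (neg-cong (*-congˡ c (spx uli₂)))) (≃-sym (mixture (stateDescription h′))))

  decompose : Difference (prob w) → _
  decompose (difference {s₁} {s₂} {F₁} {F₂} u₁ u₂ eq) =
    -- A common summand of mass one is added to both families, so that the second can be normalised
    -- even if its mass `s₂` is zero.
    let F₀ , u₀ , _ = normalise u₁ 0<s₁
        V₁ , v₁ , eq₁ = normalise (uniform-+ u₁ u₀) (ℚ.+-mono-<-≤ 0<s₁ 0≤1)
        V₂ , v₂ , eq₂ = normalise (uniform-+ u₂ u₀) (ℚ.+-mono-≤-< 0≤s₂ (ℚ.positive⁻¹ 1ℚ))
    -- The mass of the second family after the shift. The first has mass one more, as comparing
    -- masses at `⊤ᶠ` shows, which gives the coefficient `1 + λ`.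
    in fromℚ (s₂ ℚ.+ 1ℚ) , ⌈ fromℚ-mono (ℚ.+-mono-≤ 0≤s₂ 0≤1) ⌉≤
     , isMeasure⁻ (Uniform.isMeasure v₁ q) , isMeasure⁻ (Uniform.isMeasure v₂ q)
     , (λ π φ → ⌈ IsMeasure.exchangeable (Uniform.isMeasure v₁ q) π φ ⌉) , uniform⇒ULi v₁
     , (λ π φ → ⌈ IsMeasure.exchangeable (Uniform.isMeasure v₂ q) π φ ⌉) , uniform⇒ULi v₂
     , λ φ → ⌈ ≃-trans (eq φ) (≃-trans (shift (F₁ q φ) (F₂ q φ) (F₀ q φ))
         (≃-trans (+-cong (eq₁ q φ) (neg-cong (eq₂ q φ))) (coefficients (V₁ q φ) (V₂ q φ)))) ⌉
    where
    0≤1 : 0ℚ ℚ.≤ 1ℚ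
    0≤1 = ℚ.<⇒≤ (ℚ.positive⁻¹ 1ℚ)
    mass : ∀ {s F} → Uniform s F → F q ⊤ᶠ ≃ fromℚ s
    mass u = IsMeasure.tautology (Uniform.isMeasure u q) ⊤ᶠ _
    0≤s₂ : 0ℚ ℚ.≤ s₂
    0≤s₂ = fromℚ-cancel-≼ (≼-trans (IsMeasure.nonNegative (Uniform.isMeasure u₂ q) ⊤ᶠ) (≼-reflexive (mass u₂)))
    1≡s₁-s₂ : 1ℚ ≡ s₁ ℚ.- s₂
    1≡s₁-s₂ = fromℚ-injective (≃-trans (≃-sym (IsMeasure.tautology (isMeasure⁺ w ex) ⊤ᶠ _))
      (≃-trans (eq ⊤ᶠ) (≃-trans (+-cong (mass u₁) (neg-cong (mass u₂))) (pointwise λ _ → refl))))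
    s₁≡1+s₂ : s₁ ≡ 1ℚ ℚ.+ s₂
    s₁≡1+s₂ = trans (solve 2 (λ a b → a := (a :- b) :+ b) refl s₁ s₂) (cong (ℚ._+ s₂) (sym 1≡s₁-s₂))
    0<s₁ : 0ℚ ℚ.< s₁
    0<s₁ = ≡.subst (0ℚ ℚ.<_) (sym s₁≡1+s₂) (ℚ.+-mono-<-≤ (ℚ.positive⁻¹ 1ℚ) 0≤s₂)
    shift : ∀ x y z → x - y ≃ (x + z) - (y + z)
    shift x y z = pointwise λ n → solve 3 (λ a b c → a :- b := (a :+ c) :- (b :+ c)) refl (seq x n) (seq y n) (seq z n)
    coefficients : ∀ x y → (s₁ ℚ.+ 1ℚ) · x - (s₂ ℚ.+ 1ℚ) · y ≃ (1ℝ + fromℚ (s₂ ℚ.+ 1ℚ)) * x - fromℚ (s₂ ℚ.+ 1ℚ) * y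
    coefficients x y = pointwise λ n → cong (λ s → s ℚ.* seq x n ℚ.- (s₂ ℚ.+ 1ℚ) ℚ.* seq y n)
      (trans (cong (ℚ._+ 1ℚ) s₁≡1+s₂) (ℚ.+-assoc 1ℚ s₂ 1ℚ))
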